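{- Let $k \geq 2$ be an integer and let $G$ be a $k$-connected $(K_2 \cup kK_1)$-free graph with minimum degree $\delta(G) \geq \frac{3(k-1)}{2}$ and independence number $\alpha(G) \leq \frac{|V(G)|}{2}$. Then $G$ is hamiltonian or $G$ is the Petersen graph.
   Context: All graphs are finite, undirected and simple. $K_2 \cup kK_1$ denotes the disjoint union of one edge $K_2$ and $k$ isolated vertices. A graph $G$ is $(K_2 \cup kK_1)$-free if it contains no induced subgraph isomorphic to $K_2 \cup kK_1$. $\delta(G)$ is the minimum degree and $\alpha(G)$ the independence number of $G$. A graph is hamiltonian if it contains a spanning cycle. -}

module Defs where

open import Data.Nat using (ℕ; zero; suc; _+_; _*_; _∸_; _≤_; _<_; _⊔_; _≡ᵇ_)
open import Data.Bool using (Bool; true; false; _∧_; _∨_; not; if_then_else_)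
open import Data.Bool.Properties using (∨-comm)
open import Data.Fin using (Fin; toℕ; zero; suc)
open import Data.Fin.Subset using (Subset; _∈_; _∉_; ∣_∣)
open import Data.Vec using (Vec; []; _∷_; lookup)
open import Data.List using (List; []; _∷_; map; _++_; foldr; allFin)
open import Data.Nat.ListAction using (sum)
open import Data.Bool.ListAction using (any; all)
open import Data.Empty using (⊥)
open import Data.Product using (Σ; _×_; _,_)
open import Data.Sum using (_⊎_)
open import Function.Definitions using (Injective)
open import Function.Bundles using (_↔_; Inverse)
open import Relation.Binary.PropositionalEquality using (_≡_; refl)

record Graph (n : ℕ) : Set where
  field
    adj    : Fin n → Fin n → Bool
    sym    : ∀ u v → adj u v ≡ adj v u
    irrefl : ∀ u → adj u u ≡ false
open Graph public

module _ {n : ℕ} (G : Graph n) where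

  degree : Fin n → ℕ
  degree v = sum (map (λ u → if adj G v u then 1 else 0) (allFin n))

  isIndependent : Subset n → Bool
  isIndependent S =
    all (λ u → all (λ v → not (lookup S u ∧ lookup S v ∧ adj G u v)) (allFin n)) (allFin n)

allSubsets : (n : ℕ) → List (Subset n)
allSubsets zero = [] ∷ []
allSubsets (suc n) = map (true ∷_) (allSubsets n) ++ map (false ∷_) (allSubsets n)

α : ∀ {n} → Graph n → ℕ
α {n} G = foldr _⊔_ 0
  (map (λ S → if isIndependent G S then ∣ S ∣ else 0) (allSubsets n))

-- Walks in G − S: u and v are joined by a walk all of whose vertices avoid S
-- (the starting vertex u is required separately to avoid S).
data ConnectedIn {n : ℕ} (G : Graph n) (S : Subset n) : Fin n → Fin n → Set where
  here : ∀ {u} → ConnectedIn G S u u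
  step : ∀ {u w v} → adj G u w ≡ true → w ∉ S → ConnectedIn G S w v → ConnectedIn G S u v

KConnected : ℕ → ∀ {n} → Graph n → Set
KConnected k {n} G =
  k < n × (∀ (S : Subset n) → ∣ S ∣ < k → ∀ u v → u ∉ S → v ∉ S → ConnectedIn G S u v)

InducedCopy : ∀ {m n} → Graph m → Graph n → Set
InducedCopy {m} {n} H G =
  Σ (Fin m → Fin n) λ φ → Injective _≡_ _≡_ φ × (∀ i j → adj G (φ i) (φ j) ≡ adj H i j)

Free : ∀ {m n} → Graph m → Graph n → Set
Free H G = InducedCopy H G → ⊥

K2∪kK1 : (k : ℕ) → Graph (2 + k)
K2∪kK1 k = record { adj = e ; sym = s ; irrefl = ir }
  where
    e : Fin (2 + k) → Fin (2 + k) → Bool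
    e zero (suc zero) = true
    e (suc zero) zero = true
    e _ _ = false
    s : ∀ u v → e u v ≡ e v u
    s zero zero = refl
    s zero (suc zero) = refl
    s zero (suc (suc v)) = refl
    s (suc zero) zero = refl
    s (suc zero) (suc zero) = refl
    s (suc zero) (suc (suc v)) = refl
    s (suc (suc u)) zero = refl
    s (suc (suc u)) (suc zero) = refl
    s (suc (suc u)) (suc (suc v)) = refl
    ir : ∀ u → e u u ≡ false
    ir zero = refl
    ir (suc zero) = refl
    ir (suc (suc u)) = refl

-- Hamiltonian: n ≥ 3 and an injective (hence bijective) cyclic ordering σ of the
-- vertices with σ i adjacent to σ (i+1), and σ (n-1) adjacent to σ 0.
Hamiltonian : ∀ {n} → Graph n → Set
Hamiltonian {n} G =
  3 ≤ n × Σ (Fin n → Fin n) λ σ → Injective _≡_ _≡_ σ ×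
    (∀ i j → (toℕ j ≡ suc (toℕ i) ⊎ (toℕ i ≡ n ∸ 1 × toℕ j ≡ 0)) → adj G (σ i) (σ j) ≡ true)

-- The Petersen graph: outer 5-cycle 0..4, spokes i–(i+5), inner pentagram on 5..9.
petersenEdges : List (ℕ × ℕ)
petersenEdges =
  (0 , 1) ∷ (1 , 2) ∷ (2 , 3) ∷ (3 , 4) ∷ (4 , 0) ∷
  (0 , 5) ∷ (1 , 6) ∷ (2 , 7) ∷ (3 , 8) ∷ (4 , 9) ∷
  (5 , 7) ∷ (7 , 9) ∷ (9 , 6) ∷ (6 , 8) ∷ (8 , 5) ∷ []

petersenEdge : Fin 10 → Fin 10 → Bool
petersenEdge u v = any (λ { (a , b) → (a ≡ᵇ toℕ u) ∧ (b ≡ᵇ toℕ v) }) petersenEdges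

petersen : Graph 10
petersen = record
  { adj = λ u v → petersenEdge u v ∨ petersenEdge v u
  ; sym = λ u v → ∨-comm (petersenEdge u v) (petersenEdge v u)
  ; irrefl = ir }
  where
    ir : ∀ u → petersenEdge u u ∨ petersenEdge u u ≡ false
    ir zero = refl
    ir (suc zero) = refl
    ir (suc (suc zero)) = refl
    ir (suc (suc (suc zero))) = refl
    ir (suc (suc (suc (suc zero)))) = refl
    ir (suc (suc (suc (suc (suc zero))))) = refl
    ir (suc (suc (suc (suc (suc (suc zero)))))) = refl
    ir (suc (suc (suc (suc (suc (suc (suc zero))))))) = refl
    ir (suc (suc (suc (suc (suc (suc (suc (suc zero)))))))) = refl
    ir (suc (suc (suc (suc (suc (suc (suc (suc (suc zero))))))))) = refl

Isomorphic : ∀ {m n} → Graph m → Graph n → Set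
Isomorphic {m} {n} G H =
  Σ (Fin m ↔ Fin n) λ f → ∀ u v → adj H (Inverse.to f u) (Inverse.to f v) ≡ adj G u v

IsPetersen : ∀ {n} → Graph n → Set
IsPetersen G = Isomorphic G petersen

{-# OPTIONS --safe #-}
module Submission where

-- Let C be a longest cycle, x a vertex off C, and d the number of neighbours of x, all of which lie on C.
-- Freeness and k-connectivity make the vertices off C independent.  The successors of the neighbours
-- of x together with x form an independent set; let Z be the set of all vertices without a neighbour in it.
-- By freeness Z is independent, and every vertex outside Z misses fewer than k vertices of Z; the same
-- holds for the set Z⁻ obtained from the predecessors.  For two consecutive vertices of C not adjacent to x,
-- rerouting C through x orders the positions of their neighbours among these successors and predecessors,
-- and since d ≥ 3(k-1)/2 three large sets of positions cannot be ordered in a chain.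
-- If all predecessors lie in Z, then Z contains more than half of the vertices, against α(G) ≤ n/2.
-- Otherwise counting the vertices of Z missed by a predecessor outside Z yields two neighbours of x at
-- distance three on C.  With a, b the vertices between them, sending a neighbour of a to its successor
-- injects (up to two exceptions) N(a) into the part of Z missed by b, so 3(k-1)/2 ≤ deg a ≤ k; this
-- forces k = d = 3, |C| = 9, and G is the Petersen graph.

open import Defs renaming (sym to adj-sym; irrefl to adj-irrefl)
open import Data.Nat using (ℕ; zero; suc; _+_; _*_; _∸_; _⊔_; _/_; _%_; _≤_; _<_; _<ᵇ_; _≡ᵇ_; z≤n; s≤s; _≤?_; _<?_; _≟_)
open import Data.Nat.Properties using (<ᵇ⇒<; m∸n≤m; +-cancelʳ-<; +-monoʳ-<; m∸n+n≡m; ≤-refl; ≤-trans; ≤-reflexive; ≤-antisym; ≤-pred; <⇒≤; <⇒≢; <-irrefl; <-trans; <-≤-trans; ≤-<-trans; ≰⇒>; ≮⇒≥; ≤∧≢⇒<; n≤1+n; m≤n⇒m≤1+n; m≤m+n; m≤n+m; m≤n⇒m<n∨m≡n; m+[n∸m]≡n; m+n∸m≡n; +-mono-≤; +-monoˡ-≤; +-monoʳ-≤; +-suc; +-comm; +-assoc; +-identityʳ; +-cancelʳ-≡; suc-injective; <-cmp; m≤m⊔n; m≤n⊔m)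
open import Data.Nat.DivMod using (m≡m%n+[m/n]*n; m%n<n)
open import Data.Nat.Induction using (<-rec)
open import Data.Nat.Tactic.RingSolver using (solve)
open import Data.Bool.Properties using () renaming (_≟_ to _≟ᵇ_)
open import Data.Bool using (Bool; true; false; _∧_; _∨_; not; if_then_else_; T)
open import Data.Bool.ListAction using (all)
open import Data.Nat.ListAction using (sum)
open import Data.Empty using (⊥; ⊥-elim)
open import Data.Unit using (tt)
open import Data.Product using (∃; _×_; _,_; proj₁; proj₂)
open import Data.Sum using (_⊎_; inj₁; inj₂; [_,_]′)
open import Data.Fin using (Fin; zero; suc; toℕ; fromℕ<; inject≤; #_)
open import Data.Fin.Properties using (all?; any?; inject≤-injective; toℕ-injective; toℕ<n; toℕ-fromℕ<) renaming (_≟_ to _≟ᶠ_)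
open import Data.Fin.Subset using (Subset; ∣_∣; ⁅_⁆) renaming (_∈_ to _∈ˢ_; _∉_ to _∉ˢ_)
open import Data.Fin.Subset.Properties using (x∈⁅x⁆; x∈⁅y⁆⇒x≡y; ∣⁅x⁆∣≡1)
open import Data.Vec using (Vec; lookup; tabulate)
open import Data.Vec.Properties using (lookup∘tabulate; []=⇒lookup; lookup⇒[]=)
open import Data.List using (List; []; _∷_; [_]; map; _++_; length; null; allFin; foldr) renaming (lookup to nth; tabulate to tabulateᴸ)
open import Data.List.Properties using (length-map; length-++; map-++; length-tabulate)
open import Data.List.Membership.Propositional using (_∈_; _∉_)
open import Data.List.Membership.Propositional.Properties using (∈-map⁺; ∈-map⁻; ∈-++⁺ˡ; ∈-++⁺ʳ; ∈-∃++; ∈-allFin; ∈-lookup)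
import Data.List.Membership.DecPropositional as DecMembership
open import Data.List.Relation.Unary.Any using (here; there)
open import Data.List.Relation.Unary.All using (All) renaming ([] to []ᵃ; _∷_ to _∷ᵃ_)
import Data.List.Relation.Unary.All as All
import Data.List.Relation.Unary.All.Properties as All
open import Data.List.Relation.Unary.AllPairs using () renaming ([] to []ᵘ; _∷_ to _∷ᵘ_)
open import Data.List.Relation.Unary.Unique.Propositional using (Unique)
open import Data.List.Relation.Unary.Unique.Propositional.Properties using (allFin⁺) renaming (++⁺ to Unique-++⁺)
import Data.List.Relation.Unary.Unique.DecPropositional as DecUnique
open import Data.List.Relation.Binary.Permutation.Propositional using (_↭_; ↭-refl; ↭-sym; ↭-trans; ↭-reflexive; prep; swap)
open import Data.List.Relation.Binary.Permutation.Propositional.Properties using (↭-length; ∈-resp-↭; shift; ++-commutativeMonoid) renaming (++⁺ to ↭-++⁺; ++-comm to ↭-++-comm)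
import Algebra.Solver.CommutativeMonoid as CommutativeMonoidSolver
open import Function using (_∘_; id; case_of_)
open import Function.Bundles using (mk↔ₛ′)
open import Relation.Binary.PropositionalEquality using (_≡_; _≢_; refl; sym; trans; cong; cong₂; subst; subst₂; ≢-sym)
open import Relation.Binary.Definitions using (tri<; tri≈; tri>)
open import Relation.Nullary using (¬_; Dec; yes; no; does)
open import Relation.Nullary.Decidable using (map′; _×-dec_; dec-true; toWitness; ¬?; decidable-stable)

-- Write `k = suc k'`. A vertex outside Z that is not adjacent to x hits at least `d + 1 - k'` of
-- the `d` successors, since x is itself one of the vertices of Z that it misses. Three position
-- sets of that size, each weakly before the next, share at most one position per junction, so
-- `3 (d + 1 - k') ≤ d + 2`, that is `2 d < 3 k'`: this is where the degree bound comes from. Z can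
-- be compared with its complement by a shift along C only if no two consecutive vertices lie
-- outside Z. The obstacle is a predecessor b outside Z. It is met by the same inequality in another
-- guise: some vertex v hits many successors, and in the gap after each of them, except perhaps the
-- last, b misses two vertices of Z. Distance three to the next neighbour of x is the one length for
-- which no second missed vertex is found, and there the Petersen graph enters.

private variable
  A B : Set

lit : ∀ {t} i j {p : T (i <ᵇ j)} → i + t < j + t
lit {t} i j {p} = +-monoˡ-≤ t (<ᵇ⇒< i j p)

lit₀ : ∀ i j {p : T (i <ᵇ j)} → i < j
lit₀ i j {p} = <ᵇ⇒< i j p

-- A system of inequalities is refuted by adding them up with _⊕_ and comparing both sides with the ring solver.
lin : ∀ {a b} m → a ≤ b → a ≡ suc (m + b) → ⊥
lin {b = b} m a≤b refl = <-irrefl refl (<-≤-trans (s≤s (m≤n+m b m)) a≤b)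

infixr 5 _⊕_
_⊕_ : ∀ {a b c d} → a ≤ b → c ≤ d → a + c ≤ b + d
_⊕_ = +-mono-≤

true≢false : ∀ {b} → b ≡ true → b ≡ false → ⊥
true≢false refl ()

∧-split : ∀ {a b} → a ∧ b ≡ true → a ≡ true × b ≡ true
∧-split {true} e = refl , e

not-true⇒false : ∀ {b} → not b ≡ true → b ≡ false
not-true⇒false {false} _ = refl

bool-split : (b : Bool) → b ≡ true ⊎ b ≡ false
bool-split true = inj₁ refl
bool-split false = inj₂ refl

-- Lists without repetition

Unique-⊆⇒length≤ : {xs ys : List A} → Unique xs → (∀ {v} → v ∈ xs → v ∈ ys) → length xs ≤ length ys
Unique-⊆⇒length≤ {xs = []} _ _ = z≤n
Unique-⊆⇒length≤ {xs = x ∷ xs} (x∉ ∷ᵘ u) sub with ∈-∃++ (sub (here refl))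
... | as , bs , refl = subst (suc (length xs) ≤_) (sym (↭-length (shift x as bs)))
    (s≤s (Unique-⊆⇒length≤ u (λ v∈ → drop-x (All.lookup x∉ v∈) (∈-resp-↭ (shift x as bs) (sub (there v∈))))))
  where
    drop-x : ∀ {v ws} → x ≢ v → v ∈ x ∷ ws → v ∈ ws
    drop-x x≢v (here e) = ⊥-elim (x≢v (sym e))
    drop-x _ (there m) = m

Unique-↭ : {xs ys : List A} → xs ↭ ys → Unique xs → Unique ys
Unique-↭ _↭_.refl u = u
Unique-↭ (prep x p) (x∉ ∷ᵘ u) = All.tabulate (λ v∈ → All.lookup x∉ (∈-resp-↭ (↭-sym p) v∈)) ∷ᵘ Unique-↭ p u
Unique-↭ (swap x y p) ((x≢y ∷ᵃ x∉) ∷ᵘ y∉ ∷ᵘ u) =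
  (≢-sym x≢y ∷ᵃ All.tabulate (λ v∈ → All.lookup y∉ (∈-resp-↭ (↭-sym p) v∈)))
  ∷ᵘ All.tabulate (λ v∈ → All.lookup x∉ (∈-resp-↭ (↭-sym p) v∈)) ∷ᵘ Unique-↭ p u
Unique-↭ (_↭_.trans p q) u = Unique-↭ q (Unique-↭ p u)

Unique-map : (f : A → B) {xs : List A} → (∀ {p q} → p ∈ xs → q ∈ xs → f p ≡ f q → p ≡ q) →
  Unique xs → Unique (map f xs)
Unique-map f {[]} inj u = []ᵘ
Unique-map f {x ∷ xs} inj (x∉ ∷ᵘ u) =
  All.tabulate (λ v∈ e → let (q , q∈ , v≡) = ∈-map⁻ f v∈ in
    All.lookup x∉ q∈ (inj (here refl) (there q∈) (trans e v≡)))
  ∷ᵘ Unique-map f (λ p q → inj (there p) (there q)) u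

sel : (A → Bool) → List A → List A
sel P [] = []
sel P (x ∷ xs) = if P x then x ∷ sel P xs else sel P xs

∈-sel⁻ : (P : A → Bool) {v : A} (xs : List A) → v ∈ sel P xs → v ∈ xs × P v ≡ true
∈-sel⁻ P (x ∷ xs) m with P x in eq
∈-sel⁻ P (x ∷ xs) (here refl) | true = here refl , eq
∈-sel⁻ P (x ∷ xs) (there m) | true = let (i , e) = ∈-sel⁻ P xs m in there i , e
∈-sel⁻ P (x ∷ xs) m | false = let (i , e) = ∈-sel⁻ P xs m in there i , e

∈-sel⁺ : (P : A → Bool) {v : A} (xs : List A) → v ∈ xs → P v ≡ true → v ∈ sel P xs
∈-sel⁺ P (x ∷ xs) m e with P x in eq
∈-sel⁺ P (x ∷ xs) (here refl) e | true = here refl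
∈-sel⁺ P (x ∷ xs) (there m) e | true = there (∈-sel⁺ P xs m e)
∈-sel⁺ P (x ∷ xs) (here refl) e | false = ⊥-elim (true≢false e eq)
∈-sel⁺ P (x ∷ xs) (there m) e | false = ∈-sel⁺ P xs m e

Unique-sel : (P : A → Bool) {xs : List A} → Unique xs → Unique (sel P xs)
Unique-sel P {[]} u = []ᵘ
Unique-sel P {x ∷ xs} (x∉ ∷ᵘ u) with P x
... | true = All.tabulate (λ v∈ → All.lookup x∉ (proj₁ (∈-sel⁻ P xs v∈))) ∷ᵘ Unique-sel P u
... | false = Unique-sel P u

length-sel-split : (P Q : A → Bool) (xs : List A) →
  length (sel P xs) ≡ length (sel (λ p → P p ∧ Q p) xs) + length (sel (λ p → P p ∧ not (Q p)) xs)
length-sel-split P Q [] = refl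
length-sel-split P Q (x ∷ xs) with P x | Q x
... | true | true = cong suc (length-sel-split P Q xs)
... | true | false = trans (cong suc (length-sel-split P Q xs)) (sym (+-suc _ _))
... | false | _ = length-sel-split P Q xs

nonempty : (xs : List A) → 1 ≤ length xs → ∃ λ v → v ∈ xs
nonempty (x ∷ xs) _ = x , here refl

-- Windows of positions and counting in them

range : ℕ → ℕ → List ℕ
range s zero = []
range s (suc m) = s ∷ range (suc s) m

∈-range⁻ : ∀ {p} s m → p ∈ range s m → s ≤ p × p < s + m
∈-range⁻ s (suc m) (here refl) = ≤-refl , subst (s <_) (sym (+-suc s m)) (s≤s (m≤m+n s m))
∈-range⁻ {p} s (suc m) (there i) = let (a , b) = ∈-range⁻ (suc s) m i in
  <⇒≤ a , subst (p <_) (sym (+-suc s m)) b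

∈-range⁺ : ∀ {p} s m → s ≤ p → p < s + m → p ∈ range s m
∈-range⁺ {p} s zero a b = ⊥-elim (<-irrefl refl (≤-<-trans a (subst (p <_) (+-identityʳ s) b)))
∈-range⁺ {p} s (suc m) a b with m≤n⇒m<n∨m≡n a
... | inj₁ s<p = there (∈-range⁺ (suc s) m s<p (subst (p <_) (+-suc s m) b))
... | inj₂ refl = here refl

Unique-range : ∀ s m → Unique (range s m)
Unique-range s zero = []ᵘ
Unique-range s (suc m) = All.tabulate (λ v∈ e → <⇒≢ (proj₁ (∈-range⁻ (suc s) m v∈)) e) ∷ᵘ Unique-range (suc s) m

length-range : ∀ s m → length (range s m) ≡ m
length-range s zero = refl
length-range s (suc m) = cong suc (length-range (suc s) m)

range-∷ʳ : ∀ s m → range s (suc m) ≡ range s m ++ [ s + m ]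
range-∷ʳ s zero = cong [_] (sym (+-identityʳ s))
range-∷ʳ s (suc m) = cong (s ∷_) (trans (range-∷ʳ (suc s) m) (cong (λ t → range (suc s) m ++ [ t ]) (sym (+-suc s m))))

range-++ : ∀ s m m' → range s (m + m') ≡ range s m ++ range (s + m) m'
range-++ s zero m' = cong (λ t → range t m') (sym (+-identityʳ s))
range-++ s (suc m) m' = cong (s ∷_) (trans (range-++ (suc s) m m') (cong (λ t → range (suc s) m ++ range t m') (sym (+-suc s m))))

first : (P : ℕ → Bool) (s m p : ℕ) → s ≤ p → p < s + m → P p ≡ true →
  ∃ λ q → s ≤ q × q ≤ p × P q ≡ true × (∀ i → s ≤ i → i < q → P i ≡ false)
first P s zero p a b e = ⊥-elim (<-irrefl refl (≤-<-trans a (subst (p <_) (+-identityʳ s) b)))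
first P s (suc m) p a b e with P s in eq
... | true = s , ≤-refl , a , eq , λ i l r → ⊥-elim (<-irrefl refl (≤-<-trans l r))
... | false with m≤n⇒m<n∨m≡n a
... | inj₂ refl = ⊥-elim (true≢false e eq)
... | inj₁ s<p with first P (suc s) m p s<p (subst (p <_) (+-suc s m) b) e
... | q , l , r , e' , h = q , <⇒≤ l , r , e' , go
  where
    go : ∀ i → s ≤ i → i < q → P i ≡ false
    go i si iq with m≤n⇒m<n∨m≡n si
    ... | inj₁ s<i = h i s<i iq
    ... | inj₂ refl = eq

cnt : (ℕ → Bool) → ℕ → ℕ → ℕ
cnt P s m = length (sel P (range s m))

cnt-mono : (P Q : ℕ → Bool) (s m : ℕ) → (∀ p → P p ≡ true → Q p ≡ true) → cnt P s m ≤ cnt Q s m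
cnt-mono P Q s zero h = z≤n
cnt-mono P Q s (suc m) h with P s in e | Q s in e'
... | true | true = s≤s (cnt-mono P Q (suc s) m h)
... | true | false = ⊥-elim (true≢false (h s e) e')
... | false | true = m≤n⇒m≤1+n (cnt-mono P Q (suc s) m h)
... | false | false = cnt-mono P Q (suc s) m h

cnt-zero : (P : ℕ → Bool) (s m : ℕ) → (∀ p → s ≤ p → p < s + m → P p ≡ true → ⊥) → cnt P s m ≡ 0
cnt-zero P s zero h = refl
cnt-zero P s (suc m) h with P s in e
... | true = ⊥-elim (h s ≤-refl (subst (s <_) (sym (+-suc s m)) (s≤s (m≤m+n s m))) e)
... | false = cnt-zero P (suc s) m (λ p a b → h p (<⇒≤ a) (subst (p <_) (sym (+-suc s m)) b))

-- The comparison is weak, so the two sets may share one position. It is vacuous if one of them is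
-- empty, hence not transitive in general.
_≼_within_,_ : (P Q : ℕ → Bool) → ℕ → ℕ → Set
P ≼ Q within s , m = ∀ {p q} → s ≤ p → p < s + m → s ≤ q → q < s + m → P p ≡ true → Q q ≡ true → p ≤ q

-- A common position is the last of `P` and the first of `Q`, so there is at most one; the `suc`
-- pays for it.
cnt-≼ : (P Q R : ℕ → Bool) (s m : ℕ) → (∀ p → P p ≡ true → R p ≡ true) → (∀ p → Q p ≡ true → R p ≡ true) →
  P ≼ Q within s , m → cnt P s m + cnt Q s m ≤ suc (cnt R s m)
cnt-≼ P Q R s zero hP hQ o = z≤n
cnt-≼ P Q R s (suc m) hP hQ o with Q s in eQ
... | true = helper
  where
    bound : ∀ {p} → p < suc s + m → p < s + suc m
    bound {p} = subst (p <_) (sym (+-suc s m))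
    none : cnt P (suc s) m ≡ 0
    none = cnt-zero P (suc s) m (λ p a b e →
      <-irrefl refl (<-≤-trans a (o (<⇒≤ a) (bound b) ≤-refl (bound (s≤s (m≤m+n s m))) e eQ)))
    tail : cnt Q (suc s) m ≤ cnt R (suc s) m
    tail = cnt-mono Q R (suc s) m hQ
    helper : cnt P s (suc m) + suc (cnt Q (suc s) m) ≤ suc (cnt R s (suc m))
    helper with P s | R s in eR
    ... | true | true rewrite none = s≤s (s≤s tail)
    ... | false | true rewrite none = s≤s (m≤n⇒m≤1+n tail)
    ... | _ | false = ⊥-elim (true≢false (hQ s eQ) eR)
... | false = helper
  where
    bound : ∀ {p} → p < suc s + m → p < s + suc m
    bound {p} = subst (p <_) (sym (+-suc s m))
    rec : cnt P (suc s) m + cnt Q (suc s) m ≤ suc (cnt R (suc s) m)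
    rec = cnt-≼ P Q R (suc s) m hP hQ (λ a b c d → o (<⇒≤ a) (bound b) (<⇒≤ c) (bound d))
    helper : cnt P s (suc m) + cnt Q (suc s) m ≤ suc (cnt R s (suc m))
    helper with P s in eP | R s in eR
    ... | true | true = s≤s rec
    ... | true | false = ⊥-elim (true≢false (hP s eP) eR)
    ... | false | true = m≤n⇒m≤1+n rec
    ... | false | false = rec

∨-left : ∀ {a b} → a ≡ true → a ∨ b ≡ true
∨-left refl = refl

∨-right : ∀ {a b} → b ≡ true → a ∨ b ≡ true
∨-right {true} refl = refl
∨-right {false} refl = refl

∨-case : ∀ {a b} → a ∨ b ≡ true → a ≡ true ⊎ b ≡ true
∨-case {true} e = inj₁ refl
∨-case {false} e = inj₂ e

-- The comparison of `P` with `O` passes through an element of `Q`, which is why `Q` must have one.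
-- Each of the two junctions may cost one common position.
cnt-≼-≼ : (P Q O R : ℕ → Bool) (s m : ℕ) → (∀ p → P p ≡ true → R p ≡ true) →
  (∀ p → Q p ≡ true → R p ≡ true) → (∀ p → O p ≡ true → R p ≡ true) → 1 ≤ cnt Q s m →
  P ≼ Q within s , m → Q ≼ O within s , m → cnt P s m + (cnt Q s m + cnt O s m) ≤ 2 + cnt R s m
cnt-≼-≼ P Q O R s m hP hQ hO ne o₁ o₂ =
  ≤-trans (+-monoʳ-≤ (cnt P s m) (cnt-≼ Q O Q∨O s m (λ _ → ∨-left) (λ p → ∨-right {Q p}) o₂))
    (subst (_≤ 2 + cnt R s m) (sym (+-suc _ _))
      (s≤s (cnt-≼ P Q∨O R s m hP (λ p e → [ hQ p , hO p ]′ (∨-case {Q p} e)) o₁₂)))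
  where
    Q∨O : ℕ → Bool
    Q∨O p = Q p ∨ O p
    o₁₂ : P ≼ Q∨O within s , m
    o₁₂ {p} {q} a b c d e f with ∨-case {Q q} f
    ... | inj₁ g = o₁ a b c d e g
    ... | inj₂ g with nonempty _ ne
    ... | r , r∈ with ∈-sel⁻ Q _ r∈
    ... | i , h with ∈-range⁻ s m i
    ... | x , y = ≤-trans (o₁ a b x y e h) (o₂ x y c d h g)

two-elements : (P : ℕ → Bool) (s m : ℕ) → 2 ≤ cnt P s m →
  ∃ λ p → ∃ λ q → s ≤ p × p < q × q < s + m × P p ≡ true × P q ≡ true
two-elements P s (suc m) h with P s in e
... | false with two-elements P (suc s) m h
... | p , q , a , b , c , d , f = p , q , <⇒≤ a , b , subst (q <_) (sym (+-suc s m)) c , d , f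
two-elements P s (suc m) (s≤s h) | true with nonempty _ h
... | q , q∈ with ∈-sel⁻ P _ q∈
... | i , g with ∈-range⁻ (suc s) m i
... | x , y = s , q , ≤-refl , x , subst (q <_) (sym (+-suc s m)) y , e , g

cnt-lower : (P : ℕ → Bool) (s m : ℕ) (ps : List ℕ) → Unique ps →
  All (λ p → s ≤ p × p < s + m × P p ≡ true) ps → length ps ≤ cnt P s m
cnt-lower P s m ps u h = Unique-⊆⇒length≤ u (λ v∈ → let (a , b , e) = All.lookup h v∈ in
  ∈-sel⁺ P _ (∈-range⁺ s m a b) e)

-- Paths and longest cycles

module _ {n : ℕ} (G : Graph n) where

  data Path : Fin n → Fin n → List (Fin n) → Set where
    stop : ∀ {u} → Path u u (u ∷ [])
    go   : ∀ {u w v vs} → adj G u w ≡ true → Path w v vs → Path u v (u ∷ vs)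

module _ {n : ℕ} {G : Graph n} where

  ~-sym : ∀ {u v b} → adj G u v ≡ b → adj G v u ≡ b
  ~-sym {u} {v} e = trans (adj-sym G v u) e

  ~⇒≢ : ∀ {u v} → adj G u v ≡ true → u ≢ v
  ~⇒≢ {u} e refl = true≢false e (adj-irrefl G u)

  ¬~⇒≁ : ∀ {u v} → (adj G u v ≡ true → ⊥) → adj G u v ≡ false
  ¬~⇒≁ {u} {v} f with adj G u v
  ... | true = ⊥-elim (f refl)
  ... | false = refl

  Path-++ : ∀ {u v w z us vs} → Path G u v us → adj G v w ≡ true → Path G w z vs → Path G u z (us ++ vs)
  Path-++ stop e q = go e q
  Path-++ (go f p) e q = go f (Path-++ p e q)

  Path-reverse : ∀ {u v us} → Path G u v us → ∃ λ vs → Path G v u vs × vs ↭ us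
  Path-reverse stop = _ , stop , ↭-refl
  Path-reverse {u} (go {vs = us} e p) = let (vs , q , π) = Path-reverse p in
    vs ++ [ u ] , Path-++ q (~-sym e) stop , ↭-trans (↭-++-comm vs [ u ]) (prep u π)

  -- Only the multiset of visited vertices is kept. A rerouted cycle is then a chain of segments,
  -- and that it covers the old cycle is a statement on permutations.
  Visit : Fin n → Fin n → List (Fin n) → Set
  Visit u v vs = ∃ λ us → Path G u v us × us ↭ vs

  visit : ∀ {u v vs} → Path G u v vs → Visit u v vs
  visit p = _ , p , ↭-refl

  pt : ∀ u → Visit u u [ u ]
  pt u = visit stop

  back : ∀ {u v vs} → Visit u v vs → Visit v u vs
  back (us , p , π) = let (ws , q , ρ) = Path-reverse p in ws , q , ↭-trans ρ π

  infixr 4 _⟨_⟩_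
  _⟨_⟩_ : ∀ {u v w z us vs} → Visit u v us → adj G v w ≡ true → Visit w z vs → Visit u z (us ++ vs)
  (_ , p , π) ⟨ e ⟩ (_ , q , ρ) = _ , Path-++ p e q , ↭-++⁺ π ρ

-- Positions are all natural numbers, with period `L`: the cycle can be cut open anywhere, every
-- window of `L` positions lists it once, and inside a window positions are compared by `<`.
record LongestCycle {n : ℕ} (G : Graph n) : Set where
  field
    L       : ℕ
    1≤L     : 1 ≤ L
    c       : ℕ → Fin n
    c-per   : ∀ i → c (i + L) ≡ c i
    c-adj   : ∀ i → adj G (c i) (c (suc i)) ≡ true
    c-uniq  : ∀ s → Unique (map c (range s L))
    longest : ∀ {u v vs} → Path G u v vs → adj G v u ≡ true → Unique vs → L < length vs → ⊥

module Cyc {n : ℕ} {G : Graph n} (C : LongestCycle G) where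
  open LongestCycle C public

  infix 3 _~_ _≁_
  _~_ _≁_ : Fin n → Fin n → Set
  u ~ v = adj G u v ≡ true
  u ≁ v = adj G u v ≡ false

  Off : Fin n → Set
  Off v = ∀ i → v ≢ c i

  s<s+L : ∀ s → s < s + L
  s<s+L s = subst (_≤ s + L) (+-comm s 1) (+-monoʳ-≤ s 1≤L)

  -- The segment from `p` to `q`, both ends included. For `q < p` truncated subtraction leaves the
  -- single vertex `c p`, so its lemmas ask for `p ≤ q`.
  I : ℕ → ℕ → List (Fin n)
  I p q = map c (range p (suc (q ∸ p)))

  I-≡ : ∀ p m → I p (p + m) ≡ map c (range p (suc m))
  I-≡ p m = cong (λ t → map c (range p (suc t))) (m+n∸m≡n p m)

  path-up : ∀ p m → Path G (c p) (c (p + m)) (map c (range p (suc m)))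
  path-up p zero = subst (λ t → Path G (c p) (c t) [ c p ]) (sym (+-identityʳ p)) stop
  path-up p (suc m) = go (c-adj p) (subst (λ t → Path G (c (suc p)) (c t) (map c (range (suc p) (suc m)))) (sym (+-suc p m)) (path-up (suc p) m))

  up : ∀ {p q} → p ≤ q → Visit {G = G} (c p) (c q) (I p q)
  up {p} {q} p≤q = subst (λ t → Visit {G = G} (c p) (c t) (I p q)) (m+[n∸m]≡n p≤q) (visit (path-up p (q ∸ p)))

  down : ∀ {p q} → p ≤ q → Visit {G = G} (c q) (c p) (I p q)
  down p≤q = back (up p≤q)

  I-++ : ∀ {p q r} → p ≤ q → q < r → I p r ≡ I p q ++ I (suc q) r
  I-++ {p} {q} {r} p≤q q<r = helper p (q ∸ p) (r ∸ suc q) q r (sym (m+[n∸m]≡n p≤q)) (sym (m+[n∸m]≡n q<r))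
    where
      helper : ∀ p a b q r → q ≡ p + a → r ≡ suc q + b → I p r ≡ I p q ++ I (suc q) r
      helper p a b _ _ refl refl = trans (cong (I p) arith)
        (trans (I-≡ p (a + suc b))
        (trans (cong (map c) (trans (cong (λ t → range p t) refl) (range-++ p (suc a) (suc b))))
        (trans (map-++ c (range p (suc a)) (range (p + suc a) (suc b)))
        (cong₂ _++_ (sym (I-≡ p a)) (trans (cong (λ t → map c (range t (suc b))) (+-suc p a)) (sym (I-≡ (suc (p + a)) b)))))))
        where
          arith : suc (p + a) + b ≡ p + (a + suc b)
          arith = solve (p ∷ a ∷ b ∷ [])

  I-[_] : ∀ p → I p p ≡ [ c p ]
  I-[ p ] = cong (λ t → map c (range p (suc t))) (trans (cong (_∸ p) (sym (+-identityʳ p))) (m+n∸m≡n p 0))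

  window : ∀ s → I (suc s) (s + L) ≡ map c (range (suc s) L)
  window s with L | 1≤L
  ... | suc L' | _ = trans (cong (I (suc s)) (+-suc s L')) (I-≡ (suc s) L')

  c-inj : ∀ s {p q} → s ≤ p → p < q → q < s + L → c p ≢ c q
  c-inj s {p} {q} a b d e = helper (range s L) (c-uniq s) (∈-range⁺ s L a (<-trans b d)) (∈-range⁺ s L (≤-trans a (<⇒≤ b)) d)
    where
      helper : ∀ ps → Unique (map c ps) → p ∈ ps → q ∈ ps → ⊥
      helper (_ ∷ ps) _ (here refl) (here refl) = <-irrefl refl b
      helper (_ ∷ ps) (h ∷ᵘ u) (here refl) (there j) = All.lookup h (∈-map⁺ c j) e
      helper (_ ∷ ps) (h ∷ᵘ u) (there i) (here refl) = All.lookup h (∈-map⁺ c i) (sym e)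
      helper (_ ∷ ps) (h ∷ᵘ u) (there i) (there j) = helper ps u i j

  c-inj-≡ : ∀ s {p q} → s ≤ p → p < s + L → s ≤ q → q < s + L → c p ≡ c q → p ≡ q
  c-inj-≡ s {p} {q} a b a' b' e with <-cmp p q
  ... | tri≈ _ h _ = h
  ... | tri< h _ _ = ⊥-elim (c-inj s a h b' e)
  ... | tri> _ _ h = ⊥-elim (c-inj s a' h b (sym e))

  Unique-c : ∀ s {ps} → Unique ps → All (λ p → s ≤ p × p < s + L) ps → Unique (map c ps)
  Unique-c s u h = Unique-map c (λ i j → let (a , b) = All.lookup h i ; (a' , b') = All.lookup h j in c-inj-≡ s a b a' b') u

  -- Congruence modulo `L`, stated through `c` and for all shifts, so that it also transports
  -- statements on `c (e + p)` with a fixed offset `e`.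
  _≈_ : ℕ → ℕ → Set
  p ≈ q = ∀ i → c (i + p) ≡ c (i + q)

  shift-L : ∀ p → (p + L) ≈ p
  shift-L p i = trans (cong c (sym (+-assoc i p L))) (c-per (i + p))

  reduce₀ : ∀ p → ∃ λ q → q < L × p ≈ q
  reduce₀ zero = 0 , 1≤L , λ _ → refl
  reduce₀ (suc p) with reduce₀ p
  ... | q , q<L , h with m≤n⇒m<n∨m≡n q<L
  ... | inj₁ lt = suc q , lt , λ i → trans (cong c (+-suc i p)) (trans (h (suc i)) (cong c (sym (+-suc i q))))
  ... | inj₂ refl = 0 , 1≤L , λ i → trans (cong c (+-suc i p)) (trans (h (suc i)) (trans (cong c (trans (sym (+-suc i q)) (cong (_+ suc q) (sym (+-identityʳ i))))) (c-per (i + 0))))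

  reduce : ∀ s p → ∃ λ q → s ≤ q × q < s + L × p ≈ q
  reduce zero p = let (q , a , b) = reduce₀ p in q , z≤n , a , b
  reduce (suc s) p with reduce s p
  ... | q , a , b , h with m≤n⇒m<n∨m≡n a
  ... | inj₁ lt = q , lt , m≤n⇒m≤1+n b , h
  ... | inj₂ refl = s + L , s<s+L s , ≤-refl , λ i → trans (h i) (sym (shift-L s i))

  -- Every rerouting ends here: a closed path through the whole cycle, written as the window after
  -- `s`, and through some vertex off it would be longer.
  no-longer : ∀ {u v vs} s zs → Visit {G = G} u v vs → v ~ u → vs ↭ zs ++ I (suc s) (s + L) →
    Unique zs → All Off zs → 1 ≤ length zs → ⊥
  no-longer s zs (us , p , π) e ρ uz oz ne = longest p e
    (Unique-↭ (↭-sym (↭-trans π ρ)) (Unique-++⁺ uz (subst Unique (sym (window s)) (c-uniq (suc s))) disj))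
    (subst (L <_) (sym len) (+-monoˡ-≤ L ne))
    where
      disj : ∀ {v} → v ∈ zs × v ∈ I (suc s) (s + L) → ⊥
      disj (i , j) with ∈-map⁻ c j
      ... | q , _ , refl = All.lookup oz i q refl
      len : length us ≡ length zs + L
      len = trans (↭-length (↭-trans π ρ)) (trans (length-++ zs) (cong (length zs +_)
        (trans (cong length (window s)) (trans (length-map c (range (suc s) L)) (length-range (suc s) L)))))

-- The vertices off a longest cycle

nth-injective : {A : Set} {xs : List A} → Unique xs → ∀ i j → nth xs i ≡ nth xs j → i ≡ j
nth-injective (_ ∷ᵘ _) zero zero e = refl
nth-injective (h ∷ᵘ _) zero (suc j) e = ⊥-elim (All.lookup h (∈-lookup j) e)
nth-injective (h ∷ᵘ _) (suc i) zero e = ⊥-elim (All.lookup h (∈-lookup i) (sym e))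
nth-injective (_ ∷ᵘ u) (suc i) (suc j) e = cong suc (nth-injective u i j e)

K2∪kK1-free : ∀ {n k} {G : Graph n} → Free (K2∪kK1 k) G → ∀ {u v zs} → adj G u v ≡ true → Unique zs →
  (∀ {y z} → y ∈ zs → z ∈ zs → adj G y z ≡ false) →
  (∀ {z} → z ∈ zs → adj G u z ≡ false) → (∀ {z} → z ∈ zs → adj G v z ≡ false) → k ≤ length zs → ⊥
K2∪kK1-free {n} {k} {G} free {u} {v} {zs} u~v uniq indep u≁ v≁ k≤ = free (φ , φ-inj , φ-adj)
  where
    z : Fin k → Fin n
    z i = nth zs (inject≤ i k≤)
    z∈ : ∀ i → z i ∈ zs
    z∈ i = ∈-lookup (inject≤ i k≤)
    φ : Fin (2 + k) → Fin n
    φ zero = u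
    φ (suc zero) = v
    φ (suc (suc i)) = z i
    u≢ : ∀ i → u ≢ z i
    u≢ i e = true≢false u~v (~-sym {G = G} (subst (λ t → adj G v t ≡ false) (sym e) (v≁ (z∈ i))))
    v≢ : ∀ i → v ≢ z i
    v≢ i e = true≢false u~v (subst (λ t → adj G u t ≡ false) (sym e) (u≁ (z∈ i)))
    φ-inj : ∀ {i j} → φ i ≡ φ j → i ≡ j
    φ-inj {zero} {zero} e = refl
    φ-inj {zero} {suc zero} e = ⊥-elim (~⇒≢ {G = G} u~v e)
    φ-inj {zero} {suc (suc j)} e = ⊥-elim (u≢ j e)
    φ-inj {suc zero} {zero} e = ⊥-elim (~⇒≢ {G = G} u~v (sym e))
    φ-inj {suc zero} {suc zero} e = refl
    φ-inj {suc zero} {suc (suc j)} e = ⊥-elim (v≢ j e)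
    φ-inj {suc (suc i)} {zero} e = ⊥-elim (u≢ i (sym e))
    φ-inj {suc (suc i)} {suc zero} e = ⊥-elim (v≢ i (sym e))
    φ-inj {suc (suc i)} {suc (suc j)} e =
      cong (λ t → suc (suc t)) (inject≤-injective k≤ k≤ i j (nth-injective uniq _ _ e))
    φ-adj : ∀ i j → adj G (φ i) (φ j) ≡ adj (K2∪kK1 k) i j
    φ-adj zero zero = adj-irrefl G u
    φ-adj zero (suc zero) = u~v
    φ-adj zero (suc (suc j)) = u≁ (z∈ j)
    φ-adj (suc zero) zero = ~-sym {G = G} u~v
    φ-adj (suc zero) (suc zero) = adj-irrefl G v
    φ-adj (suc zero) (suc (suc j)) = v≁ (z∈ j)
    φ-adj (suc (suc i)) zero = ~-sym {G = G} (u≁ (z∈ i))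
    φ-adj (suc (suc i)) (suc zero) = ~-sym {G = G} (v≁ (z∈ i))
    φ-adj (suc (suc i)) (suc (suc j)) = indep (z∈ i) (z∈ j)

-- One notion for two uses: walks off the cycle and walks avoiding a separating set.
data Walk {n : ℕ} (G : Graph n) (P : Fin n → Set) : Fin n → Fin n → Set where
  nil  : ∀ {u} → Walk G P u u
  cons : ∀ {u w v} → adj G u w ≡ true → P w → Walk G P w v → Walk G P u v

module _ {n : ℕ} {G : Graph n} where

  open DecMembership (_≟ᶠ_ {n}) using (_∈?_)

  ConnectedIn⇒Walk : ∀ {S u v} → ConnectedIn G S u v → Walk G (_∉ˢ S) u v
  ConnectedIn⇒Walk here = nil
  ConnectedIn⇒Walk (step e w∉ r) = cons e w∉ (ConnectedIn⇒Walk r)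

  module _ {P : Fin n → Set} where

    Walk-trans : ∀ {u v w} → Walk G P u v → Walk G P v w → Walk G P u w
    Walk-trans nil q = q
    Walk-trans (cons e h p) q = cons e h (Walk-trans p q)

    Walk-reverse : ∀ {u v} → P u → Walk G P u v → Walk G P v u
    Walk-reverse _ nil = nil
    Walk-reverse hu (cons e h p) = Walk-trans (Walk-reverse h p) (cons (~-sym {G = G} e) hu nil)

    suffix : ∀ {w v vs u} → Path G w v vs → Unique vs → All P vs → u ∈ vs →
      ∃ λ us → Path G u v us × Unique us × All P us
    suffix p uq a (here refl) = helper p uq a
      where
        helper : ∀ {w v u us} → Path G w v (u ∷ us) → Unique (u ∷ us) → All P (u ∷ us) →
          ∃ λ ws → Path G u v ws × Unique ws × All P ws
        helper stop uq a = _ , stop , uq , a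
        helper (go e p) uq a = _ , go e p , uq , a
    suffix (go e p) (_ ∷ᵘ uq) (_ ∷ᵃ a) (there i) = suffix p uq a i

    Walk⇒Path : ∀ {u v} → P u → Walk G P u v → ∃ λ vs → Path G u v vs × Unique vs × All P vs
    Walk⇒Path hu nil = _ , stop , []ᵃ ∷ᵘ []ᵘ , hu ∷ᵃ []ᵃ
    Walk⇒Path {u} hu (cons e hw p) with Walk⇒Path hw p
    ... | vs , q , uq , a with u ∈? vs
    ... | yes i = suffix q uq a i
    ... | no ∉ = u ∷ vs , go e q , All.tabulate (λ { i refl → ∉ i }) ∷ᵘ uq , hu ∷ᵃ a

length-Path : ∀ {n} {G : Graph n} {u v vs} → Path G u v vs → 1 ≤ length vs
length-Path stop = s≤s z≤n
length-Path (go _ _) = s≤s z≤n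

∣tabulate∣ : ∀ {n m} (f : Fin m → Bool) (g : Fin n → Fin m) → ∣ tabulate (f ∘ g) ∣ ≡ length (sel f (tabulateᴸ g))
∣tabulate∣ {zero} f g = refl
∣tabulate∣ {suc n} f g with f (g zero)
... | true = cong suc (∣tabulate∣ f (g ∘ suc))
... | false = ∣tabulate∣ f (g ∘ suc)

does⁻ : {P : Set} (P? : Dec P) → does P? ≡ true → P
does⁻ (yes p) _ = p

-- Membership in a component off the cycle is given by walks and comes without a decision. As the
-- goal is `⊥`, a decision for the finitely many vertices may be assumed.
¬¬-decidable : ∀ {n} (P : Fin n → Set) → ((∀ v → Dec (P v)) → ⊥) → ⊥
¬¬-decidable {zero} P f = f (λ ())
¬¬-decidable {suc n} P f = ¬¬-decidable (P ∘ suc) (λ ds →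
  let P₀-no = λ p → f (λ { zero → yes p ; (suc v) → ds v })
  in f (λ { zero → no P₀-no ; (suc v) → ds v }))

module Dominating {n : ℕ} {G : Graph n} (C : LongestCycle G) where
  open Cyc C
  open DecMembership (_≟ᶠ_ {n}) using (_∈?_)

  ear-consecutive : ∀ {h h' p} → Off h → Walk G Off h h' → h ~ c p → h' ~ c (suc p) → ⊥
  ear-consecutive {p = p} oh w e e' with Walk⇒Path oh w
  ... | zs , q , uz , oz = no-longer p zs (visit q ⟨ e' ⟩ up (s<s+L p))
      (subst (_~ _) (sym (c-per p)) (~-sym {G = G} e)) ↭-refl uz oz (length-Path q)

  ear-successors : ∀ {h h' p q} → Off h → Walk G Off h h' → h ~ c p → h' ~ c q → p < q → q < p + L →
    c (suc p) ~ c (suc q) → ⊥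
  ear-successors {p = p} {q} oh w e e' p<q q<p+L f with Walk⇒Path oh w
  ... | zs , r , uz , oz = no-longer p zs (visit r ⟨ e' ⟩ down p<q ⟨ f ⟩ up q<p+L)
      (subst (_~ _) (sym (c-per p)) (~-sym {G = G} e))
      (↭-reflexive (cong (zs ++_) (sym (I-++ p<q q<p+L)))) uz oz (length-Path r)

  on? : ∀ v → Dec (v ∈ map c (range 0 L))
  on? v = v ∈? map c (range 0 L)

  off : ∀ {v} → v ∉ map c (range 0 L) → Off v
  off {v} h i v≡ = let (q , a , b) = reduce₀ i in
    h (subst (_∈ map c (range 0 L)) (sym (trans v≡ (b 0))) (∈-map⁺ c (∈-range⁺ 0 L z≤n a)))

  -- `H` is the component of x off the cycle, `N` its set of neighbours on the cycle. The successors
  -- of `N` are independent and have no neighbour in `H`, since an ear through `H` would lengthen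
  -- the cycle. With the edge from x to y, `k` of them would contain the forbidden subgraph; fewer
  -- than `k` vertices in `N` would separate x from the rest of the cycle.
  off-independent : ∀ {k} → KConnected k G → Free (K2∪kK1 k) G → ∀ {x y} → Off x → Off y → x ≁ y
  off-independent {k} (_ , conn) free {x} {y} ox oy = ¬~⇒≁ {G = G} (λ x~y → ¬¬-decidable H (contra x~y))
    where
      H : Fin n → Set
      H = Walk G Off x
      off-H : ∀ {h} → H h → Off h
      off-H {h} w = last ox w
        where
          last : ∀ {u v} → Off u → Walk G Off u v → Off v
          last o nil = o
          last o (cons _ o' r) = last o' r
      between : ∀ {h h'} → H h → H h' → Walk G Off h h'
      between w w' = Walk-trans (Walk-reverse ox w) w'
      contra : x ~ y → (∀ v → Dec (H v)) → ⊥
      contra x~y H? = separated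
        where
          N? : ∀ v → Dec ((∃ λ h → H h × h ~ v) × v ∈ map c (range 0 L))
          N? v = any? (λ h → H? h ×-dec (adj G h v ≟ᵇ true)) ×-dec on? v
          N : Fin n → Bool
          N v = does (N? v)
          N⁻ : ∀ {v} → N v ≡ true → (∃ λ h → H h × h ~ v) × v ∈ map c (range 0 L)
          N⁻ {v} = does⁻ (N? v)
          N⁺ : ∀ {v h} → H h → h ~ v → v ∈ map c (range 0 L) → N v ≡ true
          N⁺ {v} w e i = dec-true (N? v) ((_ , w , e) , i)
          S : Subset n
          S = tabulate N
          ps : List ℕ
          ps = sel (λ p → N (c p)) (range 0 L)
          N-at : ∀ {p} → p ∈ ps → N (c p) ≡ true
          N-at i = proj₂ (∈-sel⁻ (λ p → N (c p)) (range 0 L) i)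
          at< : ∀ {p} → p ∈ ps → p < L
          at< i = proj₂ (∈-range⁻ 0 L (proj₁ (∈-sel⁻ (λ p → N (c p)) (range 0 L) i)))
          card : ∣ S ∣ ≤ length ps
          card = subst₂ _≤_ (sym (∣tabulate∣ N id)) (length-map c ps)
            (Unique-⊆⇒length≤ (Unique-sel N (allFin⁺ n)) inc)
            where
              inc : ∀ {v} → v ∈ sel N (allFin n) → v ∈ map c ps
              inc {v} i with ∈-map⁻ c (proj₂ (N⁻ (proj₂ (∈-sel⁻ N (allFin n) i))))
              ... | q , q∈ , refl = ∈-map⁺ c (∈-sel⁺ (λ p → N (c p)) (range 0 L) q∈ (proj₂ (∈-sel⁻ N (allFin n) i)))
          zs : List (Fin n)
          zs = map (λ p → c (suc p)) ps
          zs-uniq : Unique zs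
          zs-uniq = Unique-map (λ p → c (suc p))
            (λ i j e → suc-injective (c-inj-≡ 1 (s≤s z≤n) (s≤s (at< i)) (s≤s z≤n) (s≤s (at< j)) e))
            (Unique-sel _ (Unique-range 0 L))
          nonadjacent : ∀ {p h} → p ∈ ps → H h → h ≁ c (suc p)
          nonadjacent i w = let (h , w' , e) = proj₁ (N⁻ (N-at i)) in
            ¬~⇒≁ {G = G} (λ f → ear-consecutive (off-H w') (between w' w) e f)
          indep : ∀ {p q} → p ∈ ps → q ∈ ps → c (suc p) ≁ c (suc q)
          indep {p} {q} i j = let (h , w , e) = proj₁ (N⁻ (N-at i)) ; (h' , w' , e') = proj₁ (N⁻ (N-at j)) in
            ¬~⇒≁ {G = G} (λ f → case <-cmp p q of λ
              { (tri< lt _ _) → ear-successors (off-H w) (between w w') e e' lt (<-≤-trans (at< j) (m≤n+m L p)) f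
              ; (tri≈ _ refl _) → ~⇒≢ {G = G} f refl
              ; (tri> _ _ gt) → ear-successors (off-H w') (between w' w) e' e gt (<-≤-trans (at< i) (m≤n+m L q)) (~-sym {G = G} f) })
          few : ∣ S ∣ < k
          few with k ≤? length ps
          ... | no h = ≤-<-trans card (≰⇒> h)
          ... | yes h = ⊥-elim (K2∪kK1-free {G = G} free x~y zs-uniq
              (λ i j → let (p , p∈ , e) = ∈-map⁻ _ i ; (q , q∈ , e') = ∈-map⁻ _ j in
                subst₂ _≁_ (sym e) (sym e') (indep p∈ q∈))
              (λ i → let (p , p∈ , e) = ∈-map⁻ _ i in subst (x ≁_) (sym e) (nonadjacent p∈ nil))
              (λ i → let (p , p∈ , e) = ∈-map⁻ _ i in subst (y ≁_) (sym e) (nonadjacent p∈ (cons x~y oy nil)))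
              (subst (k ≤_) (sym (length-map _ ps)) h))
          ∉S : ∀ {v} → (N v ≡ true → ⊥) → v ∉ˢ S
          ∉S {v} f i = f (trans (sym (lookup∘tabulate N v)) ([]=⇒lookup i))
          stays : ∀ {u v} → H u → Walk G (_∉ˢ S) u v → H v
          stays w nil = w
          stays w (cons {w = z} e z∉ r) with on? z
          ... | yes i = ⊥-elim (z∉ (lookup⇒[]= z S (trans (lookup∘tabulate N z) (N⁺ w e i))))
          ... | no z-off = stays (Walk-trans w (cons e (off z-off) nil)) r
          reach : ∀ i → (N (c i) ≡ true → ⊥) → ⊥
          reach i f = off-H (stays nil (ConnectedIn⇒Walk (conn S few x (c i)
            (∉S (λ e → let (q , _ , x≡) = ∈-map⁻ c (proj₂ (N⁻ e)) in ox q x≡)) (∉S f)))) i refl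
          -- Consecutive vertices of the cycle are never both in `N`, so position 0 or 1 is outside
          -- it and would be reached from x avoiding `S`.
          separated : ⊥
          separated with N (c 0) in e₀
          ... | false = reach 0 (λ e → true≢false e e₀)
          ... | true = reach 1 (λ e₁ → let (h , w , e) = proj₁ (N⁻ e₀) ; (h' , w' , e') = proj₁ (N⁻ e₁) in
              ear-consecutive (off-H w) (between w w') e e')

length-sel-++ : {A : Set} (P : A → Bool) (xs ys : List A) → length (sel P (xs ++ ys)) ≡ length (sel P xs) + length (sel P ys)
length-sel-++ P [] ys = refl
length-sel-++ P (x ∷ xs) ys with P x
... | true = cong suc (length-sel-++ P xs ys)
... | false = length-sel-++ P xs ys

-- Moving the window by one drops `s` and gains `s + m`, where `P` has the same value.
cnt-rotate : (P : ℕ → Bool) (m : ℕ) → (∀ p → P (p + m) ≡ P p) → ∀ s → cnt P s m ≡ cnt P 0 m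
cnt-rotate P m per zero = refl
cnt-rotate P m per (suc s) = trans (+-cancelʳ-≡ (length (sel P [ s + m ])) _ _ one-step) (cnt-rotate P m per s)
  where
    sel-singleton : ∀ {a b} → P a ≡ P b → length (sel P [ a ]) ≡ length (sel P [ b ])
    sel-singleton {a} {b} e with P a | P b
    sel-singleton refl | true | true = refl
    sel-singleton refl | false | false = refl
    one-step : cnt P (suc s) m + length (sel P [ s + m ]) ≡ cnt P s m + length (sel P [ s + m ])
    one-step = trans (cong (cnt P (suc s) m +_) (sel-singleton (per s)))
      (trans (+-comm (cnt P (suc s) m) _)
      (trans (sym (length-sel-++ P [ s ] (range (suc s) m)))
      (trans (cong (length ∘ sel P) (range-∷ʳ s m)) (length-sel-++ P (range s m) [ s + m ]))))

degree≡ : ∀ {n} (G : Graph n) v → degree G v ≡ length (sel (adj G v) (allFin n))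
degree≡ {n} G v = helper (allFin n)
  where
    helper : ∀ us → sum (map (λ u → if adj G v u then 1 else 0) us) ≡ length (sel (adj G v) us)
    helper [] = refl
    helper (u ∷ us) with adj G v u
    ... | true = cong suc (helper us)
    ... | false = helper us

-- The independence number

all-true : {A : Set} (f : A → Bool) → (∀ v → f v ≡ true) → ∀ vs → all f vs ≡ true
all-true f h [] = refl
all-true f h (v ∷ vs) rewrite h v = all-true f h vs

∈-allSubsets : ∀ {n} (S : Subset n) → S ∈ allSubsets n
∈-allSubsets Vec.[] = here refl
∈-allSubsets {suc n} (true Vec.∷ S) = ∈-++⁺ˡ (∈-map⁺ (true Vec.∷_) (∈-allSubsets S))
∈-allSubsets {suc n} (false Vec.∷ S) = ∈-++⁺ʳ (map (true Vec.∷_) (allSubsets n)) (∈-map⁺ (false Vec.∷_) (∈-allSubsets S))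

≤-foldr-⊔ : ∀ {m} ms → m ∈ ms → m ≤ foldr _⊔_ 0 ms
≤-foldr-⊔ (m ∷ ms) (here refl) = m≤m⊔n m _
≤-foldr-⊔ (m ∷ ms) (there i) = ≤-trans (≤-foldr-⊔ ms i) (m≤n⊔m m _)

independent≤α : ∀ {n} (G : Graph n) (Z : Fin n → Bool) → (∀ {u v} → Z u ≡ true → Z v ≡ true → adj G u v ≡ false) →
  length (sel Z (allFin n)) ≤ α G
independent≤α {n} G Z indep = subst (_≤ α G) (∣tabulate∣ Z id)
  (≤-foldr-⊔ _ (subst (_∈ map weight (allSubsets n)) weight≡ (∈-map⁺ weight (∈-allSubsets S))))
  where
    S : Subset n
    S = tabulate Z
    weight : Subset n → ℕ
    weight S = if isIndependent G S then ∣ S ∣ else 0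
    pair : ∀ u v → not (lookup S u ∧ lookup S v ∧ adj G u v) ≡ true
    pair u v rewrite lookup∘tabulate Z u | lookup∘tabulate Z v with Z u in eu | Z v in ev
    ... | false | _ = refl
    ... | true | false = refl
    ... | true | true rewrite indep eu ev = refl
    weight≡ : weight S ≡ ∣ S ∣
    weight≡ rewrite all-true (λ u → all (λ v → not (lookup S u ∧ lookup S v ∧ adj G u v)) (allFin n))
      (λ u → all-true _ (pair u) (allFin n)) (allFin n) = refl

length-allFin : ∀ n → length (allFin n) ≡ n
length-allFin n = length-tabulate (id {A = Fin n})

-- Rearrangements of the segments of rerouted cycles

module _ {A : Set} where
  private module Perm = CommutativeMonoidSolver (++-commutativeMonoid {A = A})
  open Perm using (_⊜_) renaming (solve to permute; _⊕_ to _⊞_)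

  -- Here and in the next three identities the left side is the order of traversal on the new cycle,
  -- the right side the order on the old one; `X` and `Y` are used for the vertices a and b between
  -- two neighbours of x at distance three.
  ↭-insert : ∀ (A D X Y : List A) → A ++ X ++ Y ++ D ↭ Y ++ (A ++ D) ++ X
  ↭-insert = permute 4 (λ A D X Y → A ⊞ X ⊞ Y ⊞ D ⊜ Y ⊞ (A ⊞ D) ⊞ X) ↭-refl

  ↭-detour₁ : ∀ (A B D X Y : List A) → B ++ X ++ A ++ Y ++ D ↭ Y ++ (A ++ B ++ D) ++ X
  ↭-detour₁ = permute 5 (λ A B D X Y → B ⊞ X ⊞ A ⊞ Y ⊞ D ⊜ Y ⊞ (A ⊞ B ⊞ D) ⊞ X) ↭-refl

  ↭-detour₂ : ∀ (A B D X Y : List A) → A ++ Y ++ B ++ X ++ D ↭ Y ++ (A ++ B ++ D) ++ X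
  ↭-detour₂ = permute 5 (λ A B D X Y → A ⊞ Y ⊞ B ⊞ X ⊞ D ⊜ Y ⊞ (A ⊞ B ⊞ D) ⊞ X) ↭-refl

module _ {A : Set} where
  private module Perm = CommutativeMonoidSolver (++-commutativeMonoid {A = A})
  open Perm using (_⊜_) renaming (solve to permute; _⊕_ to _⊞_)

  ↭-chord : ∀ (A D X Y : List A) → D ++ Y ++ X ++ A ↭ Y ++ (A ++ D) ++ X
  ↭-chord = permute 4 (λ A D X Y → D ⊞ Y ⊞ X ⊞ A ⊜ Y ⊞ (A ⊞ D) ⊞ X) ↭-refl

  ↭-seven : ∀ (A B D E F H X : List A) → H ++ B ++ X ++ E ++ A ++ D ++ F ↭ X ++ A ++ B ++ D ++ E ++ F ++ H
  ↭-seven = permute 7 (λ A B D E F H X → H ⊞ B ⊞ X ⊞ E ⊞ A ⊞ D ⊞ F ⊜ X ⊞ A ⊞ B ⊞ D ⊞ E ⊞ F ⊞ H) ↭-refl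

-- Positions modulo three and the table of the Petersen graph

Third : ℕ → ℕ → Set
Third t p = p ≡ 3 + t ⊎ p ≡ 6 + t ⊎ p ≡ 9 + t

-- Of the three admissible positions, one lies above `p` and one below `q'`; so `q' ≤ p` leaves only
-- the middle one for both.
middle : ∀ {t p q p' q'} → Third t p → Third t q → Third t p' → Third t q' →
  p < q → p' < q' → q' ≤ p → p ≡ 6 + t × q' ≡ 6 + t
middle {t} {p} {q} {p'} {q'} hp hq hp' hq' lt lt' le = p≡ , q'≡
  where
    ≥3 : ∀ {p} → Third t p → 3 + t ≤ p
    ≥3 (inj₁ refl) = ≤-refl
    ≥3 (inj₂ (inj₁ refl)) = m≤n+m (3 + t) 3
    ≥3 (inj₂ (inj₂ refl)) = m≤n+m (3 + t) 6
    ≤9 : ∀ {p} → Third t p → p ≤ 9 + t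
    ≤9 (inj₁ refl) = m≤n+m (3 + t) 6
    ≤9 (inj₂ (inj₁ refl)) = m≤n+m (6 + t) 3
    ≤9 (inj₂ (inj₂ refl)) = ≤-refl
    p≡ : p ≡ 6 + t
    p≡ = cases hp
      where
        cases : Third t p → p ≡ 6 + t
        cases (inj₁ refl) = ⊥-elim (<-irrefl refl (<-≤-trans (≤-<-trans (≥3 hp') lt') le))
        cases (inj₂ (inj₁ e)) = e
        cases (inj₂ (inj₂ refl)) = ⊥-elim (<-irrefl refl (<-≤-trans lt (≤9 hq)))
    q'≡ : q' ≡ 6 + t
    q'≡ = cases hq'
      where
        cases : Third t q' → q' ≡ 6 + t
        cases (inj₁ refl) = ⊥-elim (<-irrefl refl (≤-<-trans (≥3 hp') lt'))
        cases (inj₂ (inj₁ e)) = e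
        cases (inj₂ (inj₂ refl)) = ⊥-elim (<-irrefl refl (<-≤-trans (m≤n+m (7 + t) 2) (subst (9 + t ≤_) p≡ le)))

-- Adjacency along the cycle u₁ a₁ b₁ u₂ a₂ b₂ u₃ a₃ b₃ of the Petersen graph minus a vertex: the vertex
-- of type r (0, 1, 2 for u, a, b) is adjacent to the vertex δ steps further iff row r δ.
row : ℕ → ℕ → Bool
row 0 1 = true
row 0 8 = true
row 1 1 = true
row 1 4 = true
row 1 8 = true
row 2 1 = true
row 2 5 = true
row 2 8 = true
row _ _ = false

steps : ℕ → ℕ → ℕ
steps i j with i ≤? j
... | yes _ = j ∸ i
... | no _ = (9 + j) ∸ i

table : Fin 10 → Fin 10 → Bool
table zero zero = false
table zero (suc j) = toℕ j % 3 ≡ᵇ 0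
table (suc i) zero = toℕ i % 3 ≡ᵇ 0
table (suc i) (suc j) = row (toℕ i % 3) (steps (toℕ i) (toℕ j))

-- Index 0 is the deleted vertex. The others run along the 9-cycle 1 2 3 4 9 7 5 8 6 of `petersen`,
-- on which the neighbours 1, 4, 5 of vertex 0 take every third place.
label label⁻¹ : Fin 10 → Fin 10
label = lookup (# 0 Vec.∷ # 1 Vec.∷ # 2 Vec.∷ # 3 Vec.∷ # 4 Vec.∷ # 9 Vec.∷ # 7 Vec.∷ # 5 Vec.∷ # 8 Vec.∷ # 6 Vec.∷ Vec.[])
label⁻¹ = lookup (# 0 Vec.∷ # 1 Vec.∷ # 2 Vec.∷ # 3 Vec.∷ # 4 Vec.∷ # 7 Vec.∷ # 9 Vec.∷ # 6 Vec.∷ # 8 Vec.∷ # 5 Vec.∷ Vec.[])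

label-label⁻¹ : ∀ i → label (label⁻¹ i) ≡ i
label-label⁻¹ = toWitness {a? = all? λ i → label (label⁻¹ i) ≟ᶠ i} tt

label⁻¹-label : ∀ i → label⁻¹ (label i) ≡ i
label⁻¹-label = toWitness {a? = all? λ i → label⁻¹ (label i) ≟ᶠ i} tt

table-petersen : ∀ i j → adj petersen (label i) (label j) ≡ table i j
table-petersen = toWitness {a? = all? λ i → all? λ j → adj petersen (label i) (label j) ≟ᵇ table i j} tt

-- The neighbourhood of a vertex off a longest cycle

module Core {n k' : ℕ} {G : Graph n} (C : LongestCycle G) (1≤k' : 1 ≤ k') (free : Free (K2∪kK1 (suc k')) G)
  (off-indep : ∀ {y z} → Cyc.Off C y → Cyc.Off C z → adj G y z ≡ false)
  (min-degree : ∀ v → 3 * k' ≤ 2 * degree G v)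
  (x : Fin n) (ox : Cyc.Off C x) where

  open Cyc C public
  open Dominating C public using (ear-consecutive; ear-successors; on?; off)
  module Perm = CommutativeMonoidSolver (++-commutativeMonoid {A = Fin n})
  open Perm using (_⊜_) renaming (solve to permute; _⊕_ to _⊞_)

  adj-split : ∀ u v → u ~ v ⊎ u ≁ v
  adj-split u v = bool-split (adj G u v)

  U : ℕ → Bool
  U p = adj G x (c p)

  U-resp : ∀ {p q} → p ≈ q → U p ≡ U q
  U-resp h = cong (adj G x) (h 0)

  U-per : ∀ p → U (p + L) ≡ U p
  U-per p = cong (adj G x) (c-per p)

  U-next : ∀ {p} → U p ≡ true → U (suc p) ≡ false
  U-next e = ¬~⇒≁ {G = G} (ear-consecutive ox nil e)

  -- The predecessor, reached by `L - 1` steps forward because no position precedes 0.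
  cp : ℕ → Fin n
  cp p = c ((L ∸ 1) + p)

  L-1+ : ∀ r → suc ((L ∸ 1) + r) ≡ r + L
  L-1+ r = trans (cong (_+ r) (m+[n∸m]≡n 1≤L)) (+-comm L r)

  cp-suc : ∀ r → cp (suc r) ≡ c r
  cp-suc r = trans (cong c (trans (+-suc (L ∸ 1) r) (L-1+ r))) (c-per r)

  U-cp : ∀ {p} → U p ≡ true → U ((L ∸ 1) + p) ≡ false
  U-cp {p} e = ¬~⇒≁ {G = G} (λ f → true≢false (trans (cong U (L-1+ p)) (trans (U-per p) e)) (U-next f))

  only-x : ∀ {u v vs} s → Visit {G = G} u v vs → v ~ u → vs ↭ x ∷ I (suc s) (s + L) → ⊥
  only-x s w e π = no-longer s [ x ] w e π ([]ᵃ ∷ᵘ []ᵘ) (ox ∷ᵃ []ᵃ) ≤-refl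

  ~ˢ : ∀ {u v b} → adj G u v ≡ b → adj G v u ≡ b
  ~ˢ = ~-sym {G = G}

  U-wrap : ∀ {p} → U p ≡ true → c (p + L) ~ x
  U-wrap {p} e = ~ˢ (trans (U-per p) e)

  at-wrap : ∀ {p v} → c p ~ v → c (p + L) ~ v
  at-wrap {p} {v} = subst (_~ v) (sym (c-per p))

  ear-predecessors : ∀ {j j'} → U (suc j) ≡ true → U (suc j') ≡ true → j < j' → j' < j + L → c j ~ c j' → ⊥
  ear-predecessors {j} {j'} e e' lt gt f = only-x j
    (pt x ⟨ e ⟩ up lt ⟨ ~ˢ (at-wrap f) ⟩ down gt) (~ˢ e')
    (↭-reflexive (cong (x ∷_) (sym (I-++ lt gt))))

  two-off : ∀ {y} s → x ≢ y → Off y → ∀ A B {u v} → Visit {G = G} u v (x ∷ A ++ y ∷ B) → v ~ u →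
    I (suc s) (s + L) ≡ A ++ B → ⊥
  two-off {y} s x≢y oy A B w e eq = no-longer s (x ∷ y ∷ []) w e
    (prep x (↭-trans (shift y A B) (↭-reflexive (cong (y ∷_) (sym eq)))))
    ((x≢y ∷ᵃ []ᵃ) ∷ᵘ []ᵃ ∷ᵘ []ᵘ) (ox ∷ᵃ oy ∷ᵃ []ᵃ) (s≤s z≤n)

  -- The closed path `x, c q, ..., c (suc p), y, c (suc q), ..., c p` would take in both x and `y`.
  off-successors : ∀ {y p q} → Off y → U p ≡ true → U q ≡ true → p < q → q < p + L → y ~ c (suc p) → y ~ c (suc q) → ⊥
  off-successors {y} {p} {q} oy e e' lt gt f f' = two-off p (λ { refl → true≢false f (U-next e) }) oy (I (suc p) q) (I (suc q) (p + L))
    (pt x ⟨ e' ⟩ down lt ⟨ ~ˢ f ⟩ pt y ⟨ f' ⟩ up gt) (U-wrap e) (I-++ lt gt)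

  off-predecessors : ∀ {y j j'} → Off y → U (suc j) ≡ true → U (suc j') ≡ true → j < j' → j' < j + L → y ~ c j → y ~ c j' → ⊥
  off-predecessors {y} {j} {j'} oy e e' lt gt f f' = two-off j (λ { refl → true≢false e (U-next f) }) oy (I (suc j) j') (I (suc j') (j + L))
    (pt x ⟨ e ⟩ up lt ⟨ ~ˢ f' ⟩ pt y ⟨ ~ˢ (at-wrap (~ˢ f)) ⟩ down gt) (~ˢ e') (I-++ lt gt)

  d : ℕ
  d = cnt U 0 L

  cnt-U : ∀ s → cnt U s L ≡ d
  cnt-U = cnt-rotate U L U-per

  degree-x≤d : degree G x ≤ d
  degree-x≤d = subst₂ _≤_ (sym (degree≡ G x)) (length-map c (sel U (range 0 L)))
    (Unique-⊆⇒length≤ (Unique-sel (adj G x) (allFin⁺ n)) inc)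
    where
      inc : ∀ {v} → v ∈ sel (adj G x) (allFin n) → v ∈ map c (sel U (range 0 L))
      inc {v} i with ∈-sel⁻ (adj G x) (allFin n) i
      ... | _ , e with on? v
      ... | no h = ⊥-elim (true≢false e (off-indep ox (off h)))
      ... | yes j with ∈-map⁻ c j
      ... | q , q∈ , refl = ∈-map⁺ c (∈-sel⁺ U (range 0 L) q∈ e)

  abstract
    3k'≤2d : 3 * k' ≤ 2 * d
    3k'≤2d = ≤-trans (min-degree x) (+-mono-≤ degree-x≤d (+-mono-≤ degree-x≤d z≤n))

    k'<d : k' < d
    k'<d = ≰⇒> (λ d≤k' → lin 0 (3k'≤2d ⊕ d≤k' ⊕ d≤k' ⊕ 1≤k') (arith k' d))
      where
        arith : ∀ k' d → 3 * k' + (d + (d + 1)) ≡ suc (0 + (2 * d + (k' + (k' + k'))))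
        arith k' d = solve (k' ∷ d ∷ [])

  -- One of the two neighbourhoods on the cycle: offset 1 gives the successors of the neighbours
  -- of x, offset L ∸ 1 their predecessors.
  module Side (e : ℕ) (f-x : ∀ {p} → U p ≡ true → c (e + p) ≁ x)
    (f-ear : ∀ {p q} → U p ≡ true → U q ≡ true → p < q → q < p + L → c (e + p) ~ c (e + q) → ⊥)
    (f-off : ∀ {y p q} → Off y → U p ≡ true → U q ≡ true → p < q → q < p + L → y ~ c (e + p) → y ~ c (e + q) → ⊥) where

    f : ℕ → Fin n
    f p = c (e + p)

    hit : Fin n → ℕ → Bool
    hit v p = U p ∧ adj G v (f p)

    hit-U : ∀ v p → hit v p ≡ true → U p ≡ true
    hit-U v p h = proj₁ (∧-split {U p} h)

    hit-adj : ∀ v p → hit v p ≡ true → v ~ f p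
    hit-adj v p h = proj₂ (∧-split {U p} h)

    hit-intro : ∀ {v p} → U p ≡ true → v ~ f p → hit v p ≡ true
    hit-intro a b rewrite a = b

    -- The set Z, or Z⁻ for the predecessors; in later names T and T⁻ stand for the complements.
    inZ : Fin n → Bool
    inZ v = not (adj G v x) ∧ null (sel (hit v) (range 0 L))

    Z-x : ∀ {v} → inZ v ≡ true → v ≁ x
    Z-x {v} h with adj G v x
    ... | false = refl

    Z-f : ∀ {v p} → inZ v ≡ true → U p ≡ true → v ≁ f p
    Z-f {v} {p} h u = ¬~⇒≁ {G = G} (λ a → empty (proj₂ (∧-split {not (adj G v x)} h)) (proj₂ (witness a)))
      where
        empty : ∀ {ps : List ℕ} {q} → null ps ≡ true → q ∈ ps → ⊥
        empty {_ ∷ _} () _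
        witness : v ~ f p → ∃ λ q → q ∈ sel (hit v) (range 0 L)
        witness a = let (q , q<L , h') = reduce₀ p in
          q , ∈-sel⁺ (hit v) _ (∈-range⁺ 0 L z≤n q<L) (hit-intro (trans (sym (U-resp h')) u) (subst (v ~_) (h' e) a))

    T-cases : ∀ {v} → inZ v ≡ false → v ~ x ⊎ ∃ λ p → U p ≡ true × v ~ f p
    T-cases {v} h with adj G v x
    ... | true = inj₁ refl
    ... | false with nonempty (sel (hit v) (range 0 L)) (not-null _ h)
      where
        not-null : ∀ (ps : List ℕ) → null ps ≡ false → 1 ≤ length ps
        not-null (_ ∷ _) _ = s≤s z≤n
    ... | p , i = let h' = proj₂ (∈-sel⁻ (hit v) (range 0 L) i) in inj₂ (p , hit-U v p h' , hit-adj v p h')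

    Z-intro : ∀ {v} → v ≁ x → (∀ {p} → U p ≡ true → v ≁ f p) → inZ v ≡ true
    Z-intro {v} a b with bool-split (inZ v)
    ... | inj₁ h = h
    ... | inj₂ h with T-cases h
    ... | inj₁ g = ⊥-elim (true≢false g a)
    ... | inj₂ (p , u , g) = ⊥-elim (true≢false g (b u))

    f-indep : ∀ {p q} → U p ≡ true → U q ≡ true → f p ≁ f q
    f-indep {p} {q} u u' = let (p₀ , p< , h) = reduce₀ p ; (q₀ , q< , h') = reduce₀ q in
      ¬~⇒≁ {G = G} (λ a → go' p< q< (trans (sym (U-resp h)) u) (trans (sym (U-resp h')) u') (subst₂ _~_ (h e) (h' e) a))
      where
        go' : ∀ {p q} → p < L → q < L → U p ≡ true → U q ≡ true → f p ~ f q → ⊥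
        go' {p} {q} p< q< u u' a with <-cmp p q
        ... | tri< lt _ _ = f-ear u u' lt (<-≤-trans q< (m≤n+m L p)) a
        ... | tri≈ _ refl _ = ~⇒≢ {G = G} a refl
        ... | tri> _ _ gt = f-ear u' u gt (<-≤-trans p< (m≤n+m L q)) (~ˢ a)

    x∈Z : inZ x ≡ true
    x∈Z = Z-intro (adj-irrefl G x) (λ u → ~ˢ (f-x u))

    f∈Z : ∀ {p} → U p ≡ true → inZ (f p) ≡ true
    f∈Z u = Z-intro (f-x u) (λ u' → f-indep u u')

    Unique-f : ∀ s {ps} → Unique ps → All (λ p → s ≤ p × p < s + L) ps → Unique (map f ps)
    Unique-f s u h = Unique-map f (λ i j eq → let (a , b) = All.lookup h i ; (a' , b') = All.lookup h j in
      +-cancelˡ e (c-inj-≡ (e + s) (+-monoʳ-≤ e a) (bd b) (+-monoʳ-≤ e a') (bd b') eq)) u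
      where
        bd : ∀ {p} → p < s + L → e + p < e + s + L
        bd {p} b = subst₂ _≤_ (+-suc e p) (sym (+-assoc e s L)) (+-monoʳ-≤ e b)
        +-cancelˡ : ∀ e {p q} → e + p ≡ e + q → p ≡ q
        +-cancelˡ zero h = h
        +-cancelˡ (suc e) h = +-cancelˡ e (suc-injective h)

    x∷f-unique : ∀ s {ps} → Unique ps → All (λ p → s ≤ p × p < s + L) ps → Unique (x ∷ map f ps)
    x∷f-unique s u h = All.tabulate (λ i eq → let (p , _ , e') = ∈-map⁻ f i in ox (e + p) (trans eq e')) ∷ᵘ Unique-f s u h

    -- An edge inside Z, together with x and the `d ≥ k` vertices `f p`, none adjacent to its ends,
    -- would contain the forbidden subgraph.
    Z-indep : ∀ {v w} → inZ v ≡ true → inZ w ≡ true → v ≁ w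
    Z-indep {v} {w} hv hw = ¬~⇒≁ {G = G} (λ a → K2∪kK1-free {G = G} free a
      (x∷f-unique 0 (Unique-sel U (Unique-range 0 L)) (All.tabulate (λ i → ∈-range⁻ 0 L (proj₁ (∈-sel⁻ U (range 0 L) i)))))
      (λ i j → S-Z i (S∈Z j)) (S-Z' hv) (S-Z' hw)
      (s≤s (subst (k' ≤_) (sym (length-map f (sel U (range 0 L)))) (<⇒≤ k'<d))))
      where
        S : List (Fin n)
        S = x ∷ map f (sel U (range 0 L))
        S-Z : ∀ {z y} → z ∈ S → inZ y ≡ true → z ≁ y
        S-Z (here refl) h = ~ˢ (Z-x h)
        S-Z (there i) h with ∈-map⁻ f i
        ... | p , p∈ , refl = ~ˢ (Z-f h (proj₂ (∈-sel⁻ U (range 0 L) p∈)))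
        S-Z' : ∀ {y} → inZ y ≡ true → ∀ {z} → z ∈ S → y ≁ z
        S-Z' h i = ~ˢ (S-Z i h)
        S∈Z : ∀ {z} → z ∈ S → inZ z ≡ true
        S∈Z (here refl) = x∈Z
        S∈Z (there i) with ∈-map⁻ f i
        ... | p , p∈ , refl = f∈Z (proj₂ (∈-sel⁻ U (range 0 L) p∈))

    abstract
      -- `t` has a neighbour `s` that is x or some `f p`. These lie in Z, which is independent, so
      -- the edge from `t` to `s` and `k` vertices of Z missed by `t` would induce the forbidden
      -- subgraph.
      few-misses : ∀ {t zs} → inZ t ≡ false → Unique zs → All (λ z → inZ z ≡ true) zs → All (λ z → t ≁ z) zs → length zs ≤ k'
      few-misses {t} {zs} ht u hz hm = ≮⇒≥ (λ big → witness (T-cases ht) big)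
        where
          use : ∀ {s} → inZ s ≡ true → t ~ s → suc k' ≤ length zs → ⊥
          use hs a = K2∪kK1-free {G = G} free a u (λ i j → Z-indep (All.lookup hz i) (All.lookup hz j))
            (λ i → All.lookup hm i) (λ i → Z-indep hs (All.lookup hz i))
          witness : t ~ x ⊎ (∃ λ p → U p ≡ true × t ~ f p) → suc k' ≤ length zs → ⊥
          witness (inj₁ a) = use x∈Z a
          witness (inj₂ (p , u' , a)) = use (f∈Z u') a

      -- As x is a missed vertex of Z too, at most `k' - 1` of the `d` vertices `f p` are missed.
      many-hits : ∀ {t} → inZ t ≡ false → t ≁ x → ∀ s → suc d ≤ k' + cnt (hit t) s L
      many-hits {t} ht t≁x s = ≮⇒≥ (λ g → lin 0 (few ⊕ subst (suc (k' + cnt (hit t) s L) ≤_) (cong suc total) g)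
          (arith k' (cnt (hit t) s L) (length missed)))
        where
          missed : List ℕ
          missed = sel (λ p → U p ∧ not (adj G t (f p))) (range s L)
          total : d ≡ cnt (hit t) s L + length missed
          total = trans (sym (cnt-U s)) (length-sel-split U (λ p → adj G t (f p)) (range s L))
          few : suc (length missed) ≤ k'
          few = subst (λ m → suc m ≤ k') (length-map f missed) (few-misses ht
            (x∷f-unique s (Unique-sel _ (Unique-range s L)) (All.tabulate (λ i → ∈-range⁻ s L (proj₁ (∈-sel⁻ _ _ i)))))
            (x∈Z ∷ᵃ All.map⁺ (All.tabulate (λ {p} i → f∈Z (proj₁ (∧-split {U p} (proj₂ (∈-sel⁻ _ (range s L) i)))))))
            (t≁x ∷ᵃ All.map⁺ (All.tabulate (λ {p} i → not-true⇒false (proj₂ (∧-split {U p} (proj₂ (∈-sel⁻ _ (range s L) i))))))))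
          arith : ∀ k' h m → suc m + suc (k' + h) ≡ suc (0 + (k' + suc (h + m)))
          arith k' h m = solve (k' ∷ h ∷ m ∷ [])

      two-hits : ∀ {t} → inZ t ≡ false → t ≁ x → ∀ s → 2 ≤ cnt (hit t) s L
      two-hits {t} ht t≁x s = ≮⇒≥ (λ g → lin 0 (many-hits ht t≁x s ⊕ k'<d ⊕ g) (arith k' d (cnt (hit t) s L)))
        where
          arith : ∀ k' d h → suc d + (suc k' + suc h) ≡ suc (0 + (k' + h + (d + 2)))
          arith k' d h = solve (k' ∷ d ∷ h ∷ [])

    -- Outside Z it would have two hits, and the cycle could take in both `y` and x.
    off∈Z : ∀ {y} → Off y → inZ y ≡ true
    off∈Z {y} oy with bool-split (inZ y)
    ... | inj₁ h = h
    ... | inj₂ h with two-elements (hit y) 0 L (two-hits h (off-indep oy ox) 0)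
    ... | p , q , _ , lt , q<L , a , b = ⊥-elim (f-off oy (hit-U y p a) (hit-U y q b) lt (<-≤-trans q<L (m≤n+m L p)) (hit-adj y p a) (hit-adj y q b))

  module P = Side 1 (λ u → ~ˢ (U-next u)) (λ u u' lt gt a → ear-successors ox nil u u' lt gt a) off-successors

  private
    from-suc : ∀ {p} → U p ≡ true → U (suc ((L ∸ 1) + p)) ≡ true
    from-suc {p} u = trans (cong U (L-1+ p)) (trans (U-per p) u)
    shift-lt : ∀ e {p q} → p < q → e + p < e + q
    shift-lt e {p} {q} lt = subst (_≤ e + q) (+-suc e p) (+-monoʳ-≤ e lt)
    shift-gt : ∀ e {p q} → q < p + L → e + q < e + p + L
    shift-gt e {p} {q} gt = subst (e + q <_) (sym (+-assoc e p L)) (shift-lt e gt)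

  module M = Side (L ∸ 1) (λ u → ~ˢ (U-cp u))
    (λ u u' lt gt a → ear-predecessors (from-suc u) (from-suc u') (shift-lt (L ∸ 1) lt) (shift-gt (L ∸ 1) gt) a)
    (λ oy u u' lt gt a b → off-predecessors oy (from-suc u) (from-suc u') (shift-lt (L ∸ 1) lt) (shift-gt (L ∸ 1) gt) a b)

  -- Rerouting the cycle at two consecutive vertices

  pieces : ∀ {s p q} → s < p → p < q → q < s + L →
    I (suc s) (s + L) ≡ I (suc s) p ++ I (suc p) q ++ I (suc q) (s + L)
  pieces {s} {p} {q} a b d = trans (I-++ a (<-trans b d)) (cong (I (suc s) p ++_) (I-++ b d))

  -- The edge from `c s` to `c (suc s)` is removed and x inserted. The two letters tell whether the
  -- chords at `c s` and at `c (suc s)` lead to a successor (s) or a predecessor (p) of a neighbour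
  -- of x. In each case one order of the far ends closes up to a cycle through x.
  cut-ss : ∀ {s p q} → s < p → p < q → q < s + L → U p ≡ true → U q ≡ true →
    c s ~ c (suc p) → c (suc s) ~ c (suc q) → ⊥
  cut-ss {s} {p} {q} a b d u u' e e' = only-x s
    (pt x ⟨ u ⟩ down a ⟨ e' ⟩ up d ⟨ at-wrap e ⟩ up b) (~ˢ u')
    (prep x (↭-trans (permute 3 (λ A B D → A ⊞ D ⊞ B ⊜ A ⊞ B ⊞ D) ↭-refl (I (suc s) p) (I (suc p) q) (I (suc q) (s + L)))
      (↭-reflexive (sym (pieces a b d)))))

  cut-sp : ∀ {s p r} → s < p → p < r → r < s + L → U p ≡ true → U (suc r) ≡ true →
    c s ~ c (suc p) → c (suc s) ~ c r → ⊥
  cut-sp {s} {p} {r} a b d u u' e e' = only-x s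
    (pt x ⟨ u ⟩ down a ⟨ e' ⟩ down b ⟨ ~ˢ (at-wrap e) ⟩ down d) (~ˢ u')
    (prep x (↭-reflexive (sym (pieces a b d))))

  cut-ps : ∀ {s p r} → s < p → p < r → r < s + L → U p ≡ true → U (suc r) ≡ true →
    c (suc s) ~ c (suc p) → c s ~ c r → ⊥
  cut-ps {s} {p} {r} a b d u u' e e' = only-x s
    (pt x ⟨ u ⟩ down a ⟨ e ⟩ up b ⟨ ~ˢ (at-wrap e') ⟩ down d) (~ˢ u')
    (prep x (↭-reflexive (sym (pieces a b d))))

  cut-pp : ∀ {s r r'} → s < r → r < r' → r' < s + L → U (suc r) ≡ true → U (suc r') ≡ true →
    c s ~ c r → c (suc s) ~ c r' → ⊥
  cut-pp {s} {r} {r'} a b d u u' e e' = only-x s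
    (pt x ⟨ u ⟩ up b ⟨ ~ˢ e' ⟩ up a ⟨ ~ˢ (at-wrap e) ⟩ down d) (~ˢ u')
    (prep x (↭-trans (permute 3 (λ A B D → B ⊞ A ⊞ D ⊜ A ⊞ B ⊞ D) ↭-refl (I (suc s) r) (I (suc r) r') (I (suc r') (s + L)))
      (↭-reflexive (sym (pieces a b d)))))

  M-f-suc : ∀ r → M.f (suc r) ≡ c r
  M-f-suc = cp-suc

  M-hit⁺ : ∀ {v r} → U (suc r) ≡ true → v ~ c r → M.hit v (suc r) ≡ true
  M-hit⁺ {v} {r} u e = M.hit-intro u (subst (v ~_) (sym (M-f-suc r)) e)

  M-hit⁻ : ∀ {v r} → M.hit v (suc r) ≡ true → v ~ c r
  M-hit⁻ {v} {r} h = subst (v ~_) (M-f-suc r) (M.hit-adj v (suc r) h)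

  in-M : ∀ {r} → U (suc r) ≡ true → M.inZ (c r) ≡ true
  in-M {r} u = subst (λ v → M.inZ v ≡ true) (M-f-suc r) (M.f∈Z u)

  module Cut (s : ℕ) (n₀ : U s ≡ false) (n₁ : U (suc s) ≡ false) where

    -- The ends of the window are `c (suc s)` and `c (s + L) = c s`, neither adjacent to x.
    inner : ∀ {p} → suc s ≤ p → p < suc s + L → U p ≡ true → suc s < p × p < s + L
    inner {p} a b u = ≤∧≢⇒< a (λ { refl → true≢false u n₁ }) ,
      ≤∧≢⇒< (≤-pred b) (λ { refl → true≢false (trans (sym (U-per s)) u) n₀ })

    gap : ∀ {p r} → U p ≡ true → U (suc r) ≡ true → p < suc r → p < r
    gap u u' (s≤s le) = ≤∧≢⇒< le (λ { refl → true≢false u' (U-next u) })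

    plus-next≼plus : P.hit (c (suc s)) ≼ P.hit (c s) within suc s , L
    plus-next≼plus {p} {q} a b a' b' h h' = ≮⇒≥ λ q<p →
      let u = P.hit-U _ p h ; u' = P.hit-U _ q h' in
      cut-ss a' q<p (proj₂ (inner a b u)) u' u (P.hit-adj _ q h') (P.hit-adj _ p h)

    minus-next≼plus : M.hit (c (suc s)) ≼ P.hit (c s) within suc s , L
    -- A predecessor is recorded at the position of the neighbour of x that follows it, so `suc r`
    -- stands for `c r`; position 0 is below everything.
    minus-next≼plus {zero} a b a' b' h h' = z≤n
    minus-next≼plus {suc r} {q} a b a' b' h h' = ≮⇒≥ λ q<p →
      let u = M.hit-U _ (suc r) h ; u' = P.hit-U _ q h' in
      cut-sp a' (gap u' u q<p) (<⇒≤ (proj₂ (inner a b u))) u' u (P.hit-adj _ q h') (M-hit⁻ h)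

    minus≼plus-next : M.hit (c s) ≼ P.hit (c (suc s)) within suc s , L
    minus≼plus-next {zero} a b a' b' h h' = z≤n
    minus≼plus-next {suc r} {q} a b a' b' h h' = ≮⇒≥ λ q<p →
      let u = M.hit-U _ (suc r) h ; u' = P.hit-U _ q h' in
      cut-ps a' (gap u' u q<p) (<⇒≤ (proj₂ (inner a b u))) u' u (P.hit-adj _ q h') (M-hit⁻ h)

    minus-next≼minus : M.hit (c (suc s)) ≼ M.hit (c s) within suc s , L
    minus-next≼minus {zero} a b a' b' h h' = z≤n
    minus-next≼minus {suc r} {zero} a b () b' h h'
    minus-next≼minus {suc r'} {suc r} a b a' b' h h' = ≮⇒≥ λ lt →
      let u = M.hit-U _ (suc r') h ; u' = M.hit-U _ (suc r) h' in
      cut-pp (≤-pred (proj₁ (inner a' b' u'))) (≤-pred lt) (<⇒≤ (proj₂ (inner a b u))) u' u (M-hit⁻ h') (M-hit⁻ h)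

  three-large : ∀ (A B D : ℕ → Bool) s → (∀ p → A p ≡ true → U p ≡ true) → (∀ p → B p ≡ true → U p ≡ true) →
    (∀ p → D p ≡ true → U p ≡ true) → suc d ≤ k' + cnt A s L → suc d ≤ k' + cnt B s L → suc d ≤ k' + cnt D s L →
    A ≼ B within s , L → B ≼ D within s , L → ⊥
  three-large A B D s hA hB hD a b e o o' = lin 0 (a ⊕ b ⊕ e ⊕ 3k'≤2d ⊕ sums) (arith d k' (cnt A s L) (cnt B s L) (cnt D s L))
    where
      -- Without an element of `B` the two comparisons would say nothing about `A` and `D`.
      B-nonempty : 1 ≤ cnt B s L
      B-nonempty = ≮⇒≥ (λ g → lin 1 (b ⊕ k'<d ⊕ g) (arith₁ d k' (cnt B s L)))
        where
          arith₁ : ∀ d k' h → suc d + (suc k' + suc h) ≡ suc (1 + (k' + h + (d + 1)))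
          arith₁ d k' h = solve (d ∷ k' ∷ h ∷ [])
      sums : cnt A s L + (cnt B s L + cnt D s L) ≤ 2 + d
      sums = subst (λ t → _ ≤ 2 + t) (cnt-U s) (cnt-≼-≼ A B D U s L hA hB hD B-nonempty o o')
      arith : ∀ d k' a b e → suc d + (suc d + (suc d + (3 * k' + (a + (b + e))))) ≡
        suc (0 + (k' + a + (k' + b + (k' + e + (2 * d + (2 + d))))))
      arith d k' a b e = solve (d ∷ k' ∷ a ∷ b ∷ e ∷ [])

  U≁ : ∀ {p} → U p ≡ false → c p ≁ x
  U≁ = ~ˢ

  -- In this and the next two exclusions, membership in T or T⁻ makes a set of hits large, and the
  -- orders at one or two consecutive edges put three such sets in a chain.
  no-TT-with-first-in-T⁻ : ∀ {s} → U s ≡ false → U (suc s) ≡ false → P.inZ (c s) ≡ false → P.inZ (c (suc s)) ≡ false → M.inZ (c s) ≡ false → ⊥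
  no-TT-with-first-in-T⁻ {s} n₀ n₁ t t' m = three-large (M.hit (c s)) (P.hit (c (suc s))) (P.hit (c s)) (suc s)
    (M.hit-U _) (P.hit-U _) (P.hit-U _) (M.many-hits m (U≁ n₀) _) (P.many-hits t' (U≁ n₁) _) (P.many-hits t (U≁ n₀) _)
    (Cut.minus≼plus-next s n₀ n₁) (Cut.plus-next≼plus s n₀ n₁)

  no-T⁻T⁻-with-second-in-T : ∀ {s} → U s ≡ false → U (suc s) ≡ false → M.inZ (c s) ≡ false → M.inZ (c (suc s)) ≡ false → P.inZ (c (suc s)) ≡ false → ⊥
  no-T⁻T⁻-with-second-in-T {s} n₀ n₁ m m' t = three-large (M.hit (c (suc s))) (M.hit (c s)) (P.hit (c (suc s))) (suc s)
    (M.hit-U _) (M.hit-U _) (P.hit-U _) (M.many-hits m' (U≁ n₁) _) (M.many-hits m (U≁ n₀) _) (P.many-hits t (U≁ n₁) _)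
    (Cut.minus-next≼minus s n₀ n₁) (Cut.minus≼plus-next s n₀ n₁)

  no-T-T⁻-T⁻ : ∀ {s} → U s ≡ false → U (suc s) ≡ false → U (suc (suc s)) ≡ false →
    P.inZ (c s) ≡ false → M.inZ (c (suc s)) ≡ false → M.inZ (c (suc (suc s))) ≡ false → ⊥
  no-T-T⁻-T⁻ {s} n₀ n₁ n₂ t m m' = three-large (M.hit (c (suc (suc s)))) (M.hit (c (suc s))) (P.hit (c s)) (suc s)
    (M.hit-U _) (M.hit-U _) (P.hit-U _) (M.many-hits m' (U≁ n₂) _) (M.many-hits m (U≁ n₁) _) (P.many-hits t (U≁ n₀) _)
    -- The order at the next edge concerns the window one position later. The first vertex of the
    -- present window is not adjacent to x, so the hits lie in both.
    (λ {p} {q} a b a' b' h h' → Cut.minus-next≼minus (suc s) n₁ n₂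
      (proj₁ (Cut.inner s n₀ n₁ a b (M.hit-U _ p h))) (m≤n⇒m≤1+n b)
      (proj₁ (Cut.inner s n₀ n₁ a' b' (M.hit-U _ q h'))) (m≤n⇒m≤1+n b') h h')
    (Cut.minus-next≼plus s n₀ n₁)

  P-T : ∀ {v p} → U p ≡ true → v ~ c (suc p) → P.inZ v ≡ false
  P-T {v} u e with bool-split (P.inZ v)
  ... | inj₁ h = ⊥-elim (true≢false e (P.Z-f h u))
  ... | inj₂ h = h

  P-T' : ∀ {v w} → v ~ w → P.inZ w ≡ true → P.inZ v ≡ false
  P-T' {v} e hw with bool-split (P.inZ v)
  ... | inj₁ h = ⊥-elim (true≢false e (P.Z-indep h hw))
  ... | inj₂ h = h

  M-T' : ∀ {v w} → v ~ w → M.inZ w ≡ true → M.inZ v ≡ false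
  M-T' {v} e hw with bool-split (M.inZ v)
  ... | inj₁ h = ⊥-elim (true≢false e (M.Z-indep h hw))
  ... | inj₂ h = h

  prev-U : ∀ {s} → U (suc s) ≡ true → U s ≡ false
  prev-U {s} u = ¬~⇒≁ {G = G} (λ u' → true≢false u (U-next u'))

  -- Chords from a predecessor to a successor

  module Jump {s l : ℕ} (u : U (suc s) ≡ true) (s<l : s < l) (l< : l < suc s + L) (ul : U l ≡ true) (e : c s ~ c (suc l)) where

    v : Fin n
    v = c (suc (suc l))

    v≁x : U (suc (suc l)) ≡ false
    v≁x = ¬~⇒≁ {G = G} (λ u' → true≢false e (M.Z-indep (in-M u) (in-M u')))

    v∈T : P.inZ v ≡ false
    v∈T = P-T ul (~ˢ (c-adj (suc l)))

    first∈T⁻ : M.inZ (c (suc l)) ≡ false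
    first∈T⁻ = M-T' (~ˢ e) (in-M u)

    v∈Z⁻ : M.inZ v ≡ true
    v∈Z⁻ with bool-split (M.inZ v)
    ... | inj₁ h = h
    ... | inj₂ h = ⊥-elim (no-T⁻T⁻-with-second-in-T (U-next ul) v≁x first∈T⁻ h v∈T)

    -- Seen from `c (suc l)`, the chord is a predecessor hit at `suc s + L`. The order at the edge
    -- from `c (suc l)` to `v` pushes every hit of `v` beyond `l` up to that position, out of the
    -- window.
    v-below : ∀ {q} → s < q → q < suc s + L → P.hit v q ≡ true → q ≤ l
    v-below {q} s<q q< h = ≮⇒≥ λ l<q → <-irrefl refl (<-≤-trans q<
      (Cut.minus≼plus-next (suc l) (U-next ul) v≁x {suc s + L} {q} (s≤s l<') (s≤s (s≤s (+-monoˡ-≤ L (<⇒≤ s<l))))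
        (≤∧≢⇒< l<q (λ { refl → true≢false (P.hit-U v q h) (U-next ul) }))
        (<-trans q< (s≤s (s≤s (+-monoˡ-≤ L (<⇒≤ s<l)))))
        (M-hit⁺ (trans (U-per (suc s)) u) (subst (c (suc l) ~_) (sym (c-per s)) (~ˢ e))) h))
      where
        l<' : suc l ≤ s + L
        l<' = ≤∧≢⇒< (≤-pred l<) (λ { refl → true≢false ul (trans (U-per s) (prev-U u)) })

  -- If `l` is the least hit of `b`, the vertex `v` two steps after `l` has all its hits at or below
  -- `l`. This puts a third large set in front of the hits of `b` and of `c s`.
  no-TT-at-end : ∀ {s} → U s ≡ false → U (suc (suc s)) ≡ true → P.inZ (c s) ≡ false → P.inZ (c (suc s)) ≡ false → ⊥
  no-TT-at-end {s} n₀ u t t' = finish (two-elements (P.hit b) (suc s) L (P.two-hits t' (U≁ n₁) (suc s)))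
    where
      b : Fin n
      b = c (suc s)
      n₁ : U (suc s) ≡ false
      n₁ = prev-U u
      finish : (∃ λ p → ∃ λ q → suc s ≤ p × p < q × q < suc s + L × P.hit b p ≡ true × P.hit b q ≡ true) → ⊥
      finish (p , _ , sp , lt , q< , h , _) with first (P.hit b) (suc s) L p sp (<-trans lt q<) h
      ... | l , sl , l≤p , hl , least = three-large (P.hit v) (P.hit b) (P.hit (c s)) (suc s)
          (P.hit-U v) (P.hit-U b) (P.hit-U (c s)) (P.many-hits v∈T (U≁ v≁x) _) (P.many-hits t' (U≁ n₁) _) (P.many-hits t (U≁ n₀) _)
          (λ {p'} {q'} a b' a' b'' g g' → ≤-trans (v-below (inside a g) (m≤n⇒m≤1+n b') g)
            (≮⇒≥ (λ q'<l → true≢false g' (least q' a' q'<l))))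
          (Cut.plus-next≼plus s n₀ n₁)
        where
          inside' : ∀ {p} → suc s ≤ p → U p ≡ true → suc s < p
          inside' a u' = ≤∧≢⇒< a (λ { refl → true≢false u' n₁ })
          open Jump {suc s} {l} u (inside' sl (P.hit-U b l hl)) (m≤n⇒m≤1+n (<-trans (≤-<-trans l≤p lt) q<)) (P.hit-U b l hl) (P.hit-adj b l hl)
          inside : ∀ {p} → suc s ≤ p → P.hit v p ≡ true → suc s < p
          inside {p} a g = inside' a (P.hit-U v p g)

  -- Counting the vertices of Z missed by a predecessor outside Z

  module _ {s : ℕ} (u : U (suc s) ≡ true) (b∈T : P.inZ (c s) ≡ false) where

    private
      b : Fin n
      b = c s

      top : ℕ
      top = suc s + L

    Clear : ℕ → ℕ → Set
    Clear q z = ∀ i → q < i → i ≤ z → U i ≡ false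

    -- At a neighbour `q` of x the vertex `c (suc q)` is in Z anyway. `clear` keeps the second miss
    -- before the next neighbour of x, so misses found for different `q` differ.
    record TwoMisses (q : ℕ) : Set where
      field
        first-miss  : b ≁ c (suc q)
        at          : ℕ
        q<at        : suc q < at
        at<top      : at < top
        clear       : Clear q at
        at∈Z        : P.inZ (c at) ≡ true
        second-miss : b ≁ c at

    Counted : ℕ → ℕ → Set
    Counted m z = s < z × z < top × P.inZ (c z) ≡ true × b ≁ c z ×
      ∃ λ q → s < q × q < suc s + m × q < z × Clear q z

    widen : ∀ {m z} → Counted m z → Counted (suc m) z
    widen {m} (a , b' , e , f , q , g , lt , r) = a , b' , e , f , q , g , <-≤-trans lt (+-monoʳ-≤ (suc s) (n≤1+n m)) , r

    -- The window grows on the right. By `Clear`, nothing counted for an earlier position reaches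
    -- the new neighbour `t` of x, so the two new vertices are new indeed.
    collect : (J : ℕ → Bool) → ∀ m → (∀ q → s < q → q < suc s + m → J q ≡ true → U q ≡ true × TwoMisses q) →
      ∃ λ zs → Unique zs × length zs ≡ 2 * cnt J (suc s) m × All (Counted m) zs
    collect J zero h = [] , []ᵘ , refl , []ᵃ
    collect J (suc m) h with collect J m (λ q a lt → h q a (<-≤-trans lt (+-monoʳ-≤ (suc s) (n≤1+n m))))
    ... | zs , uz , len , az with J (suc s + m) in eJ
    ... | false = zs , uz , trans len (cong (2 *_) (sym same)) , All.map widen az
      where
        same : cnt J (suc s) (suc m) ≡ cnt J (suc s) m
        same = trans (cong (length ∘ sel J) (range-∷ʳ (suc s) m)) (trans (length-sel-++ J (range (suc s) m) _)
          (trans (cong (cnt J (suc s) m +_) none) (+-identityʳ _)))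
          where
            none : length (sel J [ suc s + m ]) ≡ 0
            none rewrite eJ = refl
    ... | true = suc t ∷ at ∷ zs
        , ((λ e → <-irrefl e q<at) ∷ᵃ All.map (λ {z} z∈ e → <-irrefl refl (<-trans (subst (_< t) (sym e) (below z∈)) ≤-refl)) az)
          ∷ᵘ All.map (λ {z} z∈ e → <-irrefl refl (<-trans (<-trans ≤-refl q<at) (subst (_< t) (sym e) (below z∈)))) az ∷ᵘ uz
        , trans (cong (λ l → suc (suc l)) len) (trans (arith (cnt J (suc s) m)) (cong (2 *_) (sym same)))
        , (s<  , <-trans q<at at<top , P.f∈Z ut , first-miss , t , s<t , t< , ≤-refl ,
            (λ i a b' → subst (λ j → U j ≡ false) (≤-antisym a b') (U-next ut)))
          ∷ᵃ (<-trans s< q<at , at<top , at∈Z , second-miss , t , s<t , t< , <-trans ≤-refl q<at , clear)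
          ∷ᵃ All.map widen az
      where
        t : ℕ
        t = suc s + m
        s<t : s < t
        s<t = m≤m+n (suc s) m
        s< : s < suc t
        s< = m≤n⇒m≤1+n s<t
        t< : t < suc s + suc m
        t< = subst (t <_) (sym (+-suc (suc s) m)) ≤-refl
        ut : U t ≡ true
        ut = proj₁ (h t s<t t< eJ)
        open TwoMisses (proj₂ (h t s<t t< eJ))
        below : ∀ {z} → Counted m z → z < t
        below (_ , _ , _ , _ , q , _ , lt , _ , cl) = ≰⇒> (λ le → true≢false ut (cl t lt le))
        same : cnt J (suc s) (suc m) ≡ cnt J (suc s) m + 1
        same = trans (cong (length ∘ sel J) (range-∷ʳ (suc s) m)) (trans (length-sel-++ J (range (suc s) m) _)
          (cong (cnt J (suc s) m +_) one))
          where
            one : length (sel J [ suc s + m ]) ≡ 1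
            one rewrite eJ = refl
        arith : ∀ a → suc (suc (2 * a)) ≡ 2 * (a + 1)
        arith a = solve (a ∷ [])

    -- Of the `h ≥ d + 1 - k'` hits of `v`, all but at most one lie below `p`. Each of these gives
    -- two missed vertices of Z, and x is one more: `2 (h - 1) + 1 ≤ k'`, so again `2 d < 3 k'`.
    -- That `v` is in Z⁻ puts its neighbours into T⁻, as `misses` asks.
    too-many-misses : ∀ {p v} → s < p → p < top → P.inZ v ≡ false → v ≁ x → M.inZ v ≡ true →
      (∀ {q} → s < q → q < top → P.hit v q ≡ true → q ≤ p) →
      (∀ {q} → s < q → q < p → U q ≡ true → M.inZ (c (suc q)) ≡ false → TwoMisses q) → ⊥
    too-many-misses {p} {v} s<p p< v∈T v≁x v∈Z⁻ below misses = conclude (collect (P.hit v) m found)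
      where
        m : ℕ
        m = p ∸ suc s
        p≡ : suc s + m ≡ p
        p≡ = m+[n∸m]≡n s<p
        found : ∀ q → s < q → q < suc s + m → P.hit v q ≡ true → U q ≡ true × TwoMisses q
        found q a lt h = P.hit-U v q h , misses a (subst (q <_) p≡ lt) (P.hit-U v q h) (M-T' (~ˢ (P.hit-adj v q h)) v∈Z⁻)
        rest : ℕ
        rest = L ∸ m
        L≡ : m + rest ≡ L
        L≡ = m+[n∸m]≡n (≮⇒≥ λ L<m → lin 1 (L<m ⊕ p< ⊕ ≤-reflexive p≡) (arith L m p s))
          where
            arith : ∀ L m p s → suc L + (suc p + (suc s + m)) ≡ suc (1 + (m + (suc s + L + p)))
            arith L m p s = solve (L ∷ m ∷ p ∷ s ∷ [])
        later : ∀ r → p + suc r ≤ top → cnt (P.hit v) (suc p) r ≡ 0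
        later r bd = cnt-zero _ (suc p) r (λ q a b' h → <-irrefl refl (<-≤-trans a
          (below (<-trans s<p a) (<-≤-trans b' (subst (_≤ top) (+-suc p r) bd)) h)))
        at-most-one : ∀ r → p + r ≤ top → cnt (P.hit v) p r ≤ 1
        at-most-one zero _ = z≤n
        at-most-one (suc r) bd with P.hit v p
        ... | true = ≤-reflexive (cong suc (later r bd))
        ... | false = ≤-trans (≤-reflexive (later r bd)) z≤n
        almost : cnt (P.hit v) (suc s) L ≤ cnt (P.hit v) (suc s) m + 1
        almost = subst (_≤ cnt (P.hit v) (suc s) m + 1)
          (sym (trans (cong (cnt (P.hit v) (suc s)) (sym L≡)) (trans (cong (length ∘ sel (P.hit v)) (range-++ (suc s) m rest))
            (length-sel-++ (P.hit v) (range (suc s) m) _))))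
          (+-monoʳ-≤ (cnt (P.hit v) (suc s) m) (subst (λ t → cnt (P.hit v) t rest ≤ 1) (sym p≡)
            (at-most-one rest (≤-reflexive (trans (cong (_+ rest) (sym p≡)) (trans (+-assoc (suc s) m rest) (cong (suc s +_) L≡)))))))
        conclude : (∃ λ zs → Unique zs × length zs ≡ 2 * cnt (P.hit v) (suc s) m × All (Counted m) zs) → ⊥
        conclude (zs , uz , len , az) = lin 0 (few ⊕ many ⊕ many ⊕ 3k'≤2d ⊕ almost ⊕ almost)
            (arith k' d (cnt (P.hit v) (suc s) L) (cnt (P.hit v) (suc s) m))
          where
            many : suc d ≤ k' + cnt (P.hit v) (suc s) L
            many = P.many-hits v∈T v≁x (suc s)
            few : suc (2 * cnt (P.hit v) (suc s) m) ≤ k'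
            few = subst (λ l → suc l ≤ k') (trans (length-map c zs) len) (P.few-misses b∈T
              (All.tabulate (λ i eq → let (q , _ , e) = ∈-map⁻ c i in ox q (trans eq e)) ∷ᵘ
                Unique-c (suc s) uz (All.map (λ z∈ → proj₁ z∈ , proj₁ (proj₂ z∈)) az))
              (P.x∈Z ∷ᵃ All.map⁺ (All.map (λ z∈ → proj₁ (proj₂ (proj₂ z∈))) az))
              (U≁ (prev-U u) ∷ᵃ All.map⁺ (All.map (λ z∈ → proj₁ (proj₂ (proj₂ (proj₂ z∈)))) az)))
            arith : ∀ k' d h m → suc (2 * m) + (suc d + (suc d + (3 * k' + (h + h)))) ≡
              suc (0 + (k' + (k' + h + (k' + h + (2 * d + (m + 1 + (m + 1)))))))
            arith k' d h m = solve (k' ∷ d ∷ h ∷ m ∷ [])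

    -- A hit `l` of `b` gives by `Jump` a vertex to which `too-many-misses` applies once every
    -- relevant gap before `l` holds two misses. The two later neighbours `p` and `p₂` passed to
    -- `no-short` locate `q` when `d = 3` is known.
    short-segment : (∀ {q p p₂} → s < q → q < p → p < p₂ → p₂ < top → U q ≡ true → U p ≡ true → U p₂ ≡ true →
      U (3 + q) ≡ true → ⊥) → ⊥
    short-segment no-short = finish (two-elements (P.hit b) (suc s) L (P.two-hits b∈T (U≁ (prev-U u)) (suc s)))
      where
        module At {l l₂ : ℕ} (s<l : s < l) (l<l₂ : l < l₂) (l₂< : l₂ < top) (ul : U l ≡ true) (ul₂ : U l₂ ≡ true) where

          Goal : ℕ → Set
          Goal q = s < q → q < l → U q ≡ true → M.inZ (c (suc q)) ≡ false → TwoMisses q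

          -- The next neighbour of x after `q` is `4 + e`, so the gap ends with `c (1 + e)`,
          -- `c (2 + e)`, `c (3 + e)`; it consists of just these if `q = e`.
          long : ∀ {q} j → s < q → U q ≡ true → M.inZ (c (suc q)) ≡ false → let e = q + j in 4 + e ≤ l →
            U (4 + e) ≡ true → (∀ i → q < i → i < 4 + e → U i ≡ false) →
            (∀ {q'} → s < q' → q' < q → U q' ≡ true → M.inZ (c (suc q')) ≡ false → TwoMisses q') → TwoMisses q
          long {q} j s<q uq m nx≤l unx none rec = by-first (adj-split b (c (suc q)))
            where
              e : ℕ
              e = q + j
              q≤e : q ≤ e
              q≤e = m≤m+n q j
              nx<top : 4 + e < top
              nx<top = ≤-<-trans nx≤l (<-trans l<l₂ l₂<)
              q<top : q < top
              q<top = <-trans (≤-<-trans q≤e (lit 0 4)) nx<top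
              clear-to : ∀ {z} → z < 4 + e → Clear q z
              clear-to z< i a b' = none i a (≤-<-trans b' z<)
              t∈M : M.inZ (c (2 + e)) ≡ false
              t∈M = M-T' (c-adj (2 + e)) (in-M unx)

              -- Here `c (1 + e)` and `c (2 + e)` are in T⁻. The exclusions force `c e` into both Z
              -- and Z⁻, and `b`, itself in Z⁻, misses it.
              deeper : b ≁ c (suc q) → q < e → P.inZ (c (1 + e)) ≡ false → M.inZ (c (1 + e)) ≡ false → TwoMisses q
              deeper miss q<e y∈T y∈T⁻ with bool-split (M.inZ (c e)) | bool-split (P.inZ (c e))
              ... | inj₂ h | _ = ⊥-elim (no-T⁻T⁻-with-second-in-T (none e q<e (lit 0 4))
                    (none (1 + e) (m≤n⇒m≤1+n q<e) (lit 1 4)) h y∈T⁻ y∈T)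
              ... | inj₁ _ | inj₂ h = ⊥-elim (no-T-T⁻-T⁻ (none e q<e (lit 0 4))
                    (none (1 + e) (m≤n⇒m≤1+n q<e) (lit 1 4))
                    (none (2 + e) (m≤n⇒m≤1+n (m≤n⇒m≤1+n q<e)) (lit 2 4)) h y∈T⁻ t∈M)
              ... | inj₁ h⁻ | inj₁ h = record
                    { first-miss = miss ; at = e
                    -- `c (suc q)` lies in T⁻ and `c e` does not, so the two misses differ.
                    ; q<at = ≤∧≢⇒< q<e (λ eq → true≢false h⁻ (subst (λ t → M.inZ (c t) ≡ false) eq m))
                    ; at<top = <-trans (lit 0 4) nx<top
                    ; clear = clear-to (lit 0 4)
                    ; at∈Z = h ; second-miss = M.Z-indep (in-M u) h⁻ }

              -- The adjacency of `b` to `c (2 + e)` is a predecessor hit of the latter at `top`,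
              -- which pushes the hits of `c (1 + e)` beyond `q` out of the window.
              below : q < e → b ~ c (2 + e) → ∀ {r} → s < r → r < top → P.hit (c (1 + e)) r ≡ true → r ≤ q
              below q<e bz {r} s<r r< h = ≮⇒≥ λ q<r → <-irrefl refl (<-≤-trans r<
                (Cut.minus-next≼plus (1 + e) (none (1 + e) (m≤n⇒m≤1+n q<e) (lit 1 4))
                  (none (2 + e) (m≤n⇒m≤1+n (m≤n⇒m≤1+n q<e)) (lit 2 4))
                  {top} {r} (<⇒≤ (<-trans (lit 2 4) nx<top)) top<
                  (≤-trans (<⇒≤ (lit 2 4)) (past q<r)) (<-trans r< top<)
                  (M-hit⁺ (trans (U-per (suc s)) u) (subst (c (2 + e) ~_) (sym (c-per s)) (~ˢ bz))) h))
                where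
                  top< : top < 2 + e + L
                  top< = s≤s (s≤s (+-monoˡ-≤ L (<⇒≤ (<-≤-trans s<q q≤e))))
                  past : q < r → 4 + e ≤ r
                  past q<r = ≮⇒≥ (λ r<nx → true≢false (P.hit-U _ r h) (none r q<r r<nx))

              by-third : b ≁ c (suc q) → P.inZ (c (2 + e)) ≡ true → b ~ c (2 + e) ⊎ b ≁ c (2 + e) → TwoMisses q
              by-third miss z∈Z (inj₂ miss') = record
                { first-miss = miss ; at = 2 + e ; q<at = s≤s (s≤s q≤e)
                ; at<top = <-trans (lit 2 4) nx<top
                ; clear = clear-to (lit 2 4) ; at∈Z = z∈Z ; second-miss = miss' }
              by-third miss z∈Z (inj₁ bz) with P-T' (c-adj (1 + e)) z∈Z
              ... | y∈T with m≤n⇒m<n∨m≡n q≤e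
              ... | inj₂ q≡e = ⊥-elim (true≢false (P.f∈Z uq) (subst (λ t → P.inZ (c (suc t)) ≡ false) (sym q≡e) y∈T))
              ... | inj₁ q<e with bool-split (M.inZ (c (1 + e)))
              ... | inj₁ h = ⊥-elim (too-many-misses s<q q<top y∈T
                      (U≁ (none (1 + e) (m≤n⇒m≤1+n q<e) (lit 1 4))) h (below q<e bz) rec)
              ... | inj₂ h = deeper miss q<e y∈T h

              -- `c (3 + e)` is a predecessor like `b`, hence missed; the question is whether it
              -- lies in Z. If not, `c (2 + e)` does by `no-TT-at-end`.
              by-last : b ≁ c (suc q) → TwoMisses q
              by-last miss with bool-split (P.inZ (c (3 + e))) | bool-split (P.inZ (c (2 + e)))
              ... | inj₁ h | _ = record
                { first-miss = miss ; at = 3 + e ; q<at = s≤s (m≤n⇒m≤1+n (s≤s q≤e)) ; at<top = <-trans ≤-refl nx<top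
                ; clear = clear-to ≤-refl ; at∈Z = h ; second-miss = M.Z-indep (in-M u) (in-M unx) }
              ... | inj₂ h | inj₂ h' = ⊥-elim (no-TT-at-end (none (2 + e) (s≤s (m≤n⇒m≤1+n q≤e)) (lit 2 4)) unx h' h)
              ... | inj₂ h | inj₁ h' = by-third miss h' (adj-split b (c (2 + e)))

              by-first : b ~ c (suc q) ⊎ b ≁ c (suc q) → TwoMisses q
              by-first (inj₂ miss) = by-last miss
              -- With this chord `q` can play the part of `l`, and the induction hypothesis covers
              -- all earlier gaps.
              by-first (inj₁ a) = ⊥-elim (too-many-misses s<q q<top v∈T (U≁ v≁x) v∈Z⁻ v-below rec)
                where open Jump u s<q q<top uq a

          step′ : ∀ q → (∀ {q'} → q' < q → Goal q') → Goal q
          -- The next neighbour of x is at distance at least 4: distance 1 is excluded, at distance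
          -- 2 the vertex `c (suc q)` would be a predecessor and lie in Z⁻, and distance 3 is
          -- `no-short`.
          step′ q rec s<q q<l uq m with first U (suc q) L l q<l (<-≤-trans (<-trans l<l₂ l₂<) (s≤s (+-monoˡ-≤ L (<⇒≤ s<q)))) ul
          ... | nx , a , nx≤l , unx , none with m≤n⇒m<n∨m≡n a
          ... | inj₂ refl = ⊥-elim (true≢false unx (U-next uq))
          ... | inj₁ a₁ with m≤n⇒m<n∨m≡n a₁
          ... | inj₂ refl = ⊥-elim (true≢false (in-M unx) m)
          ... | inj₁ a₂ with m≤n⇒m<n∨m≡n a₂
          ... | inj₂ refl = ⊥-elim (no-short s<q q<l l<l₂ l₂< uq ul ul₂ unx)
          ... | inj₁ a₃ with nx ∸ (4 + q) | m+[n∸m]≡n a₃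
          ... | j | refl = long j s<q uq m nx≤l unx none (λ {q'} sq' q'<q → rec q'<q sq' (<-trans q'<q q<l))

          all-miss : ∀ {q} → Goal q
          all-miss {q} = <-rec Goal step′ q

        finish : (∃ λ p → ∃ λ q → suc s ≤ p × p < q × q < top × P.hit b p ≡ true × P.hit b q ≡ true) → ⊥
        finish (l , l₂ , sl , lt , l₂< , h , h₂) =
            too-many-misses sl (<-trans lt l₂<) v∈T (U≁ v≁x) v∈Z⁻ v-below (λ sq q<l → At.all-miss sl lt l₂< (P.hit-U b l h) (P.hit-U b l₂ h₂) sq q<l)
          where open Jump u sl (<-trans lt l₂<) (P.hit-U b l h) (P.hit-adj b l h)

  -- The case that all predecessors lie in Z

  module Alternating (pred∈Z : ∀ {r} → U (suc r) ≡ true → P.inZ (c r) ≡ true) where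

    -- Fix a hit `l` of `c (suc s)`. The rerouting orders deny `c s` the successors of the
    -- neighbours of x before `l` and the predecessors of those after `l`. All of these lie in Z, so
    -- counting x it misses `d ≥ k` vertices of Z.
    no-TT : ∀ {s} → P.inZ (c s) ≡ false → P.inZ (c (suc s)) ≡ false → ⊥
    no-TT {s} t t' = finish (two-elements (P.hit (c (suc s))) (suc s) L (P.two-hits t' (U≁ n₁) (suc s)))
      where
        n₀ : U s ≡ false
        n₀ = ¬~⇒≁ {G = G} (λ u → true≢false (P.f∈Z u) t')
        n₁ : U (suc s) ≡ false
        n₁ = ¬~⇒≁ {G = G} (λ u → true≢false (pred∈Z u) t)
        open Cut s n₀ n₁
        finish : (∃ λ p → ∃ λ q → suc s ≤ p × p < q × q < suc s + L × P.hit (c (suc s)) p ≡ true × P.hit (c (suc s)) q ≡ true) → ⊥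
        finish (l , _ , sl , lt , q< , hl , _) = lin 0 (few ⊕ total ⊕ k'<d) (arith (length ps) d k')
          where
            l< : l < suc s + L
            l< = <-trans lt q<
            other : ℕ → Bool
            other p with p ≟ l
            ... | yes _ = false
            ... | no _ = true
            other⇒≢ : ∀ {p} → other p ≡ true → p ≢ l
            other⇒≢ {p} o with p ≟ l
            ... | no h = h
            ¬other⇒≡ : ∀ {p} → not (other p) ≡ true → p ≡ l
            ¬other⇒≡ {p} o with p ≟ l
            ... | yes h = h
            ps : List ℕ
            ps = sel (λ p → U p ∧ other p) (range (suc s) L)
            info : ∀ {p} → p ∈ ps → suc s ≤ p × p < suc s + L × U p ≡ true × p ≢ l
            info {p} i with ∈-sel⁻ _ (range (suc s) L) i
            ... | j , h with ∧-split {U p} h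
            ... | up' , o = proj₁ (∈-range⁻ (suc s) L j) , proj₂ (∈-range⁻ (suc s) L j) , up' , other⇒≢ o
            total : d ≤ length ps + 1
            total = subst (_≤ length ps + 1) (cnt-U (suc s)) (subst (_≤ length ps + 1)
              (sym (length-sel-split U other (range (suc s) L))) (+-monoʳ-≤ (length ps)
              (Unique-⊆⇒length≤ {ys = [ l ]} (Unique-sel _ (Unique-range (suc s) L)) only-l)))
              where
                only-l : ∀ {p} → p ∈ sel (λ p → U p ∧ not (other p)) (range (suc s) L) → p ∈ [ l ]
                only-l {p} i = here (¬other⇒≡ (proj₂ (∧-split {U p} (proj₂ (∈-sel⁻ (λ p → U p ∧ not (other p)) (range (suc s) L) i)))))
            pos : ℕ → ℕ
            pos p with p <? l
            ... | yes _ = suc p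
            ... | no _ = p ∸ 1
            pos-cases : ∀ {p} → p ∈ ps → (p < l × pos p ≡ suc p) ⊎ (l < p × suc (pos p) ≡ p)
            pos-cases {p} i with p <? l
            ... | yes lt = inj₁ (lt , refl)
            ... | no ge with p | ≤∧≢⇒< (≮⇒≥ ge) (λ e → proj₂ (proj₂ (proj₂ (info i))) (sym e))
            ... | suc p' | l<p = inj₂ (l<p , refl)
            -- A collision of `pos` would need neighbours of x at distance two with `l` between
            -- them, next to both.
            apart : ∀ {p q} → p ∈ ps → q ∈ ps → p < l → l < q → suc (suc p) ≢ q
            apart i j a b refl = true≢false (subst (λ t → U t ≡ true) (≤-antisym (≤-pred b) a) (P.hit-U _ l hl))
              (U-next (proj₁ (proj₂ (proj₂ (info i)))))
            pos-inj : ∀ {p q} → p ∈ ps → q ∈ ps → pos p ≡ pos q → p ≡ q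
            pos-inj i j e with pos-cases i | pos-cases j
            ... | inj₁ (_ , a) | inj₁ (_ , b) = suc-injective (trans (sym a) (trans e b))
            ... | inj₂ (_ , a) | inj₂ (_ , b) = trans (sym a) (trans (cong suc e) b)
            ... | inj₁ (l₁ , a) | inj₂ (l₂ , b) = ⊥-elim (apart i j l₁ l₂ (trans (cong suc (trans (sym a) e)) b))
            ... | inj₂ (l₂ , b) | inj₁ (l₁ , a) = ⊥-elim (apart j i l₁ l₂ (trans (cong suc (trans (sym a) (sym e))) b))
            pos-window : ∀ {p} → p ∈ ps → suc s ≤ pos p × pos p < suc s + L
            pos-window i with pos-cases i | info i
            ... | inj₁ (a , e) | (sp , _) = subst (suc s ≤_) (sym e) (m≤n⇒m≤1+n sp) , subst (_< suc s + L) (sym e) (≤-<-trans a l<)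
            ... | inj₂ (a , e) | (_ , p< , _) = ≤-trans sl (≤-pred (subst (l <_) (sym e) a)) , <⇒≤ (subst (_< suc s + L) (sym e) p<)
            pos∈Z : ∀ {p} → p ∈ ps → P.inZ (c (pos p)) ≡ true
            pos∈Z i with pos-cases i | info i
            ... | inj₁ (_ , e) | (_ , _ , u , _) = subst (λ t → P.inZ (c t) ≡ true) (sym e) (P.f∈Z u)
            ... | inj₂ (_ , e) | (_ , _ , u , _) = pred∈Z (subst (λ t → U t ≡ true) (sym e) u)
            pos-missed : ∀ {p} → p ∈ ps → c s ≁ c (pos p)
            pos-missed {p} i with pos-cases i | info i
            ... | inj₁ (p<l , e) | (a , b , u , _) = ¬~⇒≁ {G = G} (λ f → <-irrefl refl (<-≤-trans p<l
                  (plus-next≼plus sl l< a b hl (P.hit-intro u (subst (λ t → c s ~ c t) e f)))))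
            ... | inj₂ (l<p , e) | (a , b , u , _) = ¬~⇒≁ {G = G} (λ f → <-irrefl refl (<-≤-trans (subst (l <_) (sym e) l<p)
                  (minus≼plus-next (subst (suc s ≤_) (sym e) a) (subst (_< suc s + L) (sym e) b) sl l<
                    (M-hit⁺ (subst (λ t → U t ≡ true) (sym e) u) f) hl)))
            few : suc (length ps) ≤ k'
            few = subst (λ m → suc m ≤ k') (trans (length-map c (map pos ps)) (length-map pos ps)) (P.few-misses t
              (All.tabulate (λ i eq → let (q , _ , e) = ∈-map⁻ c i in ox q (trans eq e)) ∷ᵘ
                Unique-c (suc s) (Unique-map pos pos-inj (Unique-sel _ (Unique-range (suc s) L))) (All.map⁺ (All.tabulate pos-window)))
              (P.x∈Z ∷ᵃ All.map⁺ (All.map⁺ (All.tabulate pos∈Z)))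
              (U≁ n₀ ∷ᵃ All.map⁺ (All.map⁺ (All.tabulate pos-missed))))
            arith : ∀ p d k' → suc p + (d + suc k') ≡ suc (0 + (k' + (p + 1 + d)))
            arith p d k' = solve (p ∷ d ∷ k' ∷ [])

    -- The vertices outside Z are on the cycle, and by `no-TT` their successors are in Z. As Z also
    -- contains x, it is larger than its complement.
    α-large : 2 * α G ≤ n → ⊥
    α-large h = lin 0 (h ⊕ I≤α ⊕ I≤α ⊕ ≤-reflexive total ⊕ fewer ⊕ injected) (arith (α G) n (length zs) (length ts) (length vs))
      where
        outside : Fin n → Bool
        outside v = not (P.inZ v)
        zs vs : List (Fin n)
        zs = sel P.inZ (allFin n)
        vs = sel outside (allFin n)
        ts : List ℕ
        ts = sel (λ p → outside (c p)) (range 0 L)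
        I≤α : length zs ≤ α G
        I≤α = independent≤α G P.inZ P.Z-indep
        sel-all : ∀ {A : Set} (us : List A) → sel (λ _ → true) us ≡ us
        sel-all [] = refl
        sel-all (u ∷ us) = cong (u ∷_) (sel-all us)
        total : n ≡ length zs + length vs
        total = trans (sym (trans (cong length (sel-all (allFin n))) (length-allFin n)))
          (length-sel-split (λ _ → true) P.inZ (allFin n))
        fewer : length vs ≤ length ts
        fewer = subst (length vs ≤_) (length-map c ts) (Unique-⊆⇒length≤ (Unique-sel outside (allFin⁺ n)) inc)
          where
            inc : ∀ {v} → v ∈ vs → v ∈ map c ts
            inc {v} i with proj₂ (∈-sel⁻ outside (allFin n) i) | on? v
            ... | o | no h = ⊥-elim (true≢false (P.off∈Z (off h)) (not-true⇒false o))
            ... | o | yes j with ∈-map⁻ c j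
            ... | q , q∈ , refl = ∈-map⁺ c (∈-sel⁺ _ (range 0 L) q∈ o)
        t-info : ∀ {p} → p ∈ ts → 0 ≤ p × p < L × P.inZ (c p) ≡ false
        t-info i with ∈-sel⁻ (λ p → outside (c p)) (range 0 L) i
        ... | j , o = z≤n , proj₂ (∈-range⁻ 0 L j) , not-true⇒false o
        injected : suc (length ts) ≤ length zs
        injected = subst (λ m → suc m ≤ length zs) (length-map P.f ts) (Unique-⊆⇒length≤
          (P.x∷f-unique 0 (Unique-sel _ (Unique-range 0 L)) (All.tabulate (λ i → z≤n , proj₁ (proj₂ (t-info i))))) inc)
          where
            inc : ∀ {v} → v ∈ x ∷ map P.f ts → v ∈ zs
            inc (here refl) = ∈-sel⁺ P.inZ (allFin n) (∈-allFin x) P.x∈Z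
            inc (there i) with ∈-map⁻ P.f i
            ... | p , p∈ , refl with bool-split (P.inZ (c (suc p)))
            ... | inj₁ h = ∈-sel⁺ P.inZ (allFin n) (∈-allFin _) h
            ... | inj₂ h = ⊥-elim (no-TT (proj₂ (proj₂ (t-info p∈))) h)
        arith : ∀ a n z t v → 2 * a + (z + (z + (n + (v + suc t)))) ≡ suc (0 + (n + (a + (a + (z + v + (t + z))))))
        arith a n z t v = solve (a ∷ n ∷ z ∷ t ∷ v ∷ [])

  -- Two neighbours of x at distance three

  module ShortSegment {s : ℕ} (u₀ : U s ≡ true) (u₃ : U (3 + s) ≡ true) where

    a b : Fin n
    a = c (suc s)
    b = c (2 + s)

    n₁ : U (suc s) ≡ false
    n₁ = U-next u₀

    n₂ : U (2 + s) ≡ false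
    n₂ = prev-U u₃

    a~b : a ~ b
    a~b = c-adj (suc s)

    a∈Z : P.inZ a ≡ true
    a∈Z = P.f∈Z u₀

    b∈Z⁻ : M.inZ b ≡ true
    b∈Z⁻ = in-M u₃

    b∈T : P.inZ b ≡ false
    b∈T = P-T u₀ (~ˢ a~b)

    a∈T⁻ : M.inZ a ≡ false
    a∈T⁻ = M-T' a~b b∈Z⁻

    open Cut (suc s) n₁ n₂ public

    abstract
      -- Taking the smaller of two hits gives `l < s + L`, so `c l` and `c (suc l)` both lie on the
      -- segment from `3 + s` to `s + L`.
      chord : ∃ λ l → 3 + s ≤ l × l < s + L × U l ≡ true × b ~ c (suc l)
      chord = finish (two-elements (P.hit b) (2 + s) L (P.two-hits b∈T (U≁ n₂) (2 + s)))
        where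
          finish : (∃ λ p → ∃ λ q → 2 + s ≤ p × p < q × q < 2 + s + L × P.hit b p ≡ true × P.hit b q ≡ true) →
            ∃ λ l → 3 + s ≤ l × l < s + L × U l ≡ true × b ~ c (suc l)
          finish (l , l₂ , sl , lt , l₂< , h , h₂) = l , proj₁ (inner sl (<-trans lt l₂<) (P.hit-U b l h)) ,
            <-≤-trans lt (≤-pred (proj₂ (inner (≤-trans sl (<⇒≤ lt)) l₂< (P.hit-U b l₂ h₂)))) , P.hit-U b l h , P.hit-adj b l h

    a-wrap : c (suc s + L) ≡ a
    a-wrap = c-per (suc s)

    frame : 3 + s ≤ s + L → I (2 + s) (suc s + L) ≡ b ∷ I (3 + s) (s + L) ++ [ a ]
    frame h = trans (I-++ {2 + s} {2 + s} {suc s + L} ≤-refl (m≤n⇒m≤1+n h))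
      (trans (cong (_++ I (3 + s) (suc s + L)) (I-[ 2 + s ]))
      (cong (b ∷_) (trans (I-++ {3 + s} {s + L} {suc s + L} h ≤-refl)
        (cong (I (3 + s) (s + L) ++_) (trans (I-[ suc s + L ]) (cong [_] a-wrap))))))

    -- x bridges the way from `s` to `3 + s`, and the freed edge from `a` to `b` is inserted between
    -- `c p` and `c (suc p)`.
    insert : ∀ {p} → 3 + s ≤ p → p < s + L → a ~ c p → b ~ c (suc p) → ⊥
    insert {p} h h' e e' = only-x (suc s) (pt x ⟨ u₃ ⟩ up h ⟨ ~ˢ e ⟩ pt a ⟨ a~b ⟩ pt b ⟨ e' ⟩ up h') (U-wrap u₀)
      (prep x (↭-trans (↭-insert (I (3 + s) p) (I (suc p) (s + L)) [ a ] [ b ])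
        (↭-reflexive (sym (trans (frame (≤-trans h (<⇒≤ h'))) (cong (λ J → b ∷ J ++ [ a ]) (I-++ h h')))))))

    -- x bridges the segment, `a` is inserted between its two neighbours, and `b` is taken in by
    -- means of `chord`; the route depends on the order of `p` and `l`. For `p = 2 + s` the first
    -- neighbour is `b` itself.
    no-consecutive : ∀ {p} → 2 + s ≤ p → p < s + L → a ~ c p → a ~ c (suc p) → ⊥
    no-consecutive {p} h h' e e' = go' chord (m≤n⇒m<n∨m≡n h)
      where
      go' : (∃ λ l → 3 + s ≤ l × l < s + L × U l ≡ true × b ~ c (suc l)) → 2 + s < p ⊎ 2 + s ≡ p → ⊥
      go' (l , sl , l< , ul , f) (inj₂ refl) = only-x (suc s)
        (pt x ⟨ ul ⟩ down sl ⟨ ~ˢ e' ⟩ pt a ⟨ a~b ⟩ pt b ⟨ f ⟩ up l<) (U-wrap u₀)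
        (prep x (↭-trans (↭-insert (I (3 + s) l) (I (suc l) (s + L)) [ a ] [ b ])
          (↭-reflexive (sym (trans (frame (≤-trans sl (<⇒≤ l<))) (cong (λ J → b ∷ J ++ [ a ]) (I-++ sl l<)))))))
      go' (l , sl , l< , ul , f) (inj₁ h₃) with <-cmp p l
      ... | tri≈ _ refl _ = true≢false e' (P.Z-f a∈Z ul)
      ... | tri< p<l _ _ = only-x (suc s)
        (pt x ⟨ ul ⟩ down p<l ⟨ ~ˢ e' ⟩ pt a ⟨ e ⟩ down h₃ ⟨ ~ˢ (c-adj (2 + s)) ⟩ pt b ⟨ f ⟩ up l<) (U-wrap u₀)
        (prep x (↭-trans (↭-detour₁ (I (3 + s) p) (I (suc p) l) (I (suc l) (s + L)) [ a ] [ b ])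
          (↭-reflexive (sym (trans (frame (≤-trans sl (<⇒≤ l<)))
            (cong (λ J → b ∷ J ++ [ a ]) (trans (I-++ h₃ (<-trans p<l l<)) (cong (I (3 + s) p ++_) (I-++ p<l l<)))))))))
      ... | tri> _ _ l<p = only-x (suc s)
        (pt x ⟨ ul ⟩ down sl ⟨ ~ˢ (c-adj (2 + s)) ⟩ pt b ⟨ f ⟩ up l<p ⟨ ~ˢ e ⟩ pt a ⟨ e' ⟩ up h') (U-wrap u₀)
        (prep x (↭-trans (↭-detour₂ (I (3 + s) l) (I (suc l) p) (I (suc p) (s + L)) [ a ] [ b ])
          (↭-reflexive (sym (trans (frame (≤-trans sl (<⇒≤ l<)))
            (cong (λ J → b ∷ J ++ [ a ]) (trans (I-++ sl (<-trans l<p h')) (cong (I (3 + s) l ++_) (I-++ l<p h')))))))))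

    -- The window of length `m` from `2 + s` covers the cycle except `a` and `c s`.
    m : ℕ
    m = L ∸ 2

    abstract
      2+m≡L : 2 + m ≡ L
      2+m≡L = m+[n∸m]≡n (≮⇒≥ λ L<2 → let (l , sl , l< , _) = chord in lin 2 (L<2 ⊕ sl ⊕ l<) (arith L s l))
        where
          arith : ∀ L s l → suc L + (3 + s + suc l) ≡ suc (2 + (2 + (l + (s + L))))
          arith L s l = solve (L ∷ s ∷ l ∷ [])

      end≡ : 2 + s + m ≡ s + L
      end≡ = trans (cong (_+ m) (+-comm 2 s)) (trans (+-assoc s 2 m) (cong (s +_) 2+m≡L))

      window-pos : ∀ {p} → p ∈ range (2 + s) m → 2 + s ≤ p × p < s + L
      window-pos {p} i = let (h , h') = ∈-range⁻ (2 + s) m i in h , subst (p <_) end≡ h'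

    -- At an exception `c (suc p)` is adjacent to x, hence outside Z, and `c (2 + p)` is adjacent to
    -- `b`: neither candidate of `μ` is a missed vertex of Z.
    a-nbr exc : ℕ → Bool
    a-nbr p = adj G a (c p)
    exc p = U (suc p) ∧ adj G b (c (2 + p))

    ordinary : List ℕ
    ordinary = sel (λ p → a-nbr p ∧ not (exc p)) (range (2 + s) m)

    abstract
      -- An exception is at once a predecessor hit of `a` and a successor hit of `b` at `suc p`, and
      -- the former come weakly before the latter.
      at-most-one-exception : cnt (λ p → a-nbr p ∧ exc p) (2 + s) m ≤ 1
      at-most-one-exception = ≮⇒≥ (λ g → finish (two-elements _ (2 + s) m g))
        where
          finish : (∃ λ p → ∃ λ q → 2 + s ≤ p × p < q × q < 2 + s + m × a-nbr p ∧ exc p ≡ true × a-nbr q ∧ exc q ≡ true) → ⊥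
          finish (p , q , sp , lt , q< , h , h') =
            let (_ , g) = ∧-split {a-nbr p} h ; (e , g') = ∧-split {a-nbr q} h'
                (v , e') = ∧-split {U (suc p)} g ; (v' , _) = ∧-split {U (suc q)} g'
                q<' = subst (q <_) end≡ q<
            in <-irrefl refl (<-≤-trans (s≤s lt)
              (minus≼plus-next {suc q} {suc p} (≤-trans sp (≤-trans (<⇒≤ lt) (n≤1+n q))) (s≤s (m≤n⇒m≤1+n q<')) (m≤n⇒m≤1+n sp)
                (s≤s (m≤n⇒m≤1+n (<-trans lt q<'))) (M-hit⁺ v' e) (P.hit-intro v e')))

    μ : ℕ → ℕ
    μ p = if P.inZ (c (suc p)) then suc p else 2 + p

    μ-true : ∀ {p} → P.inZ (c (suc p)) ≡ true → μ p ≡ suc p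
    μ-true {p} e = cong (λ z → if z then suc p else 2 + p) e

    μ-false : ∀ {p} → P.inZ (c (suc p)) ≡ false → μ p ≡ 2 + p
    μ-false {p} e = cong (λ z → if z then suc p else 2 + p) e

    record Missed (p : ℕ) : Set where
      field
        μ∈Z    : P.inZ (c (μ p)) ≡ true
        missed : b ≁ c (μ p)

    abstract
      ordinary-info : ∀ {p} → p ∈ ordinary → 2 + s ≤ p × p < s + L × a ~ c p × exc p ≡ false
      ordinary-info {p} i with ∈-sel⁻ _ (range (2 + s) m) i
      ... | j , h with ∧-split {a-nbr p} h
      ... | e , g = proj₁ (window-pos j) , proj₂ (window-pos j) , e , not-true⇒false g

    ordinary-missed : ∀ {p} → p ∈ ordinary → Missed p
    ordinary-missed {p} i = by-successor (ordinary-info i) (bool-split (P.inZ (c (suc p))))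
      where
      by-successor : 2 + s ≤ p × p < s + L × a ~ c p × exc p ≡ false → P.inZ (c (suc p)) ≡ true ⊎ P.inZ (c (suc p)) ≡ false → Missed p
      by-successor (sp , p< , e , x') (inj₁ eq) = record
        { μ∈Z = subst (λ t → P.inZ (c t) ≡ true) (sym (μ-true eq)) eq
        ; missed = subst (λ t → b ≁ c t) (sym (μ-true eq)) (not-adjacent (m≤n⇒m<n∨m≡n sp)) }
        where
        not-adjacent : 2 + s < p ⊎ 2 + s ≡ p → b ≁ c (suc p)
        not-adjacent (inj₁ h) = ¬~⇒≁ {G = G} (insert h p< e)
        not-adjacent (inj₂ refl) = ⊥-elim (true≢false (~ˢ u₃) (P.Z-x eq))
      by-successor (sp , p< , e , x') (inj₂ eq) = record
        { μ∈Z = subst (λ t → P.inZ (c t) ≡ true) (sym (μ-false eq)) (proj₁ both)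
        ; missed = subst (λ t → b ≁ c t) (sym (μ-false eq)) (proj₂ both) }
        where
        both : P.inZ (c (2 + p)) ≡ true × b ≁ c (2 + p)
        both with bool-split (U (suc p))
        ... | inj₁ v = P.f∈Z v , trans (sym (cong (_∧ adj G b (c (2 + p))) v)) x'
        -- Now `c p` and `c (suc p)` are both in T; the exclusions decide the remaining memberships
        -- in turn and put `c (2 + p)` into Z and Z⁻.
        ... | inj₂ v = inZ⁺ , M.Z-indep b∈Z⁻ inZ⁻
          where
            w∉U : U p ≡ false
            w∉U = ¬~⇒≁ {G = G} (λ w → true≢false (P.f∈Z w) eq)
            w∈T : P.inZ (c p) ≡ false
            w∈T = P-T' (~ˢ e) a∈Z
            w∈Z⁻ : M.inZ (c p) ≡ true
            w∈Z⁻ with bool-split (M.inZ (c p))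
            ... | inj₁ h = h
            ... | inj₂ h = ⊥-elim (no-TT-with-first-in-T⁻ w∉U v w∈T eq h)
            w⁺∈T⁻ : M.inZ (c (suc p)) ≡ false
            w⁺∈T⁻ = M-T' (~ˢ (c-adj p)) w∈Z⁻
            w⁺⁺∉U : U (2 + p) ≡ false
            w⁺⁺∉U = ¬~⇒≁ {G = G} (λ w → true≢false (in-M w) w⁺∈T⁻)
            inZ⁺ : P.inZ (c (2 + p)) ≡ true
            inZ⁺ with bool-split (P.inZ (c (2 + p)))
            ... | inj₁ h = h
            ... | inj₂ h = ⊥-elim (no-TT-with-first-in-T⁻ v w⁺⁺∉U eq h w⁺∈T⁻)
            inZ⁻ : M.inZ (c (2 + p)) ≡ true
            inZ⁻ with bool-split (M.inZ (c (2 + p)))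
            ... | inj₁ h = h
            ... | inj₂ h = ⊥-elim (no-T-T⁻-T⁻ w∉U v w⁺⁺∉U w∈T w⁺∈T⁻ h)

    μ-cases : ∀ p → μ p ≡ suc p ⊎ μ p ≡ 2 + p
    μ-cases p = [ (λ h → inj₁ (μ-true h)) , (λ h → inj₂ (μ-false h)) ]′ (bool-split (P.inZ (c (suc p))))

    -- A collision would make two neighbours of `a` consecutive.
    μ-inj : ∀ {p q} → p ∈ ordinary → q ∈ ordinary → μ p ≡ μ q → p ≡ q
    μ-inj {p} {q} i j e with μ-cases p | μ-cases q | ordinary-info i | ordinary-info j
    ... | inj₁ h | inj₁ h' | _ | _ = suc-injective (trans (sym h) (trans e h'))
    ... | inj₂ h | inj₂ h' | _ | _ = suc-injective (suc-injective (trans (sym h) (trans e h')))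
    ... | inj₁ h | inj₂ h' | (_ , _ , g , _) | (sq , q< , g' , _) with suc-injective (trans (sym h) (trans e h'))
    ... | refl = ⊥-elim (no-consecutive sq q< g' g)
    μ-inj {p} {q} i j e | inj₂ h | inj₁ h' | (sp , p< , g , _) | (_ , _ , g' , _) with suc-injective (trans (sym h) (trans e h'))
    ... | refl = ⊥-elim (no-consecutive sp p< g g')

    ordinary-few : suc (length ordinary) ≤ k'
    ordinary-few = subst (λ l → suc l ≤ k') (trans (length-map c (map μ ordinary)) (length-map μ ordinary)) (P.few-misses b∈T
      (All.tabulate (λ i eq → let (q , _ , e) = ∈-map⁻ c i in ox q (trans eq e)) ∷ᵘ
        Unique-c (3 + s) (Unique-map μ μ-inj (Unique-sel _ (Unique-range (2 + s) m))) (All.map⁺ (All.tabulate in-window)))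
      (P.x∈Z ∷ᵃ All.map⁺ (All.map⁺ (All.tabulate (λ i → Missed.μ∈Z (ordinary-missed i)))))
      (U≁ n₂ ∷ᵃ All.map⁺ (All.map⁺ (All.tabulate (λ i → Missed.missed (ordinary-missed i))))))
      where
        in-window : ∀ {p} → p ∈ ordinary → 3 + s ≤ μ p × μ p < 3 + s + L
        in-window {p} i with μ-cases p | ordinary-info i
        ... | inj₁ h | (sp , p< , _) = subst (λ t → 3 + s ≤ t × t < 3 + s + L) (sym h) (s≤s sp , s≤s (m≤n⇒m≤1+n (m≤n⇒m≤1+n p<)))
        ... | inj₂ h | (sp , p< , _) = subst (λ t → 3 + s ≤ t × t < 3 + s + L) (sym h) (s≤s (m≤n⇒m≤1+n sp) , s≤s (s≤s (m≤n⇒m≤1+n p<)))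

    -- There are at most `k' - 1` ordinary neighbours and one exception in the window, and `c s`
    -- outside it.
    degree-a≤k : degree G a ≤ suc k'
    degree-a≤k = ≮⇒≥ (λ g → lin 0 (g ⊕ ordinary-few ⊕ at-most-one-exception ⊕ covered ⊕ ≤-reflexive split)
        (arith (degree G a) k' (length ordinary) (cnt (λ p → a-nbr p ∧ exc p) (2 + s) m) (cnt a-nbr (2 + s) m)))
      where
        split : cnt a-nbr (2 + s) m ≡ cnt (λ p → a-nbr p ∧ exc p) (2 + s) m + length ordinary
        split = length-sel-split a-nbr exc (range (2 + s) m)
        covered : degree G a ≤ suc (cnt a-nbr (2 + s) m)
        covered = subst₂ _≤_ (sym (degree≡ G a)) (cong suc (length-map c (sel a-nbr (range (2 + s) m))))
          (Unique-⊆⇒length≤ {ys = c s ∷ map c (sel a-nbr (range (2 + s) m))} (Unique-sel (adj G a) (allFin⁺ n)) inc)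
          where
            inc : ∀ {v} → v ∈ sel (adj G a) (allFin n) → v ∈ c s ∷ map c (sel a-nbr (range (2 + s) m))
            inc {v} i with proj₂ (∈-sel⁻ (adj G a) (allFin n) i) | on? v
            ... | e | no h = ⊥-elim (true≢false e (P.Z-indep a∈Z (P.off∈Z (off h))))
            ... | e | yes j with ∈-map⁻ c j
            ... | q₀ , _ , refl with reduce (2 + s) q₀
            ... | q , sq , q< , h with h 0
            ... | q₀≡ with m≤n⇒m<n∨m≡n (≤-pred q<)
            ... | inj₂ refl = ⊥-elim (~⇒≢ {G = G} e (sym (trans q₀≡ a-wrap)))
            ... | inj₁ q<' with m≤n⇒m<n∨m≡n (≤-pred q<')
            ... | inj₂ refl = here (trans q₀≡ (c-per s))
            ... | inj₁ q<'' = there (subst (_∈ map c (sel a-nbr (range (2 + s) m))) (sym q₀≡)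
                    (∈-map⁺ c (∈-sel⁺ a-nbr (range (2 + s) m) (∈-range⁺ (2 + s) m sq (subst (q <_) (sym end≡) q<'')) (subst (a ~_) q₀≡ e))))
        arith : ∀ δ k' o x' t → suc (suc k') + (suc o + (x' + (δ + t))) ≡ suc (0 + (δ + (k' + (1 + (suc t + (x' + o))))))
        arith δ k' o x' t = solve (δ ∷ k' ∷ o ∷ x' ∷ t ∷ [])

    degree-a≥ : suc (cnt (M.hit a) (2 + s) L) ≤ degree G a
    degree-a≥ = subst₂ _≤_ (cong suc (length-map M.f (sel (M.hit a) (range (2 + s) L)))) (sym (degree≡ G a))
      (Unique-⊆⇒length≤ {xs = c s ∷ map M.f (sel (M.hit a) (range (2 + s) L))}
        (All.tabulate (λ i eq → new i eq) ∷ᵘ M.Unique-f (2 + s) (Unique-sel _ (Unique-range (2 + s) L)) (All.tabulate (λ i → ∈-range⁻ (2 + s) L (proj₁ (∈-sel⁻ (M.hit a) (range (2 + s) L) i)))))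
        inc)
      where
        hits : ∀ {v} → v ∈ map M.f (sel (M.hit a) (range (2 + s) L)) → ∃ λ q → M.hit a q ≡ true × v ≡ M.f q
        hits i with ∈-map⁻ M.f i
        ... | q , q∈ , e = q , proj₂ (∈-sel⁻ (M.hit a) (range (2 + s) L) q∈) , e
        new : ∀ {v} → v ∈ map M.f (sel (M.hit a) (range (2 + s) L)) → c s ≢ v
        new i eq with hits i
        ... | q , h , e = true≢false (~ˢ u₀) (subst (_≁ x) (sym (trans eq e)) (M.Z-x (M.f∈Z (M.hit-U a q h))))
        inc : ∀ {v} → v ∈ c s ∷ map M.f (sel (M.hit a) (range (2 + s) L)) → v ∈ sel (adj G a) (allFin n)
        inc (here refl) = ∈-sel⁺ (adj G a) (allFin n) (∈-allFin _) (~ˢ (c-adj s))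
        inc (there i) with hits i
        ... | q , h , refl = ∈-sel⁺ (adj G a) (allFin n) (∈-allFin _) (M.hit-adj a q h)

    -- From above, `3 k' ≤ 2 (k' + 1)`. From below, `c s` and the predecessor hits give
    -- `d + 2 - k' ≤ k' + 1`, so `d < 2 k'`, which with `3 k' ≤ 2 d` excludes `k' = 1`.
    k'≡2 : k' ≡ 2
    k'≡2 = ≤-antisym
      (≮⇒≥ λ g → lin 0 (g ⊕ min-degree a ⊕ degree-a≤k ⊕ degree-a≤k) (arith₁ k' (degree G a)))
      (≮⇒≥ λ g → lin 0 (g ⊕ 3k'≤2d ⊕ many ⊕ many ⊕ degree-a≥ ⊕ degree-a≥ ⊕ degree-a≤k ⊕ degree-a≤k)
        (arith₂ k' d (cnt (M.hit a) (2 + s) L) (degree G a)))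
      where
        many : suc d ≤ k' + cnt (M.hit a) (2 + s) L
        many = M.many-hits a∈T⁻ (U≁ n₁) (2 + s)
        arith₁ : ∀ k' δ → 3 + (3 * k' + (δ + δ)) ≡ suc (0 + (k' + (2 * δ + (suc k' + suc k'))))
        arith₁ k' δ = solve (k' ∷ δ ∷ [])
        arith₂ : ∀ k' d h δ → suc k' + (3 * k' + (suc d + (suc d + (suc h + (suc h + (δ + δ)))))) ≡
          suc (0 + (2 + (2 * d + (k' + h + (k' + h + (δ + (δ + (suc k' + suc k'))))))))
        arith₂ k' d h δ = solve (k' ∷ d ∷ h ∷ δ ∷ [])

  -- The extremal case

  four-neighbours : ∀ {s p₁ p₂ p₃ p₄} → s ≤ p₁ → p₁ < p₂ → p₂ < p₃ → p₃ < p₄ → p₄ < s + L →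
    U p₁ ≡ true → U p₂ ≡ true → U p₃ ≡ true → U p₄ ≡ true → 4 ≤ d
  four-neighbours {s} {p₁} {p₂} {p₃} {p₄} a b e f g u₁ u₂ u₃ u₄ = subst (4 ≤_) (cnt-U s) (cnt-lower U s L (p₁ ∷ p₂ ∷ p₃ ∷ p₄ ∷ [])
    ((<⇒≢ b ∷ᵃ <⇒≢ (<-trans b e) ∷ᵃ <⇒≢ (<-trans b (<-trans e f)) ∷ᵃ []ᵃ) ∷ᵘ (<⇒≢ e ∷ᵃ <⇒≢ (<-trans e f) ∷ᵃ []ᵃ) ∷ᵘ (<⇒≢ f ∷ᵃ []ᵃ) ∷ᵘ []ᵃ ∷ᵘ []ᵘ)
    ((a , <-trans b (<-trans e (<-trans f g)) , u₁) ∷ᵃ (≤-trans a (<⇒≤ b) , <-trans e (<-trans f g) , u₂)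
      ∷ᵃ (≤-trans a (<⇒≤ (<-trans b e)) , <-trans f g , u₃) ∷ᵃ (≤-trans a (<⇒≤ (<-trans b (<-trans e f))) , g , u₄) ∷ᵃ []ᵃ))

  module Nine {s : ℕ} (u₀ : U s ≡ true) (u₃ : U (3 + s) ≡ true) where

    abstract
      k'≡2 : k' ≡ 2
      k'≡2 = ShortSegment.k'≡2 u₀ u₃

      d≡3 : d ≡ 3
      d≡3 = ≤-antisym
        (≮⇒≥ λ g → lin 0 (g ⊕ many ⊕ degree-a≥ ⊕ degree-a≤k ⊕ ≤-reflexive k'≡2 ⊕ ≤-reflexive k'≡2)
          (arith₁ k' d (cnt (M.hit a) (2 + s) L) (degree G a)))
        (≮⇒≥ λ g → lin 1 (g ⊕ g ⊕ 3k'≤2d ⊕ k'≥2 ⊕ k'≥2 ⊕ k'≥2) (arith₂ d k'))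
        where
          open ShortSegment u₀ u₃ hiding (k'≡2)
          many : suc d ≤ k' + cnt (M.hit a) (2 + s) L
          many = M.many-hits a∈T⁻ (U≁ n₁) (2 + s)
          k'≥2 : 2 ≤ k'
          k'≥2 = ≤-reflexive (sym k'≡2)
          arith₁ : ∀ k' d h δ → 4 + (suc d + (suc h + (δ + (k' + k')))) ≡ suc (0 + (d + (k' + h + (δ + (suc k' + (2 + 2))))))
          arith₁ k' d h δ = solve (k' ∷ d ∷ h ∷ δ ∷ [])
          arith₂ : ∀ d k' → suc d + (suc d + (3 * k' + (2 + (2 + 2)))) ≡ suc (1 + (3 + (3 + (2 * d + (k' + (k' + k'))))))
          arith₂ d k' = solve (d ∷ k' ∷ [])

    not-four : 4 ≤ d → ⊥
    not-four h = <-irrefl refl (subst (4 ≤_) d≡3 h)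

    abstract
      -- `c (2 + t)` is a predecessor outside Z, so `short-segment` applies to the window starting
      -- at `3 + t`. Its `q` is followed there by two more neighbours of x, so `d = 3` forces
      -- `q = 3 + t`.
      next-short : ∀ {t} → U t ≡ true → U (3 + t) ≡ true → U (6 + t) ≡ true
      next-short {t} v₀ v₃ with bool-split (U (6 + t))
      ... | inj₁ h = h
      ... | inj₂ h = ⊥-elim (short-segment v₃ (ShortSegment.b∈T v₀ v₃)
          (λ {q} {p} {p₂} sq qp pp₂ p₂< uq up' up₂ uq₃ → case m≤n⇒m<n∨m≡n sq of λ
            { (inj₁ lt) → not-four (four-neighbours ≤-refl lt qp pp₂ p₂< v₃ uq up' up₂)
            ; (inj₂ refl) → true≢false uq₃ h }))

      every-third : ∀ q → U (q * 3 + s) ≡ true × U (suc q * 3 + s) ≡ true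
      every-third zero = u₀ , u₃
      every-third (suc q) = let (v₀ , v₃) = every-third q in v₃ , next-short v₀ v₃

    u₆ : U (6 + s) ≡ true
    u₆ = proj₂ (every-third 1)

    u₉ : U (9 + s) ≡ true
    u₉ = proj₂ (every-third 2)

    six-positions : ∀ {p} → s ≤ p → p < 6 + s → p ∈ s ∷ 1 + s ∷ 2 + s ∷ 3 + s ∷ 4 + s ∷ 5 + s ∷ []
    six-positions {p} a b = ∈-range⁺ s 6 a (subst (p <_) (+-comm 6 s) b)

    abstract
      L≡9 : L ≡ 9
      -- Position `L + s` is again a neighbour of x, whereas `7 + s` follows one and `8 + s`
      -- precedes one.
      L≡9 = ≤-antisym L≤9 (≤∧≢⇒< (≤∧≢⇒< 7≤L (λ e → wrap 7 e (U-next u₆))) (λ e → wrap 8 e (prev-U u₉)))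
        where
          s+ : ∀ {i j} → i < j → i + s < j + s
          s+ = +-monoˡ-≤ s
          wrap : ∀ i → i ≡ L → U (i + s) ≡ false → ⊥
          wrap i refl h = true≢false u₀ (trans (sym (U-per s)) (trans (cong U (+-comm s i)) h))
          L≤9 : L ≤ 9
          L≤9 = ≮⇒≥ (λ g → not-four (four-neighbours ≤-refl (lit 0 3) (lit 3 6) (lit 6 9)
            (subst (9 + s <_) (+-comm L s) (s+ g)) u₀ u₃ u₆ u₉))
          7≤L : 7 ≤ L
          7≤L = ≮⇒≥ (λ g → too-few (≤-trans (≤-reflexive (sym (trans (cnt-U s) d≡3)))
            (Unique-⊆⇒length≤ {ys = s ∷ 3 + s ∷ []} (Unique-sel U (Unique-range s L)) (inc g))))
            where
              too-few : 3 ≤ 2 → ⊥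
              too-few (s≤s (s≤s ()))
              inc : L < 7 → ∀ {p} → p ∈ sel U (range s L) → p ∈ s ∷ 3 + s ∷ []
              inc g {p} i with ∈-sel⁻ U (range s L) i
              ... | j , u with ∈-range⁻ s L j
              ... | sp , p< with six-positions sp (<-≤-trans p< (subst (_≤ 6 + s) (+-comm L s) (+-monoˡ-≤ s (≤-pred g))))
              ... | here refl = here refl
              ... | there (here refl) = ⊥-elim (true≢false u (U-next u₀))
              ... | there (there (here refl)) = ⊥-elim (true≢false u (prev-U u₃))
              ... | there (there (there (here refl))) = there (here refl)
              ... | there (there (there (there (here refl)))) = ⊥-elim (true≢false u (U-next u₃))
              ... | there (there (there (there (there (here refl))))) = ⊥-elim (true≢false u (prev-U u₆))

    per₉ : ∀ i → c (9 + i) ≡ c i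
    per₉ i = trans (cong c (trans (+-comm 9 i) (cong (i +_) (sym L≡9)))) (c-per i)

    module Segment {t : ℕ} (v₀ : U t ≡ true) (v₃ : U (3 + t) ≡ true) where

      open ShortSegment v₀ v₃ hiding (k'≡2) public

      v₆ : U (6 + t) ≡ true
      v₆ = next-short v₀ v₃

      v₉ : U (9 + t) ≡ true
      v₉ = next-short v₃ v₆

      t+L : t + L ≡ 9 + t
      t+L = trans (cong (t +_) L≡9) (+-comm t 9)

      <t+L : ∀ {i} → i < 9 → i + t < t + L
      <t+L {i} h = subst (i + t <_) (sym t+L) (+-monoˡ-≤ t h)

      e-≢ : ∀ {i j} → i < j → j < 9 → c (i + t) ≢ c (j + t)
      e-≢ {i} h h' = c-inj t (m≤n+m t i) (+-monoˡ-≤ t h) (<t+L h')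

      abstract
        U-positions : ∀ {p} → 2 + t ≤ p → p < 2 + t + L → U p ≡ true → Third t p
        U-positions {p} a' b' u = cases (∈-range⁺ {p} (2 + t) 9 a' (subst (λ l → p < 2 + t + l) L≡9 b'))
          where
          cases : p ∈ range (2 + t) 9 → Third t p
          cases (here refl) = ⊥-elim (true≢false u n₂)
          cases (there (here refl)) = inj₁ refl
          cases (there (there (here refl))) = ⊥-elim (true≢false u (U-next v₃))
          cases (there (there (there (here refl)))) = ⊥-elim (true≢false u (prev-U v₆))
          cases (there (there (there (there (here refl))))) = inj₂ (inj₁ refl)
          cases (there (there (there (there (there (here refl)))))) = ⊥-elim (true≢false u (U-next v₆))
          cases (there (there (there (there (there (there (here refl))))))) = ⊥-elim (true≢false u (prev-U v₉))
          cases (there (there (there (there (there (there (there (here refl)))))))) = inj₂ (inj₂ refl)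
          cases (there (there (there (there (there (there (there (there (here refl))))))))) = ⊥-elim (true≢false u (U-next v₉))

      -- Two predecessor hits of `a` come weakly before two successor hits of `b`, on three
      -- positions in all; they meet in the middle one.
      crossing : M.hit a (6 + t) ≡ true × P.hit b (6 + t) ≡ true
      crossing = compare (two-elements (P.hit b) (2 + t) L (P.two-hits b∈T (U≁ n₂) (2 + t)))
          (two-elements (M.hit a) (2 + t) L (M.two-hits a∈T⁻ (U≁ n₁) (2 + t)))
        where
        compare : (∃ λ p → ∃ λ q → 2 + t ≤ p × p < q × q < 2 + t + L × P.hit b p ≡ true × P.hit b q ≡ true) →
          (∃ λ p → ∃ λ q → 2 + t ≤ p × p < q × q < 2 + t + L × M.hit a p ≡ true × M.hit a q ≡ true) →
          M.hit a (6 + t) ≡ true × P.hit b (6 + t) ≡ true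
        compare (p , q , sp , pq , q< , hp , hq) (p' , q' , sp' , pq' , q<' , hp' , hq') =
          subst (λ z → M.hit a z ≡ true) (proj₂ both) hq' , subst (λ z → P.hit b z ≡ true) (proj₁ both) hp
          where
            both : p ≡ 6 + t × q' ≡ 6 + t
            both = middle (U-positions sp (<-trans pq q<) (P.hit-U b p hp)) (U-positions (≤-trans sp (<⇒≤ pq)) q< (P.hit-U b q hq))
              (U-positions sp' (<-trans pq' q<') (M.hit-U a p' hp')) (U-positions (≤-trans sp' (<⇒≤ pq')) q<' (M.hit-U a q' hq'))
              pq pq' (minus≼plus-next (≤-trans sp' (<⇒≤ pq')) q<' sp (<-trans pq q<) hq' hp)

      a~5 : a ~ c (5 + t)
      a~5 = M-hit⁻ (proj₁ crossing)

      b~7 : b ~ c (7 + t)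
      b~7 = P.hit-adj b (6 + t) (proj₂ crossing)

      b≁4 : b ≁ c (4 + t)
      b≁4 = ¬~⇒≁ {G = G} (λ e → lin 2 (minus≼plus-next {6 + t} {3 + t} (in₁ 4) (in₂ (lit₀ 6 9)) (in₁ 1) (in₂ (lit₀ 3 9))
          (proj₁ crossing) (P.hit-intro v₃ e)) (arith t))
        where
          arith : ∀ t → 6 + t ≡ suc (2 + (3 + t))
          arith t = refl
          in₁ : ∀ i → 2 + t ≤ suc (suc i) + t
          in₁ i = s≤s (s≤s (m≤n+m t i))
          in₂ : ∀ {i} → i < 9 → i + t < 2 + t + L
          in₂ h = m≤n⇒m≤1+n (m≤n⇒m≤1+n (<t+L h))

      -- With x and `c (4 + t)`, a second vertex off the cycle would be a third vertex of Z missed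
      -- by `b`, but `k' = 2`.
      x-only : ∀ {y} → Off y → y ≡ x
      x-only {y} oy with y ≟ᶠ x
      ... | yes e = e
      ... | no y≢x = ⊥-elim (lin 0 (P.few-misses b∈T
          (((λ e → y≢x (sym e)) ∷ᵃ ox (4 + t) ∷ᵃ []ᵃ) ∷ᵘ (oy (4 + t) ∷ᵃ []ᵃ) ∷ᵘ []ᵃ ∷ᵘ []ᵘ)
          (P.x∈Z ∷ᵃ P.off∈Z oy ∷ᵃ P.f∈Z v₃ ∷ᵃ []ᵃ)
          (U≁ n₂ ∷ᵃ M.Z-indep b∈Z⁻ (M.off∈Z oy) ∷ᵃ b≁4 ∷ᵃ []ᵃ) ⊕ ≤-reflexive k'≡2) (arith k'))
        where
          arith : ∀ k' → 3 + k' ≡ suc (0 + (k' + 2))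
          arith k' = solve (k' ∷ [])

      -- `a` has degree at most 3, and three neighbours are known.
      a-only : ∀ {v} → c t ≢ v → b ≢ v → c (5 + t) ≢ v → a ≁ v
      a-only {v} h₀ h₂ h₅ = ¬~⇒≁ {G = G} (λ e → lin 0 (four e ⊕ degree-a≤k ⊕ ≤-reflexive k'≡2) (arith k' (degree G a)))
        where
          arith : ∀ k' δ → 4 + (δ + k') ≡ suc (0 + (δ + (suc k' + 2)))
          arith k' δ = solve (k' ∷ δ ∷ [])
          four : a ~ v → 4 ≤ degree G a
          four e = subst (4 ≤_) (sym (degree≡ G a)) (Unique-⊆⇒length≤ {xs = c t ∷ b ∷ c (5 + t) ∷ v ∷ []}
            ((e-≢ (lit₀ 0 2) (lit₀ 2 9) ∷ᵃ e-≢ (lit₀ 0 5) (lit₀ 5 9) ∷ᵃ h₀ ∷ᵃ []ᵃ)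
              ∷ᵘ (e-≢ (lit₀ 2 5) (lit₀ 5 9) ∷ᵃ h₂ ∷ᵃ []ᵃ) ∷ᵘ (h₅ ∷ᵃ []ᵃ) ∷ᵘ []ᵃ ∷ᵘ []ᵘ)
            λ { (here refl) → nb (~ˢ (c-adj t)) ; (there (here refl)) → nb a~b
              ; (there (there (here refl))) → nb a~5 ; (there (there (there (here refl)))) → nb e })
            where
              nb : ∀ {w} → a ~ w → w ∈ sel (adj G a) (allFin n)
              nb e = ∈-sel⁺ (adj G a) (allFin n) (∈-allFin _) e

      9≤ : 9 + t ≤ t + L
      9≤ = ≤-reflexive (sym t+L)

      b≁5 : b ≁ c (5 + t)
      b≁5 = M.Z-indep b∈Z⁻ (in-M v₆)

      b≁8 : b ≁ c (8 + t)
      b≁8 = M.Z-indep b∈Z⁻ (in-M v₉)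

      b≁6 : b ≁ c (6 + t)
      b≁6 = ¬~⇒≁ {G = G} (insert {5 + t} (<⇒≤ (lit 3 5)) (<t+L (lit₀ 5 9)) a~5)

      b≁0 : b ≁ c t
      b≁0 = ¬~⇒≁ {G = G} (λ e → only-x (suc t)
        (pt x ⟨ v₆ ⟩ up 6≤ ⟨ at-wrap (~ˢ e) ⟩ pt b ⟨ ~ˢ a~b ⟩ pt a ⟨ a~5 ⟩ down (<⇒≤ (lit 3 5))) (~ˢ v₃)
        (prep x (↭-trans (↭-chord (I (3 + t) (5 + t)) (I (6 + t) (t + L)) [ a ] [ b ])
          (↭-reflexive (sym (trans (frame (≤-trans (<⇒≤ (lit 3 6)) 6≤))
            (cong (λ J → b ∷ J ++ [ a ]) (I-++ {3 + t} {5 + t} {t + L} (<⇒≤ (lit 3 5)) 6≤))))))))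
        where
          6≤ : 6 + t ≤ t + L
          6≤ = ≤-trans (<⇒≤ (lit 6 9)) 9≤

    -- u₁ u₂ x u₃ a₃ b₁ a₁ b₂ a₂ b₃ is a hamiltonian cycle of the Petersen graph with the edge u₁u₂ added.
    no-chord : ∀ {t} → U t ≡ true → U (3 + t) ≡ true → c t ≁ c (3 + t)
    no-chord {t} v₀ v₃ = ¬~⇒≁ {G = G} (λ e → only-x t
        (up 9≤ ⟨ at-wrap e ⟩ up (≤-refl {3 + t}) ⟨ ~ˢ v₃ ⟩ pt x ⟨ v₆ ⟩ up (<⇒≤ (lit 6 7)) ⟨ ~ˢ b~7 ⟩
          down (<⇒≤ (lit 1 2)) ⟨ a~5 ⟩ down (<⇒≤ (lit 4 5)) ⟨ Segment.a~5 v₃ v₆ ⟩ up (≤-refl {8 + t}))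
        (c-adj (8 + t))
        (↭-trans (↭-seven (I (1 + t) (2 + t)) (I (3 + t) (3 + t)) (I (4 + t) (5 + t)) (I (6 + t) (7 + t)) (I (8 + t) (8 + t)) (I (9 + t) (t + L)) [ x ])
          (↭-reflexive (cong (x ∷_) (sym split)))))
      where
        open Segment v₀ v₃
        beyond : ∀ i {p : T (i <ᵇ 9)} → i + t < t + L
        beyond i {p} = <t+L (<ᵇ⇒< i 9 p)
        split : I (1 + t) (t + L) ≡ I (1 + t) (2 + t) ++ I (3 + t) (3 + t) ++ I (4 + t) (5 + t) ++ I (6 + t) (7 + t) ++ I (8 + t) (8 + t) ++ I (9 + t) (t + L)
        split = trans (I-++ {1 + t} {2 + t} {t + L} (<⇒≤ (lit 1 2)) (beyond 2)) (cong (I (1 + t) (2 + t) ++_)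
          (trans (I-++ {3 + t} {3 + t} {t + L} ≤-refl (beyond 3)) (cong (I (3 + t) (3 + t) ++_)
          (trans (I-++ {4 + t} {5 + t} {t + L} (<⇒≤ (lit 4 5)) (beyond 5)) (cong (I (4 + t) (5 + t) ++_)
          (trans (I-++ {6 + t} {7 + t} {t + L} (<⇒≤ (lit 6 7)) (beyond 7)) (cong (I (6 + t) (7 + t) ++_)
          (I-++ {8 + t} {8 + t} {t + L} ≤-refl (beyond 8)))))))))

  -- Identification with the Petersen graph

  module Isomorphism {s : ℕ} (u₀ : U s ≡ true) (u₃ : U (3 + s) ≡ true) where
    open Nine u₀ u₃

    -- The segments at `t`, `3 + t` and `6 + t` satisfy the same hypotheses. Several entries for
    -- `c t` are read off the other two by symmetry of adjacency, after a full turn where needed.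
    segment-row : ∀ {t} → U t ≡ true → U (3 + t) ≡ true → ∀ r δ → r < 3 → δ < 9 → adj G (c (r + t)) (c (δ + (r + t))) ≡ row r δ
    segment-row {t} v₀ v₃ = rows
      where
        module S₀ = Segment v₀ v₃
        module S₁ = Segment v₃ S₀.v₆
        module S₂ = Segment S₀.v₆ S₀.v₉
        e≢ : ∀ i j {p : T (i <ᵇ j)} {q : T (j <ᵇ 9)} → c (i + t) ≢ c (j + t)
        e≢ i j {p} {q} = S₀.e-≢ (<ᵇ⇒< i j p) (<ᵇ⇒< j 9 q)
        e≢˘ : ∀ i j {p : T (i <ᵇ j)} {q : T (j <ᵇ 9)} → c (j + t) ≢ c (i + t)
        e≢˘ i j {p} {q} = ≢-sym (e≢ i j {p} {q})
        wrap : ∀ {b v} i → adj G v (c i) ≡ b → adj G v (c (9 + i)) ≡ b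
        wrap {b} {v} i = subst (λ w → adj G v w ≡ b) (sym (per₉ i))
        unwrap : ∀ {b v} i → adj G v (c (9 + i)) ≡ b → adj G v (c i) ≡ b
        unwrap {b} {v} i = subst (λ w → adj G v w ≡ b) (per₉ i)
        rows : ∀ r δ → r < 3 → δ < 9 → adj G (c (r + t)) (c (δ + (r + t))) ≡ row r δ
        rows 0 0 _ _ = adj-irrefl G _
        rows 0 1 _ _ = c-adj t
        rows 0 2 _ _ = ~ˢ S₀.b≁0
        rows 0 3 _ _ = no-chord v₀ v₃
        rows 0 4 _ _ = ~ˢ (S₁.a-only (e≢˘ 0 3) (e≢˘ 0 5) (e≢˘ 0 8))
        rows 0 5 _ _ = ~ˢ (unwrap t S₁.b≁6)
        rows 0 6 _ _ = ~ˢ (unwrap t (no-chord S₀.v₆ S₀.v₉))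
        rows 0 7 _ _ = ~ˢ (S₂.a-only (e≢˘ 0 6) (e≢˘ 0 8) (λ e → e≢˘ 0 2 (trans (sym (per₉ (2 + t))) e)))
        rows 0 8 _ _ = ~ˢ (unwrap t (c-adj (8 + t)))
        rows 1 0 _ _ = adj-irrefl G _
        rows 1 1 _ _ = S₀.a~b
        rows 1 2 _ _ = S₀.a-only (e≢ 0 3) (e≢ 2 3) (e≢˘ 3 5)
        rows 1 3 _ _ = S₀.a-only (e≢ 0 4) (e≢ 2 4) (e≢˘ 4 5)
        rows 1 4 _ _ = S₀.a~5
        rows 1 5 _ _ = S₀.a-only (e≢ 0 6) (e≢ 2 6) (e≢ 5 6)
        rows 1 6 _ _ = S₀.a-only (e≢ 0 7) (e≢ 2 7) (e≢ 5 7)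
        rows 1 7 _ _ = S₀.a-only (e≢ 0 8) (e≢ 2 8) (e≢ 5 8)
        rows 1 8 _ _ = wrap t (~ˢ (c-adj t))
        rows 2 0 _ _ = adj-irrefl G _
        rows 2 1 _ _ = c-adj (2 + t)
        rows 2 2 _ _ = S₀.b≁4
        rows 2 3 _ _ = S₀.b≁5
        rows 2 4 _ _ = S₀.b≁6
        rows 2 5 _ _ = S₀.b~7
        rows 2 6 _ _ = S₀.b≁8
        rows 2 7 _ _ = wrap t S₀.b≁0
        rows 2 8 _ _ = wrap (1 + t) (~ˢ S₀.a~b)
        rows (suc (suc (suc _))) _ (s≤s (s≤s (s≤s ()))) _
        rows 0 (suc (suc (suc (suc (suc (suc (suc (suc (suc _))))))))) _ (s≤s (s≤s (s≤s (s≤s (s≤s (s≤s (s≤s (s≤s (s≤s ())))))))))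
        rows 1 (suc (suc (suc (suc (suc (suc (suc (suc (suc _))))))))) _ (s≤s (s≤s (s≤s (s≤s (s≤s (s≤s (s≤s (s≤s (s≤s ())))))))))
        rows 2 (suc (suc (suc (suc (suc (suc (suc (suc (suc _))))))))) _ (s≤s (s≤s (s≤s (s≤s (s≤s (s≤s (s≤s (s≤s (s≤s ())))))))))

    vertex : Fin 10 → Fin n
    vertex zero = x
    vertex (suc i) = c (toℕ i + s)

    steps< : ∀ i j → i < 9 → j < 9 → steps i j < 9
    steps< i j i< j< with i ≤? j
    ... | yes _ = ≤-<-trans (m∸n≤m j i) j<
    ... | no h = +-cancelʳ-< i ((9 + j) ∸ i) 9 (subst (_< 9 + i) (sym (m∸n+n≡m (≤-trans (<⇒≤ i<) (m≤m+n 9 j)))) (+-monoʳ-< 9 (≰⇒> h)))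

    steps-c : ∀ i j → i < 9 → c (steps i j + (i + s)) ≡ c (j + s)
    steps-c i j i< with i ≤? j
    ... | yes h = cong c (trans (sym (+-assoc (j ∸ i) i s)) (cong (_+ s) (m∸n+n≡m h)))
    ... | no _ = trans (cong c (trans (sym (+-assoc ((9 + j) ∸ i) i s)) (cong (_+ s) (m∸n+n≡m (≤-trans (<⇒≤ i<) (m≤m+n 9 j)))))) (per₉ (j + s))

    mod-split : ∀ i → i + s ≡ i % 3 + (i / 3 * 3 + s)
    mod-split i = trans (cong (_+ s) (m≡m%n+[m/n]*n i 3)) (+-assoc (i % 3) (i / 3 * 3) s)

    cycle-adj : ∀ i j → i < 9 → j < 9 → adj G (c (i + s)) (c (j + s)) ≡ row (i % 3) (steps i j)
    cycle-adj i j i< j< = trans (cong₂ (adj G) (cong c (mod-split i)) (trans (sym (steps-c i j i<)) (cong (λ p → c (steps i j + p)) (mod-split i))))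
      (segment-row (proj₁ (every-third (i / 3))) (proj₂ (every-third (i / 3))) (i % 3) (steps i j) (m%n<n i 3) (steps< i j i< j<))

    x-adj : ∀ i → U (i + s) ≡ (i % 3 ≡ᵇ 0)
    x-adj i = trans (cong U (mod-split i)) (types (i % 3) (m%n<n i 3))
      where
        v₀ : U (i / 3 * 3 + s) ≡ true
        v₀ = proj₁ (every-third (i / 3))
        types : ∀ r → r < 3 → U (r + (i / 3 * 3 + s)) ≡ (r ≡ᵇ 0)
        types 0 _ = v₀
        types 1 _ = U-next v₀
        types 2 _ = prev-U (proj₂ (every-third (i / 3)))
        types (suc (suc (suc _))) (s≤s (s≤s (s≤s ())))

    vertex-adj : ∀ i j → adj G (vertex i) (vertex j) ≡ table i j
    vertex-adj zero zero = adj-irrefl G x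
    vertex-adj zero (suc j) = x-adj (toℕ j)
    vertex-adj (suc i) zero = ~ˢ (x-adj (toℕ i))
    vertex-adj (suc i) (suc j) = cycle-adj (toℕ i) (toℕ j) (toℕ<n i) (toℕ<n j)

    vertex-injective : ∀ i j → vertex i ≡ vertex j → i ≡ j
    vertex-injective zero zero e = refl
    vertex-injective zero (suc j) e = ⊥-elim (ox _ e)
    vertex-injective (suc i) zero e = ⊥-elim (ox _ (sym e))
    vertex-injective (suc i) (suc j) e = cong suc (toℕ-injective (+-cancelʳ-≡ s (toℕ i) (toℕ j)
      (c-inj-≡ s (m≤n+m s (toℕ i)) (bound i) (m≤n+m s (toℕ j)) (bound j) e)))
      where
        bound : ∀ (i : Fin 9) → toℕ i + s < s + L
        bound i = Segment.<t+L u₀ u₃ (toℕ<n i)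

    vertex-surjective : ∀ v → ∃ λ i → vertex i ≡ v
    vertex-surjective v = cases (on? v)
      where
        at : ∀ q → s ≤ q → q < s + L → ∃ λ i → vertex i ≡ c q
        at q sq q< = suc (fromℕ< q-s<9) , cong c (trans (cong (_+ s) (toℕ-fromℕ< q-s<9)) (m∸n+n≡m sq))
          where
            q-s<9 : q ∸ s < 9
            q-s<9 = +-cancelʳ-< s (q ∸ s) 9 (subst (_< 9 + s) (sym (m∸n+n≡m sq)) (subst (q <_) (Segment.t+L u₀ u₃) q<))
        cases : Dec (v ∈ map c (range 0 L)) → ∃ λ i → vertex i ≡ v
        cases (no h) = zero , sym (Segment.x-only u₀ u₃ (off h))
        cases (yes i) = let (q₀ , _ , e) = ∈-map⁻ c i ; (q , sq , q< , h) = reduce s q₀ ; (i' , e') = at q sq q< in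
          i' , trans e' (trans (sym (h 0)) (sym e))

    isPetersen : IsPetersen G
    isPetersen = mk↔ₛ′ to from to∘from from∘to , λ u v → trans (table-petersen (index u) (index v))
        (trans (sym (vertex-adj (index u) (index v))) (cong₂ (adj G) (vertex-index u) (vertex-index v)))
      where
        index : Fin n → Fin 10
        index v = proj₁ (vertex-surjective v)
        vertex-index : ∀ v → vertex (index v) ≡ v
        vertex-index v = proj₂ (vertex-surjective v)
        to : Fin n → Fin 10
        to v = label (index v)
        from : Fin 10 → Fin n
        from w = vertex (label⁻¹ w)
        to∘from : ∀ w → to (from w) ≡ w
        to∘from w = trans (cong label (vertex-injective (index (from w)) (label⁻¹ w) (vertex-index (from w)))) (label-label⁻¹ w)
        from∘to : ∀ v → from (to v) ≡ v
        from∘to v = trans (cong vertex (label⁻¹-label (index v))) (vertex-index v)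

  off-vertex⇒Petersen : 2 * α G ≤ n → IsPetersen G
  off-vertex⇒Petersen small-α = cases (U-T) refl
    where
      last-T : ℕ → Bool
      last-T p = U p ∧ not (P.inZ (M.f p))
      short : ℕ → Bool
      short p = U p ∧ U (3 + p)
      U-T : List ℕ
      U-T = sel last-T (range 1 L)
      -- The window of `short-segment` starts at `suc s ≤ L` and has length `L`, so two periods
      -- contain it.
      from-short : ∀ ps → ps ≡ sel short (range 0 (L + L)) → (∃ λ s → U (suc s) ≡ true × P.inZ (c s) ≡ false × s < L) → IsPetersen G
      from-short (p ∷ ps) e _ = let (_ , h) = ∈-sel⁻ short (range 0 (L + L)) (subst (p ∈_) e (here refl)) ; (v₀ , v₃) = ∧-split {U p} h in
        Isomorphism.isPetersen v₀ v₃
      from-short [] e (s , u , t , s<L) = ⊥-elim (short-segment u t λ {q} sq qp pp₂ p₂< uq _ _ uq₃ →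
          empty e (∈-sel⁺ short (range 0 (L + L)) (∈-range⁺ 0 (L + L) z≤n (<-trans (<-trans qp pp₂) (<-≤-trans p₂< (+-monoˡ-≤ L s<L))))
            (both uq uq₃)))
        where
          both : ∀ {q} → U q ≡ true → U (3 + q) ≡ true → short q ≡ true
          both a b rewrite a = b
          empty : ∀ {q} {ps : List ℕ} → [] ≡ ps → q ∈ ps → ⊥
          empty refl ()
      cases : ∀ ps → ps ≡ U-T → IsPetersen G
      cases [] e = ⊥-elim (Alternating.α-large pred∈Z small-α)
        where
          none : ∀ {p} → p ∈ U-T → ⊥
          none i with subst (_ ∈_) (sym e) i
          ... | ()
          pred∈Z : ∀ {r} → U (suc r) ≡ true → P.inZ (c r) ≡ true
          pred∈Z {r} u with bool-split (P.inZ (c r))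
          ... | inj₁ h = h
          ... | inj₂ h = let (q , a , b , h') = reduce 1 (suc r) in
            ⊥-elim (none (∈-sel⁺ last-T (range 1 L) (∈-range⁺ 1 L a b) (both q h' h)))
            where
              both : ∀ q → suc r ≈ q → P.inZ (c r) ≡ false → last-T q ≡ true
              both q h' h rewrite trans (sym (U-resp h')) u | trans (sym (h' (L ∸ 1))) (cp-suc r) | h = refl
      cases (suc p ∷ ps) e = found (∈-sel⁻ last-T (range 1 L) (subst (suc p ∈_) e (here refl)))
        where
          found : suc p ∈ range 1 L × last-T (suc p) ≡ true → IsPetersen G
          found (i , h) = let (u , t) = ∧-split {U (suc p)} h in
            from-short _ refl (p , u , subst (λ v → P.inZ v ≡ false) (M-f-suc p) (not-true⇒false t) , ≤-pred (proj₂ (∈-range⁻ 1 L i)))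
      cases (zero ∷ ps) e = bad (proj₁ (∈-range⁻ 1 L (proj₁ (∈-sel⁻ last-T (range 1 L) (subst (0 ∈_) e (here refl))))))
        where
          bad : 1 ≤ 0 → IsPetersen G
          bad ()

-- Existence of a longest cycle

module _ {n : ℕ} (G : Graph n) where

  Closed : List (Fin n) → Set
  Closed vs = ∃ λ u → ∃ λ v → Path G u v vs × adj G v u ≡ true × Unique vs

  OfLength : ℕ → Set
  OfLength m = ∃ λ vs → length vs ≡ m × Closed vs

  path? : ∀ t u vs → Dec (∃ λ v → Path G u v (u ∷ vs) × adj G v t ≡ true)
  path? t u [] = map′ (λ e → u , stop , e) (λ { (_ , stop , e) → e }) (adj G u t ≟ᵇ true)
  path? t u (w ∷ vs) = map′ (λ { (e , v , p , f) → v , go e p , f }) inv ((adj G u w ≟ᵇ true) ×-dec path? t w vs)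
    where
      inv : (∃ λ v → Path G u v (u ∷ w ∷ vs) × adj G v t ≡ true) →
        adj G u w ≡ true × ∃ λ v → Path G w v (w ∷ vs) × adj G v t ≡ true
      inv (v , go {vs = _ ∷ _} e stop , f) = e , v , stop , f
      inv (v , go {vs = _ ∷ _} e (go e' p) , f) = e , v , go e' p , f

  closed? : ∀ vs → Dec (Closed vs)
  closed? [] = no (λ { (_ , _ , () , _) })
  closed? (u ∷ vs) = map′ (λ { ((v , p , e) , h) → u , v , p , e , h }) inv (path? u u vs ×-dec unique? (u ∷ vs))
    where
      open DecUnique (_≟ᶠ_ {n}) using (unique?)
      inv : Closed (u ∷ vs) → (∃ λ v → Path G u v (u ∷ vs) × adj G v u ≡ true) × Unique (u ∷ vs)
      inv (_ , v , stop , e , h) = (v , stop , e) , h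
      inv (_ , v , go f p , e , h) = (v , go f p , e) , h

  list? : ∀ m {P : List (Fin n) → Set} → (∀ vs → Dec (P vs)) → Dec (∃ λ vs → length vs ≡ m × P vs)
  list? zero P? = map′ (λ p → [] , refl , p) (λ { ([] , _ , p) → p }) (P? [])
  list? (suc m) P? = map′ (λ { (v , vs , e , p) → v ∷ vs , cong suc e , p })
    (λ { (v ∷ vs , e , p) → v , vs , suc-injective e , p }) (any? (λ v → list? m (λ vs → P? (v ∷ vs))))

  Closed-length : ∀ {vs} → Closed vs → length vs ≤ n
  Closed-length {vs} (_ , _ , _ , _ , h) = subst (length vs ≤_) (length-allFin n) (Unique-⊆⇒length≤ h (λ {v} _ → ∈-allFin v))

  -- The search descends from a bound; the closed path of length `m` stops it before 0.
  maximal : ∀ j {m} → 1 ≤ m → OfLength m → (∀ i → j < i → OfLength i → ⊥) →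
    ∃ λ M → m ≤ M × OfLength M × (∀ i → M < i → OfLength i → ⊥)
  maximal zero 1≤m o none = ⊥-elim (none _ 1≤m o)
  maximal (suc j) {m} 1≤m o none = by-decision (list? (suc j) closed?)
    where
      by-decision : Dec (OfLength (suc j)) → ∃ λ M → m ≤ M × OfLength M × (∀ i → M < i → OfLength i → ⊥)
      by-decision (yes h) = suc j , ≮⇒≥ (λ lt → none m lt o) , h , none
      by-decision (no h) = maximal j 1≤m o (λ i lt o' → case m≤n⇒m<n∨m≡n lt of λ
        { (inj₁ lt') → none i lt' o' ; (inj₂ refl) → h o' })

module Periodic {n : ℕ} {G : Graph n} (y : Fin n) (zs : List (Fin n)) where

  -- The periodic extension of `y ∷ zs`, started with a remainder `ws` of a round; recursion on the
  -- index avoids division.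
  seq : List (Fin n) → ℕ → Fin n
  seq [] zero = y
  seq [] (suc i) = seq zs i
  seq (w ∷ ws) zero = w
  seq (w ∷ ws) (suc i) = seq ws i

  seq-[] : ∀ i → seq [] i ≡ seq (y ∷ zs) i
  seq-[] zero = refl
  seq-[] (suc i) = refl

  seq-period : ∀ ws i → seq ws (length ws + i) ≡ seq [] i
  seq-period [] i = refl
  seq-period (w ∷ ws) i = seq-period ws i

  seq-list : ∀ ws → map (seq ws) (range 0 (length ws)) ≡ ws
  seq-list [] = refl
  seq-list (w ∷ ws) = cong (w ∷_) (trans (shifted (seq (w ∷ ws)) 0 (length ws)) (seq-list ws))
    where
      shifted : ∀ {A : Set} (f : ℕ → A) s m → map f (range (suc s) m) ≡ map (f ∘ suc) (range s m)
      shifted f s zero = refl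
      shifted f s (suc m) = cong (f (suc s) ∷_) (shifted f (suc s) m)

  seq-head : ∀ {w v ws} → Path G w v ws → seq ws 0 ≡ w
  seq-head stop = refl
  seq-head (go _ _) = refl

  module _ {u v : Fin n} (closed : Path G u v (y ∷ zs)) (v~u : adj G v u ≡ true) where

    u≡y : u ≡ y
    u≡y = sym (seq-head closed)

    seq-adj : ∀ {w ws} → Path G w v ws → ∀ i → adj G (seq ws i) (seq ws (suc i)) ≡ true
    seq-adj stop zero = subst (λ t → adj G v t ≡ true) u≡y v~u
    seq-adj stop (suc i) = subst₂ (λ s t → adj G s t ≡ true) (sym (seq-[] i)) refl (seq-adj closed i)
    seq-adj (go e p) zero = subst (λ t → adj G _ t ≡ true) (sym (seq-head p)) e
    seq-adj (go e p) (suc i) = seq-adj p i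

longest-cycle : ∀ {n} (G : Graph n) {M} → 1 ≤ M → OfLength G M → (∀ i → M < i → OfLength G i → ⊥) →
  ∃ λ (C : LongestCycle G) → LongestCycle.L C ≡ M
longest-cycle {n} G {M} 1≤M ([] , refl , _) _ with 1≤M
... | ()
longest-cycle {n} G {M} 1≤M (y ∷ zs , refl , u , v , p , e , h) none = record
  { L = M ; 1≤L = 1≤M ; c = c ; c-per = c-per ; c-adj = seq-adj p e p ; c-uniq = c-uniq
  ; longest = λ q f h' lt → none _ lt (_ , refl , _ , _ , q , f , h') } , refl
  where
    open Periodic {G = G} y zs
    c : ℕ → Fin n
    c = seq (y ∷ zs)
    c-per : ∀ i → c (i + M) ≡ c i
    c-per i = trans (cong c (+-comm i M)) (trans (seq-period (y ∷ zs) i) (seq-[] i))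
    c-uniq : ∀ s → Unique (map c (range s M))
    c-uniq zero = subst Unique (sym (seq-list (y ∷ zs))) h
    -- Moving the window by one moves its first vertex to the end.
    c-uniq (suc s) = Unique-↭ (↭-trans (↭-++-comm [ c s ] (map c (range (suc s) (length zs)))) (↭-reflexive (sym last))) (c-uniq s)
      where
        last : map c (range (suc s) M) ≡ map c (range (suc s) (length zs)) ++ [ c s ]
        last = trans (cong (map c) (range-∷ʳ (suc s) (length zs))) (trans (map-++ c (range (suc s) (length zs)) _)
          (cong (λ t → map c (range (suc s) (length zs)) ++ [ t ]) (trans (cong c (sym (+-suc s (length zs)))) (c-per s))))

spanning⇒Hamiltonian : ∀ {n} {G : Graph n} (C : LongestCycle G) → 3 ≤ LongestCycle.L C → LongestCycle.L C ≡ n → Hamiltonian G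
spanning⇒Hamiltonian {n} {G} C 3≤L L≡n = subst (3 ≤_) L≡n 3≤L , (λ i → c (toℕ i)) , inj , edges
  where
    open Cyc C
    bound : ∀ (i : Fin n) → toℕ i < 0 + L
    bound i = subst (toℕ i <_) (sym L≡n) (toℕ<n i)
    inj : ∀ {i j : Fin n} → c (toℕ i) ≡ c (toℕ j) → i ≡ j
    inj {i} {j} e = toℕ-injective (c-inj-≡ 0 z≤n (bound i) z≤n (bound j) e)
    edges : ∀ (i j : Fin n) → (toℕ j ≡ suc (toℕ i) ⊎ (toℕ i ≡ n ∸ 1 × toℕ j ≡ 0)) → c (toℕ i) ~ c (toℕ j)
    edges i j (inj₁ e) = subst (λ t → c (toℕ i) ~ c t) (sym e) (c-adj (toℕ i))
    edges i j (inj₂ (e , e')) = subst (λ v → c (toℕ i) ~ v) (trans (c-per 0) (cong c (sym e')))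
      (subst (λ t → c (toℕ i) ~ c t) (trans (cong suc e) (trans (m+[n∸m]≡n (subst (1 ≤_) L≡n 1≤L)) (sym L≡n))) (c-adj (toℕ i)))

-- As `k ≥ 2`, removing `v₀` leaves a connected graph, where a path joins two neighbours of `v₀`.
-- The length 3 matters because a single edge, run to and fro, is a closed path of length 2.
some-cycle : ∀ {n k} {G : Graph n} → 2 ≤ k → KConnected k G → (∀ v → 2 ≤ degree G v) → ∃ λ m → 3 ≤ m × OfLength G m
some-cycle {suc n} {k} {G} 2≤k (_ , conn) deg = build (two (sel (adj G v₀) (allFin (suc n))) (subst (2 ≤_) (degree≡ G v₀) (deg v₀)) (Unique-sel (adj G v₀) (allFin⁺ (suc n))))
  where
    v₀ : Fin (suc n)
    v₀ = zero
    two : ∀ (vs : List (Fin (suc n))) → 2 ≤ length vs → Unique vs → ∃ λ u → ∃ λ w → u ∈ vs × w ∈ vs × u ≢ w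
    two (u ∷ w ∷ vs) _ ((u≢w ∷ᵃ _) ∷ᵘ _) = u , w , here refl , there (here refl) , u≢w
    two (_ ∷ []) (s≤s ()) _
    ∉v₀ : ∀ {u} → adj G v₀ u ≡ true → u ∉ˢ ⁅ v₀ ⁆
    ∉v₀ e i = ~⇒≢ {G = G} e (sym (x∈⁅y⁆⇒x≡y v₀ i))
    long : ∀ {u w vs} → u ≢ w → Path G u w vs → 2 ≤ length vs
    long u≢w stop = ⊥-elim (u≢w refl)
    long u≢w (go _ p) = s≤s (length-Path p)
    build : (∃ λ u → ∃ λ w → u ∈ sel (adj G v₀) (allFin (suc n)) × w ∈ sel (adj G v₀) (allFin (suc n)) × u ≢ w) →
      ∃ λ m → 3 ≤ m × OfLength G m
    build (u , w , i , j , u≢w) =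
      let e = proj₂ (∈-sel⁻ (adj G v₀) (allFin (suc n)) i) ; f = proj₂ (∈-sel⁻ (adj G v₀) (allFin (suc n)) j)
          (vs , p , h , a) = Walk⇒Path (∉v₀ e) (ConnectedIn⇒Walk (conn ⁅ v₀ ⁆ (subst (_< k) (sym (∣⁅x⁆∣≡1 v₀)) 2≤k) u w (∉v₀ e) (∉v₀ f)))
      in _ , s≤s (long u≢w p) , v₀ ∷ vs , refl , v₀ , w , go e p , ~-sym {G = G} f ,
         All.map (λ v∉ v≡ → v∉ (subst (_∈ˢ ⁅ v₀ ⁆) v≡ (x∈⁅x⁆ v₀))) a ∷ᵘ h

-- From a longest cycle to the theorem

module _ {n : ℕ} {G : Graph n} (C : LongestCycle G) where
  open Cyc C
  open Dominating C using (on?; off)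

  spanning-or-off : L ≡ n ⊎ ∃ λ x → Off x
  spanning-or-off = cases (any? (λ v → ¬? (on? v)))
    where
      L≤n : L ≤ n
      L≤n = subst₂ _≤_ (trans (length-map c (range 0 L)) (length-range 0 L)) (length-allFin n) (Unique-⊆⇒length≤ (c-uniq 0) (λ {v} _ → ∈-allFin v))
      cases : Dec (∃ λ v → ¬ (v ∈ map c (range 0 L))) → L ≡ n ⊎ ∃ λ x → Off x
      cases (yes (x , h)) = inj₂ (x , off h)
      cases (no h) = inj₁ (≤-antisym L≤n (subst₂ _≤_ (length-allFin n) (trans (length-map c (range 0 L)) (length-range 0 L))
        (Unique-⊆⇒length≤ (allFin⁺ n) (λ {v} _ → decidable-stable (on? v) (λ g → h (v , g))))))

theorem1p6 : (k n : ℕ) → 2 ≤ k → (G : Graph n) →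
    KConnected k G →
    Free (K2∪kK1 k) G →
    (∀ v → 3 * (k ∸ 1) ≤ 2 * degree G v) →
    2 * α G ≤ n →
    Hamiltonian G ⊎ IsPetersen G
theorem1p6 (suc k') n 2≤k@(s≤s 1≤k') G conn free deg small-α = with-cycle (some-cycle 2≤k conn deg≥2)
  where
    deg≥2 : ∀ v → 2 ≤ degree G v
    deg≥2 v = ≮⇒≥ (λ g → lin 0 (deg v ⊕ g ⊕ g ⊕ 1≤k' ⊕ 1≤k' ⊕ 1≤k') (arith k' (degree G v)))
      where
        arith : ∀ k' δ → 3 * k' + (suc δ + (suc δ + (1 + (1 + 1)))) ≡ suc (0 + (2 * δ + (2 + (2 + (k' + (k' + k'))))))
        arith k' δ = solve (k' ∷ δ ∷ [])
    with-longest : ∀ (C : LongestCycle G) → 3 ≤ LongestCycle.L C → Hamiltonian G ⊎ IsPetersen G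
    with-longest C 3≤L = cases (spanning-or-off C)
      where
        cases : LongestCycle.L C ≡ n ⊎ (∃ λ x → Cyc.Off C x) → Hamiltonian G ⊎ IsPetersen G
        cases (inj₁ L≡n) = inj₁ (spanning⇒Hamiltonian C 3≤L L≡n)
        cases (inj₂ (x , ox)) = inj₂ (Core.off-vertex⇒Petersen C 1≤k' free (λ oy oz → Dominating.off-independent C conn free oy oz) deg x ox small-α)
    with-cycle : (∃ λ m → 3 ≤ m × OfLength G m) → Hamiltonian G ⊎ IsPetersen G
    with-cycle (m , 3≤m , o) = finish (maximal G n (≤-trans (s≤s z≤n) 3≤m) o (λ { _ lt (_ , refl , h) → <-irrefl refl (<-≤-trans lt (Closed-length G h)) }))
      where
        finish : (∃ λ M → m ≤ M × OfLength G M × (∀ i → M < i → OfLength G i → ⊥)) → Hamiltonian G ⊎ IsPetersen G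
        finish (M , m≤M , o' , none) = let (C , L≡M) = longest-cycle G (≤-trans (s≤s z≤n) (≤-trans 3≤m m≤M)) o' none in
          with-longest C (subst (3 ≤_) (sym L≡M) (≤-trans 3≤m m≤M))
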